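{- Let $N\ge1$, $Z_N=Z(\mathrm U(\mathfrak q_N))$, $b_r=c_{2r-1}$ ($r\ge1$) with $c_{2r-1}$ Sergeev's odd cyclic elements, and $\Delta_N=\det(b_{i+j-1})_{1\le i,j\le N}\in Z_N$. Put $x_i=\lambda_i(\lambda_i-1)$, $y_i=\lambda_i(\lambda_i+1)$ for $1\le i\le N$, and $$P_N(z)=\prod_{j=1}^N(1-y_jz),\qquad Q_N(z)=\prod_{i=1}^N(1-x_iz).$$ Then $$\mathrm{HC}(\Delta_N)=(-1)^{\binom N2}\operatorname{Res}(Q_N,P_N)=(-1)^{\binom N2}\prod_{i,j=1}^N(\lambda_i+\lambda_j)\prod_{i\ne j}(\lambda_i-\lambda_j-1),$$ where the last product is over ordered pairs $(i,j)$ with $i\ne j$. In particular, $\Delta_N\ne0$.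
   Context: Ground field $\mathbb C$. Queer Lie superalgebra: fix $N\ge1$, $I_N=\{ -N,\dots,-1,1,\dots,N\}$, $\bar i=0$ if $i>0$ and $\bar i=1$ if $i<0$. Let $E_{ij}$ ($i,j\in I_N$) be the matrix units of $\mathfrak{gl}(N|N)$, of parity $\bar i+\bar j$ mod $2$. $\mathfrak q_N\subset\mathfrak{gl}(N|N)$ is the Lie sub-superalgebra spanned by $F_{ij}=E_{ij}+E_{ -i,-j}$ (so $F_{ -i,-j}=F_{ij}$). $\mathrm U(\mathfrak q_N)$ is its universal enveloping algebra and $Z_N=Z(\mathrm U(\mathfrak q_N))$ its center (in the superalgebra sense; all central elements are even). Harish-Chandra map: $\mathfrak h_{\bar0}=\bigoplus_{i=1}^N\mathbb C F_{ii}$, $\mathfrak h_{\bar 1}=\bigoplus_{i=1}^N\mathbb C F_{i,-i}$, $\mathfrak n_+$ (resp. $\mathfrak n_-$) is the span of $F_{ij},F_{i,-j}$ with $1\le i<j\le N$ (resp. $1\le j<i\le N$). For $z\in Z_N$, $\mathrm{HC}(z)\in\mathbb C[\lambda_1,\dots,\lambda_N]$ is the polynomial with $z\equiv \mathrm{HC}(z)|_{\lambda_i=F_{ii}}$ modulo $\mathfrak n_-\mathrm U(\mathfrak q_N)+\mathrm U(\mathfrak q_N)\mathfrak n_+$ (no $\rho$-shift). It is known that $\mathrm{HC}$ is an algebra isomorphism of $Z_N$ onto $\Gamma_N$, the algebra of symmetric polynomials $f\in\mathbb C[\lambda_1,\dots,\lambda_N]$ such that $f(t,-t,\lambda_3,\dots,\lambda_N)$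 is independent of $t$ (no condition if $N=1$). Cyclic elements: for $r\ge1$, $$c_r=\sum_{i_1,\dots,i_r\in I_N}(-1)^{\bar i_2+\cdots+\bar i_r}F_{i_1i_2}F_{i_2i_3}\cdots F_{i_ri_1}\in \mathrm U(\mathfrak q_N);$$ these are known to be central. Resultant: $P_N,Q_N$ are polynomials in $z$ of degree $N$ over $K=\mathbb C(\lambda_1,\dots,\lambda_N)$. If $f$ has degree $m$, leading coefficient $a_f$ and roots $\alpha_1,\dots,\alpha_m$ with multiplicity, then $\operatorname{Res}(f,g)=a_f^{\deg g}\prod_{k=1}^mg(\alpha_k)$. -}

module Defs where

open import Algebra.Apartness.Bundles using (HeytingField; HeytingCommutativeRing)
open import Algebra.Bundles using (CommutativeRing; RawMonoid; RawRing; Ring)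
import Algebra.Consequences.Setoid as Consequences
import Algebra.Definitions.RawMonoid as RawMonoidDefs
import Algebra.Definitions.RawSemiring as RawSemiringDefs
import Algebra.Properties.CommutativeSemigroup as CommSemigroupProps
import Algebra.Properties.Ring as RingProps
import Algebra.Solver.Ring.NaturalCoefficients.Default as SemiringSolver
open import Data.Bool.Base using (Bool; _∧_; if_then_else_)
open import Data.Fin.Base as Fin using (Fin; zero; suc; toℕ; punchIn)
import Data.Fin.Properties as Finₚ
open import Data.List.Base using (List; []; _∷_; map)
open import Data.Nat.Base as ℕ using (ℕ; zero; suc)
open import Data.Nat.Combinatorics using (_C_)
open import Data.Parity.Base as ℙ using (Parity; 0ℙ; 1ℙ)
open import Data.Product.Base using (Σ; Σ-syntax; _×_; _,_)
open import Data.Sign.Base as Sign using (Sign)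
import Data.Sign.Properties as Signₚ
open import Data.Vec.Base using (Vec; []; _∷_)
open import Level using (_⊔_)
open import Relation.Binary.Bundles using (Setoid)
open import Relation.Binary.Core using (Rel)
open import Relation.Binary.PropositionalEquality.Core using (_≢_)
open import Relation.Nullary.Decidable.Core using (does)
open import Relation.Nullary.Negation.Core using (¬_)

------------------------------------------------------------------------

fieldRing : ∀ {c ℓ₁ ℓ₂} → HeytingField c ℓ₁ ℓ₂ → CommutativeRing c ℓ₁
fieldRing K =
  HeytingCommutativeRing.commutativeRing (HeytingField.heytingCommutativeRing K)

CharZero : ∀ {c ℓ₁ ℓ₂} → HeytingField c ℓ₁ ℓ₂ → Set ℓ₂
CharZero K = ∀ n → (suc n ·1) # 0#
  where
  open HeytingField K using (_#_; 0#; 1#)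
  _·1 : ℕ → HeytingField.Carrier K
  n ·1 = RawMonoidDefs._×_ (CommutativeRing.+-rawMonoid (fieldRing K)) n 1#

module BigOperators {c ℓ} (A : Ring c ℓ) where
  open RawSemiringDefs (RawRing.rawSemiring (Ring.rawRing A)) public
    using (sum; product; _^_)

------------------------------------------------------------------------

-- Expansion along the first row.  Over a noncommutative ring this is the
-- Leibniz sum with the factors of each product ordered by row.
det : ∀ {c ℓ} (A : Ring c ℓ) {n : ℕ} →
      (Fin n → Fin n → Ring.Carrier A) → Ring.Carrier A
det A {zero}  M = Ring.1# A
det A {suc n} M = sum λ j →
    ((- 1#) ^ toℕ j) * M zero j * det A (λ i k → M (suc i) (punchIn j k))
  where
  open Ring A using (_*_; -_; 1#)
  open BigOperators A using (sum; _^_)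

------------------------------------------------------------------------
-- Univariate polynomials: coefficient lists, constant term first.
-- Trailing zeros are allowed, so equality is equality of all coefficients.

module Polynomial {c ℓ} (R : CommutativeRing c ℓ) where

  open CommutativeRing R hiding (zero)
  open BigOperators ring using (product; _^_)
  private
    module RP = RingProps ring
    module CS = CommSemigroupProps +-commutativeSemigroup

  Poly : Set c
  Poly = List Carrier

  coeff : Poly → ℕ → Carrier
  coeff []      k       = 0#
  coeff (a ∷ p) zero    = a
  coeff (a ∷ p) (suc k) = coeff p k

  infix 4 _≈ₚ_
  record _≈ₚ_ (p q : Poly) : Set ℓ where
    constructor coeffwise
    field coeff-≈ : ∀ k → coeff p k ≈ coeff q k
  open _≈ₚ_ public

  infixl 6 _+ₚ_
  _+ₚ_ : Poly → Poly → Poly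
  []      +ₚ q       = q
  (a ∷ p) +ₚ []      = a ∷ p
  (a ∷ p) +ₚ (b ∷ q) = a + b ∷ p +ₚ q

  scale : Carrier → Poly → Poly
  scale a = map (a *_)

  -ₚ_ : Poly → Poly
  -ₚ_ = map (-_)

  infixl 7 _*ₚ_
  _*ₚ_ : Poly → Poly → Poly
  []      *ₚ q = []
  (a ∷ p) *ₚ q = scale a q +ₚ (0# ∷ p *ₚ q)

  const : Carrier → Poly
  const a = a ∷ []

  X : Poly
  X = 0# ∷ 1# ∷ []

  private
    reflₚ : ∀ {p} → p ≈ₚ p
    reflₚ .coeff-≈ k = refl

    symₚ : ∀ {p q} → p ≈ₚ q → q ≈ₚ p
    symₚ e .coeff-≈ k = sym (e .coeff-≈ k)

    transₚ : ∀ {p q r} → p ≈ₚ q → q ≈ₚ r → p ≈ₚ r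
    transₚ e f .coeff-≈ k = trans (e .coeff-≈ k) (f .coeff-≈ k)

    ∷-cong : ∀ {a b p q} → a ≈ b → p ≈ₚ q → a ∷ p ≈ₚ b ∷ q
    ∷-cong e f .coeff-≈ zero    = e
    ∷-cong e f .coeff-≈ (suc k) = f .coeff-≈ k

    tail-≈ : ∀ {a b p q} → a ∷ p ≈ₚ b ∷ q → p ≈ₚ q
    tail-≈ e .coeff-≈ k = e .coeff-≈ (suc k)

    polySetoid : Setoid c ℓ
    polySetoid = record { Carrier = Poly ; _≈_ = _≈ₚ_ ; isEquivalence = record
      { refl  = λ {p} → reflₚ {p}
      ; sym   = λ {p} {q} → symₚ {p} {q}
      ; trans = λ {p} {q} {r} → transₚ {p} {q} {r} } }

    open Consequences polySetoid

    0∷[] : 0# ∷ [] ≈ₚ []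
    0∷[] .coeff-≈ zero    = refl
    0∷[] .coeff-≈ (suc k) = refl

  coeff-+ : ∀ p q k → coeff (p +ₚ q) k ≈ coeff p k + coeff q k
  coeff-+ []      q       k       = sym (+-identityˡ _)
  coeff-+ (a ∷ p) []      k       = sym (+-identityʳ _)
  coeff-+ (a ∷ p) (b ∷ q) zero    = refl
  coeff-+ (a ∷ p) (b ∷ q) (suc k) = coeff-+ p q k

  coeff-scale : ∀ a p k → coeff (scale a p) k ≈ a * coeff p k
  coeff-scale a []      k       = sym (zeroʳ a)
  coeff-scale a (b ∷ p) zero    = refl
  coeff-scale a (b ∷ p) (suc k) = coeff-scale a p k

  coeff-neg : ∀ p k → coeff (-ₚ p) k ≈ - coeff p k
  coeff-neg []      k       = sym RP.-0#≈0#
  coeff-neg (b ∷ p) zero    = refl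
  coeff-neg (b ∷ p) (suc k) = coeff-neg p k

  private
    +ₚ-cong : ∀ {p p′ q q′} → p ≈ₚ p′ → q ≈ₚ q′ → p +ₚ q ≈ₚ p′ +ₚ q′
    +ₚ-cong {p} {p′} {q} {q′} e f .coeff-≈ k = trans (coeff-+ p q k)
      (trans (+-cong (e .coeff-≈ k) (f .coeff-≈ k)) (sym (coeff-+ p′ q′ k)))

    +ₚ-assoc : ∀ p q r → (p +ₚ q) +ₚ r ≈ₚ p +ₚ (q +ₚ r)
    +ₚ-assoc p q r .coeff-≈ k =
      trans (coeff-+ (p +ₚ q) r k)
      (trans (+-congʳ (coeff-+ p q k))
      (trans (+-assoc _ _ _)
      (trans (+-congˡ (sym (coeff-+ q r k)))
      (sym (coeff-+ p (q +ₚ r) k)))))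

    +ₚ-comm : ∀ p q → p +ₚ q ≈ₚ q +ₚ p
    +ₚ-comm p q .coeff-≈ k =
      trans (coeff-+ p q k) (trans (+-comm _ _) (sym (coeff-+ q p k)))

    +ₚ-identityʳ : ∀ p → p +ₚ [] ≈ₚ p
    +ₚ-identityʳ p .coeff-≈ k = trans (coeff-+ p [] k) (+-identityʳ _)

    -ₚ-inverseʳ : ∀ p → p +ₚ (-ₚ p) ≈ₚ []
    -ₚ-inverseʳ p .coeff-≈ k = trans (coeff-+ p (-ₚ p) k)
      (trans (+-congˡ (coeff-neg p k)) (-‿inverseʳ _))

    -ₚ-cong : ∀ {p q} → p ≈ₚ q → -ₚ p ≈ₚ -ₚ q
    -ₚ-cong {p} {q} e .coeff-≈ k = trans (coeff-neg p k)
      (trans (-‿cong (e .coeff-≈ k)) (sym (coeff-neg q k)))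

    +ₚ-interchange : ∀ p q r s → (p +ₚ q) +ₚ (r +ₚ s) ≈ₚ (p +ₚ r) +ₚ (q +ₚ s)
    +ₚ-interchange p q r s .coeff-≈ k =
      trans (coeff-+ (p +ₚ q) (r +ₚ s) k)
      (trans (+-cong (coeff-+ p q k) (coeff-+ r s k))
      (trans (CS.interchange _ _ _ _)
      (trans (+-cong (sym (coeff-+ p r k)) (sym (coeff-+ q s k)))
      (sym (coeff-+ (p +ₚ r) (q +ₚ s) k)))))

    scale-cong : ∀ {a b p q} → a ≈ b → p ≈ₚ q → scale a p ≈ₚ scale b q
    scale-cong {a} {b} {p} {q} e f .coeff-≈ k = trans (coeff-scale a p k)
      (trans (*-cong e (f .coeff-≈ k)) (sym (coeff-scale b q k)))

    scale-0 : ∀ p → scale 0# p ≈ₚ []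
    scale-0 p .coeff-≈ k = trans (coeff-scale 0# p k) (zeroˡ _)

    scale-1 : ∀ p → scale 1# p ≈ₚ p
    scale-1 p .coeff-≈ k = trans (coeff-scale 1# p k) (*-identityˡ _)

    scale-+ : ∀ a p q → scale a (p +ₚ q) ≈ₚ scale a p +ₚ scale a q
    scale-+ a p q .coeff-≈ k =
      trans (coeff-scale a (p +ₚ q) k)
      (trans (*-congˡ (coeff-+ p q k))
      (trans (distribˡ _ _ _)
      (trans (+-cong (sym (coeff-scale a p k)) (sym (coeff-scale a q k)))
      (sym (coeff-+ (scale a p) (scale a q) k)))))

    +-scale : ∀ a b p → scale (a + b) p ≈ₚ scale a p +ₚ scale b p
    +-scale a b p .coeff-≈ k =
      trans (coeff-scale (a + b) p k)
      (trans (distribʳ _ _ _)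
      (trans (+-cong (sym (coeff-scale a p k)) (sym (coeff-scale b p k)))
      (sym (coeff-+ (scale a p) (scale b p) k))))

    scale-scale : ∀ a b p → scale (a * b) p ≈ₚ scale a (scale b p)
    scale-scale a b p .coeff-≈ k =
      trans (coeff-scale (a * b) p k)
      (trans (*-assoc _ _ _)
      (trans (*-congˡ (sym (coeff-scale b p k)))
      (sym (coeff-scale a (scale b p) k))))

    shift-+ : ∀ p q → 0# ∷ (p +ₚ q) ≈ₚ (0# ∷ p) +ₚ (0# ∷ q)
    shift-+ p q = ∷-cong (sym (+-identityˡ 0#)) reflₚ

    zero-*ₚ : ∀ p q → p ≈ₚ [] → p *ₚ q ≈ₚ []
    zero-*ₚ []      q e = reflₚ
    zero-*ₚ (a ∷ p) q e = transₚ
      (+ₚ-cong (transₚ (scale-cong {p = q} (e .coeff-≈ 0) reflₚ) (scale-0 q))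
               (∷-cong refl (zero-*ₚ p q (coeffwise λ k → e .coeff-≈ (suc k)))))
      0∷[]

    *ₚ-congʳ : ∀ p p′ q → p ≈ₚ p′ → p *ₚ q ≈ₚ p′ *ₚ q
    *ₚ-congʳ []      p′       q e = symₚ (zero-*ₚ p′ q (symₚ e))
    *ₚ-congʳ (a ∷ p) []       q e = zero-*ₚ (a ∷ p) q e
    *ₚ-congʳ (a ∷ p) (b ∷ p′) q e =
      +ₚ-cong (scale-cong {p = q} (e .coeff-≈ 0) reflₚ)
              (∷-cong refl (*ₚ-congʳ p p′ q (tail-≈ e)))

    *ₚ-congˡ : ∀ p q q′ → q ≈ₚ q′ → p *ₚ q ≈ₚ p *ₚ q′
    *ₚ-congˡ []      q q′ e = reflₚ
    *ₚ-congˡ (a ∷ p) q q′ e =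
      +ₚ-cong (scale-cong refl e) (∷-cong refl (*ₚ-congˡ p q q′ e))

    *ₚ-cong : ∀ {p p′ q q′} → p ≈ₚ p′ → q ≈ₚ q′ → p *ₚ q ≈ₚ p′ *ₚ q′
    *ₚ-cong {p} {p′} {q} {q′} e f =
      transₚ (*ₚ-congʳ p p′ q e) (*ₚ-congˡ p′ q q′ f)

    *ₚ-distribʳ : ∀ r p q → (p +ₚ q) *ₚ r ≈ₚ p *ₚ r +ₚ q *ₚ r
    *ₚ-distribʳ r []      q       = reflₚ
    *ₚ-distribʳ r (a ∷ p) []      = symₚ (+ₚ-identityʳ _)
    *ₚ-distribʳ r (a ∷ p) (b ∷ q) = transₚ
      (+ₚ-cong (+-scale a b r)
        (transₚ (∷-cong refl (*ₚ-distribʳ r p q)) (shift-+ (p *ₚ r) (q *ₚ r))))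
      (+ₚ-interchange (scale a r) (scale b r) _ _)

    scale-*ₚ : ∀ a p q → scale a p *ₚ q ≈ₚ scale a (p *ₚ q)
    scale-*ₚ a []      q = reflₚ
    scale-*ₚ a (b ∷ p) q = symₚ (transₚ
      (scale-+ a (scale b q) (0# ∷ p *ₚ q))
      (+ₚ-cong (symₚ (scale-scale a b q))
               (∷-cong (zeroʳ a) (symₚ (scale-*ₚ a p q)))))

    shift-*ₚ : ∀ p q → (0# ∷ p) *ₚ q ≈ₚ 0# ∷ p *ₚ q
    shift-*ₚ p q = +ₚ-cong (scale-0 q) reflₚ

    *ₚ-assoc : ∀ p q r → (p *ₚ q) *ₚ r ≈ₚ p *ₚ (q *ₚ r)
    *ₚ-assoc []      q r = reflₚ
    *ₚ-assoc (a ∷ p) q r = transₚ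
      (*ₚ-distribʳ r (scale a q) (0# ∷ p *ₚ q))
      (+ₚ-cong (scale-*ₚ a q r)
        (transₚ (shift-*ₚ (p *ₚ q) r) (∷-cong refl (*ₚ-assoc p q r))))

    *ₚ-zeroʳ : ∀ p → p *ₚ [] ≈ₚ []
    *ₚ-zeroʳ []      = reflₚ
    *ₚ-zeroʳ (a ∷ p) = transₚ (∷-cong refl (*ₚ-zeroʳ p)) 0∷[]

    *ₚ-∷ : ∀ p b q → p *ₚ (b ∷ q) ≈ₚ scale b p +ₚ (0# ∷ p *ₚ q)
    *ₚ-∷ []      b q = symₚ 0∷[]
    *ₚ-∷ (a ∷ p) b q = ∷-cong (+-congʳ (*-comm a b))
      (transₚ (+ₚ-cong {p = scale a q} reflₚ (*ₚ-∷ p b q))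
      (transₚ (symₚ (+ₚ-assoc (scale a q) (scale b p) _))
      (transₚ (+ₚ-cong (+ₚ-comm (scale a q) (scale b p)) reflₚ)
              (+ₚ-assoc (scale b p) (scale a q) _))))

    *ₚ-comm : ∀ p q → p *ₚ q ≈ₚ q *ₚ p
    *ₚ-comm p []      = *ₚ-zeroʳ p
    *ₚ-comm p (b ∷ q) = transₚ (*ₚ-∷ p b q)
      (+ₚ-cong {p = scale b p} reflₚ (∷-cong refl (*ₚ-comm p q)))

    *ₚ-identityˡ : ∀ p → const 1# *ₚ p ≈ₚ p
    *ₚ-identityˡ p =
      transₚ (+ₚ-cong (scale-1 p) 0∷[]) (+ₚ-identityʳ p)

  polyRing : CommutativeRing c ℓ
  polyRing = record
    { Carrier = Poly ; _≈_ = _≈ₚ_ ; _+_ = _+ₚ_ ; _*_ = _*ₚ_ ; -_ = -ₚ_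
    ; 0# = [] ; 1# = const 1#
    ; isCommutativeRing = record
      { isRing = record
        { +-isAbelianGroup = record
          { isGroup = record
            { isMonoid = record
              { isSemigroup = record
                { isMagma = record
                    { isEquivalence = Setoid.isEquivalence polySetoid
                    ; ∙-cong = +ₚ-cong }
                ; assoc   = +ₚ-assoc }
              ; identity = (λ _ → reflₚ) , +ₚ-identityʳ }
            ; inverse = comm∧invʳ⇒inv +ₚ-comm -ₚ-inverseʳ
            ; ⁻¹-cong = -ₚ-cong }
          ; comm = +ₚ-comm }
        ; *-cong     = *ₚ-cong
        ; *-assoc    = *ₚ-assoc
        ; *-identity = comm∧idˡ⇒id *ₚ-comm *ₚ-identityˡ
        ; distrib    = comm∧distrʳ⇒distr +ₚ-cong *ₚ-comm *ₚ-distribʳ }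
      ; *-comm = *ₚ-comm } }

  evaluate : Poly → Carrier → Carrier
  evaluate []      x = 0#
  evaluate (a ∷ p) x = a + x * evaluate p x

  record HasDegree (p : Poly) (n : ℕ) : Set ℓ where
    field
      leading≉0 : ¬ (coeff p n ≈ 0#)
      above     : ∀ k → n ℕ.< k → coeff p k ≈ 0#

  -- f = a (X - α₁) ⋯ (X - αₘ) with a ≠ 0.
  record Splitting (f : Poly) : Set (c ⊔ ℓ) where
    field
      degree    : ℕ
      leading   : Carrier
      roots     : Fin degree → Carrier
      leading≉0 : ¬ (leading ≈ 0#)
      splits    : f ≈ₚ const leading *ₚ
                    BigOperators.product (CommutativeRing.ring polyRing)
                      (λ k → X +ₚ (-ₚ const (roots k)))

  record IsResultant (f g : Poly) (ρ : Carrier) : Set (c ⊔ ℓ) where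
    field
      splitting : Splitting f
      degree-g  : ℕ
      hasDegree : HasDegree g degree-g
    open Splitting splitting public
    field
      ρ≈ : ρ ≈ (leading ^ degree-g) * product (λ k → evaluate g (roots k))

------------------------------------------------------------------------
-- Polynomials in n variables, as iterated univariate polynomials; the
-- variable with index zero is the outermost one.

MPoly : ∀ {c ℓ} → CommutativeRing c ℓ → ℕ → CommutativeRing c ℓ
MPoly K zero    = K
MPoly K (suc n) = Polynomial.polyRing (MPoly K n)

var : ∀ {c ℓ} (K : CommutativeRing c ℓ) {n} →
      Fin n → CommutativeRing.Carrier (MPoly K n)
var K {suc n} zero    = Polynomial.X (MPoly K n)
var K {suc n} (suc i) = Polynomial.const (MPoly K n) (var K i)

-- Substitution of ring elements for the variables; the result is the usual
-- one when the elements commute with each other and with the scalars.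
substitute : ∀ {c ℓ a ℓ′} (K : CommutativeRing c ℓ) (A : Ring a ℓ′) →
             (CommutativeRing.Carrier K → Ring.Carrier A) →
             ∀ {n} → (Fin n → Ring.Carrier A) →
             CommutativeRing.Carrier (MPoly K n) → Ring.Carrier A
substitute K A ι {zero}  x p = ι p
substitute K A ι {suc n} x p = horner p
  where
  open Ring A hiding (zero)
  horner : List (CommutativeRing.Carrier (MPoly K n)) → Carrier
  horner []      = 0#
  horner (a ∷ p) = substitute K A ι (λ i → x (suc i)) a + x zero * horner p

------------------------------------------------------------------------
-- The total ring of fractions.  The denominators are the regular (cancellable)
-- elements; in an integral domain these are the nonzero elements, and one
-- gets the field of fractions.

module Fractions {c ℓ} (R : CommutativeRing c ℓ) where

  open CommutativeRing R hiding (zero)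
  private
    module RP = RingProps ring

  Regular : Carrier → Set (c ⊔ ℓ)
  Regular d = ∀ {x y} → d * x ≈ d * y → x ≈ y

  regular-1 : Regular 1#
  regular-1 e = trans (sym (*-identityˡ _)) (trans e (*-identityˡ _))

  regular-* : ∀ {d e} → Regular d → Regular e → Regular (d * e)
  regular-* rd re eq =
    re (rd (trans (sym (*-assoc _ _ _)) (trans eq (*-assoc _ _ _))))

  infix 5 _/_[_]
  record Fraction : Set (c ⊔ ℓ) where
    no-eta-equality
    pattern
    constructor _/_[_]
    field
      num     : Carrier
      den     : Carrier
      regular : Regular den
  open Fraction public

  infix 4 _≈ᶠ_
  record _≈ᶠ_ (p q : Fraction) : Set ℓ where
    constructor cross
    field cross-≈ : num p * den q ≈ num q * den p
  open _≈ᶠ_ public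

  _+ᶠ_ _*ᶠ_ : Fraction → Fraction → Fraction
  (a / b [ rb ]) +ᶠ (c / d [ rd ]) = a * d + c * b / b * d [ regular-* rb rd ]
  (a / b [ rb ]) *ᶠ (c / d [ rd ]) = a * c / b * d [ regular-* rb rd ]

  -ᶠ_ : Fraction → Fraction
  -ᶠ (a / b [ rb ]) = - a / b [ rb ]

  fromRing : Carrier → Fraction
  fromRing a = a / 1# [ regular-1 ]

  private
    open SemiringSolver commutativeSemiring

    transᶠ : ∀ {p q r} → p ≈ᶠ q → q ≈ᶠ r → p ≈ᶠ r
    transᶠ {a / b [ rb ]} {c / d [ rd ]} {e / f [ rf ]} (cross s) (cross t) =
      cross (rd (trans (solve 3 (λ a d f → d :* (a :* f) := (a :* d) :* f) refl a d f)
                (trans (*-congʳ s)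
                (trans (solve 3 (λ b c f → (c :* b) :* f := (c :* f) :* b) refl b c f)
                (trans (*-congʳ t)
                (solve 3 (λ b d e → (e :* d) :* b := d :* (e :* b)) refl b d e))))))

    fractionSetoid : Setoid (c ⊔ ℓ) ℓ
    fractionSetoid = record { Carrier = Fraction ; _≈_ = _≈ᶠ_ ; isEquivalence = record
      { refl  = λ {p} → cross {p} {p} refl
      ; sym   = λ {p} {q} e → cross {q} {p} (sym (e .cross-≈))
      ; trans = λ {p} {q} {r} → transᶠ {p} {q} {r} } }

    open Consequences fractionSetoid

    *ᶠ-comm : ∀ p q → (p *ᶠ q) ≈ᶠ (q *ᶠ p)
    *ᶠ-comm (a / b [ _ ]) (c / d [ _ ]) = cross (solve 4 (λ a b c d →
      (a :* c) :* (d :* b) := (c :* a) :* (b :* d)) refl a b c d)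

    +ᶠ-cong : ∀ {p p′ q q′} → p ≈ᶠ p′ → q ≈ᶠ q′ → (p +ᶠ q) ≈ᶠ (p′ +ᶠ q′)
    +ᶠ-cong {a / b [ _ ]} {a′ / b′ [ _ ]} {c / d [ _ ]} {c′ / d′ [ _ ]}
            (cross s) (cross t) = cross
      (trans (solve 6 (λ a b c d b′ d′ →
                (a :* d :+ c :* b) :* (b′ :* d′) :=
                (a :* b′) :* (d :* d′) :+ (c :* d′) :* (b :* b′)) refl a b c d b′ d′)
      (trans (+-cong (*-congʳ s) (*-congʳ t))
      (solve 6 (λ a′ b c′ d b′ d′ →
                (a′ :* b) :* (d :* d′) :+ (c′ :* d) :* (b :* b′) :=
                (a′ :* d′ :+ c′ :* b′) :* (b :* d)) refl a′ b c′ d b′ d′)))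

    *ᶠ-cong : ∀ {p p′ q q′} → p ≈ᶠ p′ → q ≈ᶠ q′ → (p *ᶠ q) ≈ᶠ (p′ *ᶠ q′)
    *ᶠ-cong {a / b [ _ ]} {a′ / b′ [ _ ]} {c / d [ _ ]} {c′ / d′ [ _ ]}
            (cross s) (cross t) = cross
      (trans (solve 4 (λ a c b′ d′ →
                (a :* c) :* (b′ :* d′) := (a :* b′) :* (c :* d′)) refl a c b′ d′)
      (trans (*-cong s t)
      (solve 4 (λ a′ b c′ d →
                (a′ :* b) :* (c′ :* d) := (a′ :* c′) :* (b :* d)) refl a′ b c′ d)))

    -ᶠ-cong : ∀ {p q} → p ≈ᶠ q → (-ᶠ p) ≈ᶠ (-ᶠ q)
    -ᶠ-cong {a / b [ _ ]} {c / d [ _ ]} (cross s) = cross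
      (trans (sym (RP.-‿distribˡ-* a d))
      (trans (-‿cong s) (RP.-‿distribˡ-* c b)))

    +ᶠ-comm : ∀ p q → (p +ᶠ q) ≈ᶠ (q +ᶠ p)
    +ᶠ-comm (a / b [ _ ]) (c / d [ _ ]) = cross (solve 4 (λ a b c d →
      (a :* d :+ c :* b) :* (d :* b) := (c :* b :+ a :* d) :* (b :* d))
      refl a b c d)

    -ᶠ-inverseʳ : ∀ p → (p +ᶠ (-ᶠ p)) ≈ᶠ fromRing 0#
    -ᶠ-inverseʳ (a / b [ _ ]) = cross
      (trans (*-identityʳ _)
      (trans (sym (distribʳ b a (- a)))
      (trans (*-congʳ (-‿inverseʳ a))
      (trans (zeroˡ b) (sym (zeroˡ _))))))

  fractionRing : CommutativeRing (c ⊔ ℓ) ℓ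
  fractionRing = record
    { Carrier = Fraction ; _≈_ = _≈ᶠ_ ; _+_ = _+ᶠ_ ; _*_ = _*ᶠ_ ; -_ = -ᶠ_
    ; 0# = fromRing 0# ; 1# = fromRing 1#
    ; isCommutativeRing = record
      { isRing = record
        { +-isAbelianGroup = record
          { isGroup = record
            { isMonoid = record
              { isSemigroup = record
                { isMagma = record
                    { isEquivalence = Setoid.isEquivalence fractionSetoid
                    ; ∙-cong = +ᶠ-cong }
                ; assoc   = λ { (a / b [ _ ]) (c / d [ _ ]) (e / f [ _ ]) → cross
                    (solve 6 (λ a b c d e f →
                      ((a :* d :+ c :* b) :* f :+ e :* (b :* d)) :* (b :* (d :* f)) :=
                      (a :* (d :* f) :+ (c :* f :+ e :* d) :* b) :* ((b :* d) :* f))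
                      refl a b c d e f) } }
              ; identity = comm∧idʳ⇒id +ᶠ-comm λ { (a / b [ _ ]) → cross
                  (solve 2 (λ a b →
                    (a :* con 1 :+ con 0 :* b) :* b := a :* (b :* con 1))
                    refl a b) } }
            ; inverse = comm∧invʳ⇒inv +ᶠ-comm -ᶠ-inverseʳ
            ; ⁻¹-cong = -ᶠ-cong }
          ; comm = +ᶠ-comm }
        ; *-cong     = *ᶠ-cong
        ; *-assoc    = λ { (a / b [ _ ]) (c / d [ _ ]) (e / f [ _ ]) → cross
            (solve 6 (λ a b c d e f →
              ((a :* c) :* e) :* (b :* (d :* f)) :=
              (a :* (c :* e)) :* ((b :* d) :* f)) refl a b c d e f) }
        ; *-identity = comm∧idʳ⇒id *ᶠ-comm λ { (a / b [ _ ]) → cross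
            (solve 2 (λ a b → (a :* con 1) :* b := a :* (b :* con 1)) refl a b) }
        ; distrib    = comm∧distrʳ⇒distr +ᶠ-cong *ᶠ-comm
            λ { (e / f [ _ ]) (a / b [ _ ]) (c / d [ _ ]) → cross
              (solve 6 (λ a b c d e f →
                ((a :* d :+ c :* b) :* e) :* ((b :* f) :* (d :* f)) :=
                ((a :* e) :* (d :* f) :+ (c :* e) :* (b :* f)) :* ((b :* d) :* f))
                refl a b c d e f) } }
      ; *-comm = *ᶠ-comm } }

------------------------------------------------------------------------

data Term {a g} (K : Set a) (G : Set g) : Set (a ⊔ g) where
  scalar : K → Term K G
  gen    : G → Term K G
  plus   : Term K G → Term K G → Term K G
  times  : Term K G → Term K G → Term K G
  minus  : Term K G → Term K G

module Presented {c ℓ g r} (K : CommutativeRing c ℓ) (G : Set g)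
                 (R : Rel (Term (CommutativeRing.Carrier K) G) r) where

  private
    module K = CommutativeRing K
    T : Set (c ⊔ g)
    T = Term K.Carrier G

  -- The least congruence containing R whose quotient is a K-algebra.
  data _∼_ : T → T → Set (c ⊔ ℓ ⊔ g ⊔ r) where
    relation   : ∀ {s t} → R s t → s ∼ t
    ∼-refl     : ∀ {s} → s ∼ s
    ∼-sym      : ∀ {s t} → s ∼ t → t ∼ s
    ∼-trans    : ∀ {s t u} → s ∼ t → t ∼ u → s ∼ u
    plus-cong  : ∀ {s s′ t t′} → s ∼ s′ → t ∼ t′ → plus s t ∼ plus s′ t′
    times-cong : ∀ {s s′ t t′} → s ∼ s′ → t ∼ t′ → times s t ∼ times s′ t′
    minus-cong : ∀ {s t} → s ∼ t → minus s ∼ minus t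
    plus-assoc : ∀ s t u → plus (plus s t) u ∼ plus s (plus t u)
    plus-comm  : ∀ s t → plus s t ∼ plus t s
    plus-zero  : ∀ s → plus s (scalar K.0#) ∼ s
    plus-minus : ∀ s → plus s (minus s) ∼ scalar K.0#
    times-assoc : ∀ s t u → times (times s t) u ∼ times s (times t u)
    times-one  : ∀ s → times (scalar K.1#) s ∼ s
    distribˡ   : ∀ s t u → times s (plus t u) ∼ plus (times s t) (times s u)
    distribʳ   : ∀ s t u → times (plus t u) s ∼ plus (times t s) (times u s)
    scalar-cong  : ∀ {a b} → a K.≈ b → scalar a ∼ scalar b
    scalar-plus  : ∀ a b → scalar (a K.+ b) ∼ plus (scalar a) (scalar b)
    scalar-times : ∀ a b → scalar (a K.* b) ∼ times (scalar a) (scalar b)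
    scalar-comm  : ∀ a s → times (scalar a) s ∼ times s (scalar a)

  private
    termSetoid : Setoid (c ⊔ g) (c ⊔ ℓ ⊔ g ⊔ r)
    termSetoid = record { Carrier = T ; _≈_ = _∼_ ; isEquivalence =
      record { refl = ∼-refl ; sym = ∼-sym ; trans = ∼-trans } }

    open Consequences termSetoid

  algebra : Ring (c ⊔ g) (c ⊔ ℓ ⊔ g ⊔ r)
  algebra = record
    { Carrier = T ; _≈_ = _∼_ ; _+_ = plus ; _*_ = times ; -_ = minus
    ; 0# = scalar K.0# ; 1# = scalar K.1#
    ; isRing = record
      { +-isAbelianGroup = record
        { isGroup = record
          { isMonoid = record
            { isSemigroup = record
              { isMagma = record
                  { isEquivalence = Setoid.isEquivalence termSetoid
                  ; ∙-cong = plus-cong }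
              ; assoc   = plus-assoc }
            ; identity = comm∧idʳ⇒id plus-comm plus-zero }
          ; inverse = comm∧invʳ⇒inv plus-comm plus-minus
          ; ⁻¹-cong = minus-cong }
        ; comm = plus-comm }
      ; *-cong     = times-cong
      ; *-assoc    = times-assoc
      ; *-identity = times-one , λ s →
          ∼-trans (∼-sym (scalar-comm K.1# s)) (times-one s)
      ; distrib    = distribˡ , distribʳ } }

------------------------------------------------------------------------

module Queer {c ℓ} (K : CommutativeRing c ℓ) (N : ℕ) where

  private
    module K = CommutativeRing K

  -- I_N: the pair (s , i) stands for the signed integer s (i + 1).
  I : Set
  I = Sign × Fin N

  pos : Fin N → I
  pos i = Sign.+ , i

  infix 8 ⁻_
  ⁻_ : I → I
  ⁻ (s , i) = Sign.opposite s , i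

  parity : I → Parity
  parity (s , _) = ℙ.fromSign s

  _≡ᴵ_ : I → I → Bool
  (s , i) ≡ᴵ (t , j) = does (s Signₚ.≟ t) ∧ does (i Finₚ.≟ j)

  sumI : ∀ {a r} (M : RawMonoid a r) → (I → RawMonoid.Carrier M) → RawMonoid.Carrier M
  sumI M f = sum (λ i → f (Sign.- , i)) ∙ sum (λ i → f (Sign.+ , i))
    where
    open RawMonoid M using (_∙_)
    open RawMonoidDefs M using (sum)

  sgn : Parity → K.Carrier
  sgn 0ℙ = K.1#
  sgn 1ℙ = K.- K.1#

  Matrix : Set c
  Matrix = I → I → K.Carrier

  infix 4 _≈ᴹ_
  _≈ᴹ_ : Matrix → Matrix → Set ℓ
  A ≈ᴹ B = ∀ i j → A i j K.≈ B i j

  0ᴹ : Matrix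
  0ᴹ i j = K.0#

  infixl 6 _+ᴹ_
  _+ᴹ_ : Matrix → Matrix → Matrix
  (A +ᴹ B) i j = A i j K.+ B i j

  infixl 7 _·ᴹ_ _*ᴹ_
  _·ᴹ_ : K.Carrier → Matrix → Matrix
  (a ·ᴹ A) i j = a K.* A i j

  _*ᴹ_ : Matrix → Matrix → Matrix
  (A *ᴹ B) i j = sumI K.+-rawMonoid λ k → A i k K.* B k j

  HasParity : Parity → Matrix → Set ℓ
  HasParity p A = ∀ i j → parity i ℙ.+ parity j ≢ p → A i j K.≈ K.0#

  -- AB - (-1)^{pq} BA, the superbracket when A, B are homogeneous of parities p, q.
  [_,_]⟨_,_⟩ : Matrix → Matrix → Parity → Parity → Matrix
  [ A , B ]⟨ p , q ⟩ = A *ᴹ B +ᴹ (K.- sgn (p ℙ.* q)) ·ᴹ (B *ᴹ A)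

  data Span {a} {J : Set a} (v : J → Matrix) : Matrix → Set (a ⊔ c ⊔ ℓ) where
    span-gen  : ∀ j → Span v (v j)
    span-0    : Span v 0ᴹ
    span-+    : ∀ {A B} → Span v A → Span v B → Span v (A +ᴹ B)
    span-·    : ∀ a {A} → Span v A → Span v (a ·ᴹ A)
    span-resp : ∀ {A B} → A ≈ᴹ B → Span v A → Span v B

  E F : I → I → Matrix
  E i j a b = if (a ≡ᴵ i) ∧ (b ≡ᴵ j) then K.1# else K.0#
  F i j = E i j +ᴹ E (⁻ i) (⁻ j)

  𝔮 : Matrix → Set (c ⊔ ℓ)
  𝔮 = Span {J = I × I} λ (i , j) → F i j

  -- F_{ij} and F_{i,-j} (according to the sign) for 1 ≤ i < j ≤ N, resp.
  -- 1 ≤ j < i ≤ N.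
  𝔫₊ 𝔫₋ : Matrix → Set (c ⊔ ℓ)
  𝔫₊ = Span {J = Sign × (Σ[ i ∈ Fin N ] Σ[ j ∈ Fin N ] (i Fin.< j))}
         λ (s , i , j , _) → F (pos i) (s , j)
  𝔫₋ = Span {J = Sign × (Σ[ i ∈ Fin N ] Σ[ j ∈ Fin N ] (j Fin.< i))}
         λ (s , i , j , _) → F (pos i) (s , j)

  UTerm : Set (c ⊔ ℓ)
  UTerm = Term K.Carrier (Σ Matrix 𝔮)

  -- The defining relations of U(𝔮_N) as a quotient of the free algebra on the
  -- set 𝔮_N: linearity of the inclusion, and xy - (-1)^{pq} yx = [x,y] for
  -- homogeneous x, y of parities p, q.  The results C of these operations are
  -- given up to ≈ᴹ, so that no closure proof for 𝔮_N is needed and ≈ᴹ-equal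
  -- matrices become equal in the quotient.
  data EnvelopingRelation : UTerm → UTerm → Set (c ⊔ ℓ) where
    linear  : ∀ {A B C} (A∈ : 𝔮 A) (B∈ : 𝔮 B) (C∈ : 𝔮 C) a b →
              C ≈ᴹ a ·ᴹ A +ᴹ b ·ᴹ B →
              EnvelopingRelation
                (gen (C , C∈))
                (plus (times (scalar a) (gen (A , A∈)))
                      (times (scalar b) (gen (B , B∈))))
    bracket : ∀ {A B C} (A∈ : 𝔮 A) (B∈ : 𝔮 B) (C∈ : 𝔮 C) p q →
              HasParity p A → HasParity q B → C ≈ᴹ [ A , B ]⟨ p , q ⟩ →
              EnvelopingRelation
                (plus (times (gen (A , A∈)) (gen (B , B∈)))
                      (minus (times (scalar (sgn (p ℙ.* q)))
                                    (times (gen (B , B∈)) (gen (A , A∈))))))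
                (gen (C , C∈))

  U : Ring (c ⊔ ℓ) (c ⊔ ℓ)
  U = Presented.algebra K (Σ Matrix 𝔮) EnvelopingRelation

  open Ring U hiding (zero)

  Fᵁ : I → I → Carrier
  Fᵁ i j = gen (F i j , span-gen (i , j))

  data Homogeneous : Parity → Carrier → Set (c ⊔ ℓ) where
    hom-scalar : ∀ a → Homogeneous 0ℙ (scalar a)
    hom-gen    : ∀ {p A} (A∈ : 𝔮 A) → HasParity p A → Homogeneous p (gen (A , A∈))
    hom-0      : ∀ {p} → Homogeneous p 0#
    hom-+      : ∀ {p u v} → Homogeneous p u → Homogeneous p v → Homogeneous p (u + v)
    hom-*      : ∀ {p q u v} → Homogeneous p u → Homogeneous q v →
                 Homogeneous (p ℙ.+ q) (u * v)
    hom-resp   : ∀ {p u v} → u ≈ v → Homogeneous p u → Homogeneous p v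

  SuperCommutes : Parity → Carrier → Set (c ⊔ ℓ)
  SuperCommutes p z =
    ∀ {q u} → Homogeneous q u → z * u ≈ scalar (sgn (p ℙ.* q)) * (u * z)

  -- Membership in Z(U(𝔮_N)): both homogeneous components supercommute with
  -- everything.
  record Central (z : Carrier) : Set (c ⊔ ℓ) where
    field
      z₀ z₁ : Carrier
      z≈    : z ≈ z₀ + z₁
      even  : Homogeneous 0ℙ z₀
      odd   : Homogeneous 1ℙ z₁
      comm₀ : SuperCommutes 0ℙ z₀
      comm₁ : SuperCommutes 1ℙ z₁

  data 𝔫₋U+U𝔫₊ : Carrier → Set (c ⊔ ℓ) where
    𝔫₋U     : ∀ {A} (A∈ : 𝔮 A) → 𝔫₋ A → ∀ u → 𝔫₋U+U𝔫₊ (gen (A , A∈) * u)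
    U𝔫₊     : ∀ u {A} (A∈ : 𝔮 A) → 𝔫₊ A → 𝔫₋U+U𝔫₊ (u * gen (A , A∈))
    sum-0    : 𝔫₋U+U𝔫₊ 0#
    sum-+    : ∀ {u v} → 𝔫₋U+U𝔫₊ u → 𝔫₋U+U𝔫₊ v → 𝔫₋U+U𝔫₊ (u + v)
    sum-resp : ∀ {u v} → u ≈ v → 𝔫₋U+U𝔫₊ u → 𝔫₋U+U𝔫₊ v

  -- The graph of the Harish-Chandra map.  By the Poincaré-Birkhoff-Witt
  -- theorem there is at most one f for a given z.
  record HC (z : Carrier) (f : CommutativeRing.Carrier (MPoly K N)) : Set (c ⊔ ℓ) where
    field
      central   : Central z
      congruent : 𝔫₋U+U𝔫₊ (z - substitute K U scalar (λ i → Fᵁ (pos i) (pos i)) f)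

  sumTuples : ∀ r → (Vec I r → Carrier) → Carrier
  sumTuples zero    f = f []
  sumTuples (suc r) f = sumI +-rawMonoid λ i → sumTuples r λ v → f (i ∷ v)

  -- path i (i₂ ∷ ⋯ ∷ iᵣ ∷ []) e = F_{i i₂} F_{i₂ i₃} ⋯ F_{iᵣ e}
  path : ∀ {r} → I → Vec I r → I → Carrier
  path i []      e = Fᵁ i e
  path i (j ∷ v) e = Fᵁ i j * path j v e

  totalParity : ∀ {r} → Vec I r → Parity
  totalParity []      = 0ℙ
  totalParity (i ∷ v) = parity i ℙ.+ totalParity v

  cyclic : (r : ℕ) → .{{ℕ.NonZero r}} → Carrier
  cyclic (suc r) = sumI +-rawMonoid λ i₁ → sumTuples r λ v →
    scalar (sgn (totalParity v)) * path i₁ v i₁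

  -- b_r = c_{2r-1}
  b : (r : ℕ) → .{{ℕ.NonZero r}} → Carrier
  b (suc r) = cyclic (suc (2 ℕ.* r))

  -- With i, j counted from 0, the entry b_{i+j-1} becomes b_{i+j+1}.
  Δ : Carrier
  Δ = det U {N} λ i j → b (suc (toℕ i ℕ.+ toℕ j))

------------------------------------------------------------------------

module Lambda {c ℓ} (K : CommutativeRing c ℓ) (N : ℕ) where

  K[λ] : CommutativeRing c ℓ
  K[λ] = MPoly K N

  K⟨λ⟩ : CommutativeRing (c ⊔ ℓ) ℓ
  K⟨λ⟩ = Fractions.fractionRing K[λ]

  open Fractions K[λ] public using (fromRing)
  open Polynomial K⟨λ⟩ public using (Poly; IsResultant)

  private
    module L  = CommutativeRing K[λ]
    module K⟨λ⟩[z] = CommutativeRing (Polynomial.polyRing K⟨λ⟩)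
    open BigOperators K⟨λ⟩[z].ring using (product)
    open Polynomial K⟨λ⟩ using (const; X)

  x y : Fin N → L.Carrier
  x i = var K i L.* (var K i L.- L.1#)
  y i = var K i L.* (var K i L.+ L.1#)

  P Q : Poly
  P = product {N} λ j → K⟨λ⟩[z].1# K⟨λ⟩[z].- const (fromRing (y j)) K⟨λ⟩[z].* X
  Q = product {N} λ i → K⟨λ⟩[z].1# K⟨λ⟩[z].- const (fromRing (x i)) K⟨λ⟩[z].* X

  infix 4 _≈[λ]_ _≈⟨λ⟩_
  _≈[λ]_ = CommutativeRing._≈_ K[λ]
  _≈⟨λ⟩_ = CommutativeRing._≈_ K⟨λ⟩

  signed : ∀ {a r} (R : CommutativeRing a r) →
           CommutativeRing.Carrier R → CommutativeRing.Carrier R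
  signed R f = ((- 1#) ^ (N C 2)) * f
    where
    open CommutativeRing R
    open BigOperators ring using (_^_)

  -- ∏_{i,j} (λᵢ + λⱼ) ∏_{i≠j} (λᵢ - λⱼ - 1); the second product is written as a
  -- product over all (i , j) with factor 1 on the diagonal.
  productFormula : L.Carrier
  productFormula =
      (∏ λ i → ∏ λ j → var K i L.+ var K j)
    L.* (∏ λ i → ∏ λ j → if does (i Finₚ.≟ j) then L.1#
                          else var K i L.- var K j L.- L.1#)
    where
    ∏ : (Fin N → L.Carrier) → L.Carrier
    ∏ = BigOperators.product L.ring

{-# OPTIONS --safe #-}
module Submission where

-- Let X⁽ⁿ⁾ be the matrix of signed path sums, so that c_{n+1} is the trace of X⁽ⁿ⁾.
-- Its entries transform under ad F_{ij} like the F_{kl} themselves, hence the trace is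
-- central.  Modulo the left ideal U𝔫₊ the entries with |k| < |l| vanish, and two steps of
-- X⁽ⁿ⁺¹⁾ = F X⁽ⁿ⁾ give a triangular recursion for the diagonal entries, which says that
-- 1 - Σ HC(bᵣ) zʳ = P_N(z) / Q_N(z).  Products are controlled because a central element
-- moves U𝔫₊ into itself when multiplied from the right.
--
-- With τ the shift of sequences, the rows ∏_{k≤i} (τ - x_k) and the columns
-- ∏_{k>N-j} (τ - x_k) bring the Hankel matrix of the coefficients of P_N / Q_N to
-- antitriangular form; its antidiagonal entries are the residues
-- -∏_k (x_m - y_k), whose product is Res(Q_N, P_N).
--
-- For Δ_N ≠ 0 the Poincaré–Birkhoff–Witt theorem is avoided: in a representation of 𝔮 by
-- first order operators on a tensor algebra the top-degree part of an element of U is its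
-- symbol, and the symbol of Δ_N at diag(1, …, N) is the Hankel determinant of odd power
-- sums, a unit in characteristic zero.

open import Defs
open import Algebra.Apartness.Bundles using (HeytingField)
open import Algebra.Bundles using (CommutativeRing; Ring; RawRing)
import Algebra.Definitions.RawMonoid as RawMonoidDefs
import Algebra.Properties.CommutativeMonoid.Sum as MonoidSum
import Algebra.Properties.CommutativeSemigroup as CommSemigroupProps
import Algebra.Properties.Monoid.Mult as MonoidMult
import Algebra.Properties.Ring as RingProps
import Algebra.Properties.Semiring.Mult as SemiringMult
import Algebra.Properties.Semiring.Sum as SemiringSum
import Algebra.Solver.CommutativeMonoid as CommutativeMonoidSolver
import Algebra.Solver.Ring as RingSolverMod
open import Algebra.Solver.Ring.AlmostCommutativeRing using (fromCommutativeRing; _-Raw-AlmostCommutative⟶_)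
open import Data.Bool.Base using (Bool; true; false; _∧_; if_then_else_)
open import Data.Empty using (⊥-elim)
open import Data.Fin.Base as Fin using (Fin; zero; suc; toℕ; punchIn; inject₁; fromℕ)
import Data.Fin.Properties as Finₚ
open import Data.List.Base using (List; []; _∷_; length)
open import Data.Maybe.Base as Maybe using (Maybe)
open import Data.Nat.Base as ℕ using (ℕ; zero; suc; NonZero; z≤n; s≤s)
open import Data.Nat.Combinatorics using (_C_; nC1≡n; nCk+nC[k+1]≡[n+1]C[k+1])
import Data.Nat.Properties as ℕₚ
open import Data.Parity.Base as ℙ using (Parity; 0ℙ; 1ℙ)
import Data.Parity.Properties as ℙₚ
open import Data.Product.Base using (Σ; _×_; _,_; proj₁; proj₂; ∃-syntax)
open import Data.Sign.Base as Sign using (Sign)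
import Data.Sign.Properties as Signₚ
open import Data.Sum.Base using (inj₁; inj₂; _⊎_)
open import Data.Vec.Base using (Vec; []; _∷_)
open import Function.Base using (_∘_)
import Level
open import Relation.Binary.Definitions using (tri<; tri≈; tri>)
open import Relation.Binary.PropositionalEquality.Core as ≡ using (_≡_; _≢_)
import Relation.Binary.Reasoning.Setoid as SetoidReasoning
open import Relation.Nullary.Decidable.Core using (yes; no; dec⇒maybe; does)
open import Relation.Nullary.Negation.Core using (¬_)

-- The recursion takes two steps at a time because one multiplication by F turns the symmetry
-- X(-k,-l) = X(k,l) into X(-k,-l) = -X(k,l); the second step restores it. The entries at μ and -μ
-- then agree, so the later diagonal entries enter with coefficient -2λ. For the generating series
-- this means one factor (1 - y z) / (1 - x z) per variable, because y - x = 2λ: this is the origin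
-- of x_i and y_i.
--
-- HC is available only as a graph, and that a central element has a single image is the
-- Poincaré-Birkhoff-Witt theorem. The formula for HC(Δ_N), although its right-hand side is a
-- nonzero polynomial, therefore does not by itself exclude Δ_N = 0. The separate argument by
-- symbols ends in the same Hankel evaluation, now with nodes a_k² and weights 2a_k.
--
-- The roots of Q_N are the inverses of the x_i, so the resultant lives over fractions. There x_i
-- and y_i become invertible because λ_i and λ_i ± 1 are monic in λ_i, hence regular.

-- A ring solver with integer coefficients

module Solver {c ℓ} (R : CommutativeRing c ℓ) where
  open CommutativeRing R hiding (zero)
  private
    module RP = RingProps ring
    module SM = SemiringMult semiring
    open SetoidReasoning setoid
    open SM using () renaming (_×_ to _·_)
    module CS = CommSemigroupProps +-commutativeSemigroup

    -- Integer coefficients, encoded as formal differences of naturals.  They have to be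
    -- kept reduced, because the solver compares the values of normal forms syntactically.
    reduce : ℕ × ℕ → ℕ × ℕ
    reduce (suc a , suc b) = reduce (a , b)
    reduce p               = p

    _+ᵈ_ _*ᵈ_ : ℕ × ℕ → ℕ × ℕ → ℕ × ℕ
    (a , b) +ᵈ (c , d) = a ℕ.+ c , b ℕ.+ d
    (a , b) *ᵈ (c , d) = a ℕ.* c ℕ.+ b ℕ.* d , a ℕ.* d ℕ.+ b ℕ.* c

    Diff : RawRing _ _
    Diff = record
      { Carrier = ℕ × ℕ ; _≈_ = λ (a , b) (c , d) → a ℕ.+ d ≡ c ℕ.+ b
      ; _+_ = λ p q → reduce (p +ᵈ q)
      ; _*_ = λ p q → reduce (p *ᵈ q)
      ; -_ = λ (a , b) → b , a
      ; 0# = 0 , 0 ; 1# = 1 , 0 }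

    difference : ℕ × ℕ → Carrier
    difference (a , b) = a · 1# - b · 1#

    -- The first two clauses let the constants 0# and 1# occur literally in goals.
    ⟦_⟧ᵈ : ℕ × ℕ → Carrier
    ⟦ 0 , 0 ⟧ᵈ = 0#
    ⟦ 1 , 0 ⟧ᵈ = 1#
    ⟦ p ⟧ᵈ = difference p

    ⟦⟧-difference : ∀ p → ⟦ p ⟧ᵈ ≈ difference p
    ⟦⟧-difference (0 , 0)           = sym (-‿inverseʳ 0#)
    ⟦⟧-difference (1 , 0)           = sym (trans (+-cong (+-identityʳ 1#) RP.-0#≈0#) (+-identityʳ 1#))
    ⟦⟧-difference (suc (suc a) , 0) = refl
    ⟦⟧-difference (0 , suc b)       = refl
    ⟦⟧-difference (1 , suc b)       = refl
    ⟦⟧-difference (suc (suc a) , suc b) = refl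

    cancel-cross : ∀ a b c d → a ℕ.+ d ≡ c ℕ.+ b → difference (a , b) ≈ difference (c , d)
    cancel-cross a b c d e = begin
      A - B               ≈⟨ +-identityʳ _ ⟨
      A - B + 0#          ≈⟨ +-congˡ (-‿inverseʳ D) ⟨
      A - B + (D - D)     ≈⟨ CS.interchange _ _ _ _ ⟩
      A + D + (- B - D)   ≈⟨ +-congʳ (trans (sym (SM.×-homo-+ 1# a d))
                              (trans (reflexive (≡.cong (_· 1#) e)) (SM.×-homo-+ 1# c b))) ⟩
      C + B + (- B - D)   ≈⟨ +-congˡ (+-comm _ _) ⟩
      C + B + (- D - B)   ≈⟨ CS.interchange _ _ _ _ ⟩
      C - D + (B - B)     ≈⟨ +-congˡ (-‿inverseʳ B) ⟩
      C - D + 0#          ≈⟨ +-identityʳ _ ⟩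
      C - D               ∎
      where
      A = a · 1#
      B = b · 1#
      C = c · 1#
      D = d · 1#

    reduce-correct : ∀ p → difference (reduce p) ≈ difference p
    reduce-correct (suc a , suc b) = trans (reduce-correct (a , b)) (cancel-cross a b (suc a) (suc b) (ℕₚ.+-suc a b))
    reduce-correct (zero  , b)     = refl
    reduce-correct (suc a , zero)  = refl

    +-homoᵈ : ∀ p q → difference (p +ᵈ q) ≈ difference p + difference q
    +-homoᵈ (a , b) (c , d) = trans
      (+-cong (SM.×-homo-+ 1# a c) (trans (-‿cong (SM.×-homo-+ 1# b d)) (sym (RP.-‿+-comm _ _))))
      (CS.interchange _ _ _ _)

    -‿homoᵈ : ∀ p → difference (RawRing.-_ Diff p) ≈ - difference p
    -‿homoᵈ (a , b) = sym (RP.⁻¹-anti-homo‿- _ _)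

    *-homoᵈ : ∀ p q → difference (p *ᵈ q) ≈ difference p * difference q
    *-homoᵈ (a , b) (c , d) = sym (begin
      (A - B) * (C - D)                       ≈⟨ distribʳ _ _ _ ⟩
      A * (C - D) + - B * (C - D)             ≈⟨ +-cong (distribˡ _ _ _) (distribˡ _ _ _) ⟩
      A * C + A * - D + (- B * C + - B * - D) ≈⟨ +-cong (+-congˡ (sym (RP.-‿distribʳ-* _ _)))
                                                   (+-cong (sym (RP.-‿distribˡ-* _ _)) neg²) ⟩
      A * C - A * D + (- (B * C) + B * D)     ≈⟨ +-congˡ (+-comm _ _) ⟩
      A * C - A * D + (B * D - B * C)         ≈⟨ CS.interchange _ _ _ _ ⟩
      A * C + B * D + (- (A * D) - B * C)     ≈⟨ +-cong (fold a c b d) (trans (RP.-‿+-comm _ _) (-‿cong (fold a d b c))) ⟩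
      difference ((a , b) *ᵈ (c , d)) ∎)
      where
      A = a · 1#
      B = b · 1#
      C = c · 1#
      D = d · 1#
      neg² : - B * - D ≈ B * D
      neg² = trans (sym (RP.-‿distribˡ-* _ _))
               (trans (-‿cong (sym (RP.-‿distribʳ-* _ _))) (RP.-‿involutive _))
      fold : ∀ a c b d → (a · 1#) * (c · 1#) + (b · 1#) * (d · 1#) ≈ (a ℕ.* c ℕ.+ b ℕ.* d) · 1#
      fold a c b d = sym (trans (SM.×-homo-+ 1# (a ℕ.* c) (b ℕ.* d))
        (+-cong (SM.×1-homo-* a c) (SM.×1-homo-* b d)))

    morphism : Diff -Raw-AlmostCommutative⟶ fromCommutativeRing R
    morphism = record
      { ⟦_⟧ = ⟦_⟧ᵈ
      ; +-homo = λ p q → trans (trans (⟦⟧-difference (reduce (p +ᵈ q))) (reduce-correct (p +ᵈ q)))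
          (trans (+-homoᵈ p q) (sym (+-cong (⟦⟧-difference p) (⟦⟧-difference q))))
      ; *-homo = λ p q → trans (trans (⟦⟧-difference (reduce (p *ᵈ q))) (reduce-correct (p *ᵈ q)))
          (trans (*-homoᵈ p q) (sym (*-cong (⟦⟧-difference p) (⟦⟧-difference q))))
      ; -‿homo = λ p → trans (⟦⟧-difference (RawRing.-_ Diff p))
          (trans (-‿homoᵈ p) (sym (-‿cong (⟦⟧-difference p))))
      ; 0-homo = refl
      ; 1-homo = refl }

    equal? : ∀ p q → Maybe (⟦ p ⟧ᵈ ≈ ⟦ q ⟧ᵈ)
    equal? (a , b) (c , d) =
      Maybe.map (λ e → trans (⟦⟧-difference (a , b))
        (trans (cancel-cross a b c d e) (sym (⟦⟧-difference (c , d)))))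
        (dec⇒maybe (a ℕ.+ d ℕₚ.≟ c ℕ.+ b))

  open RingSolverMod Diff (fromCommutativeRing R) morphism equal? public
    using (solve; _:=_; _:+_; _:*_; _:-_; :-_; con; Polynomial)

  :1 :0 : ∀ {n} → Polynomial n
  :1 = con (1 , 0)
  :0 = con (0 , 0)

-- Determinants defined by expansion along the first row

module Determinant {c ℓ} (R : CommutativeRing c ℓ) where
  open CommutativeRing R hiding (zero)
  open BigOperators ring using (sum; product; _^_)
  private
    module RP = RingProps ring
    open SetoidReasoning setoid
    open Solver R
  open SemiringSum semiring public
    using (sum-cong-≋; ∑-distrib-+; *-distribˡ-sum; *-distribʳ-sum; ∑-comm; sum-replicate-zero)

  Row : ℕ → Set c
  Row n = Fin n → Carrier

  Mat : ℕ → Set c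
  Mat n = Fin n → Row n

  ⟨_⟩ : ℕ → Carrier
  ⟨ k ⟩ = (- 1#) ^ k

  minor : ∀ {n} → (Fin n → Row (suc n)) → Fin (suc n) → Mat n
  minor M j i k = M i (punchIn j k)

  infixr 5 _∷ʳ_
  _∷ʳ_ : ∀ {a} {A : Set a} {n} → A → (Fin n → A) → Fin (suc n) → A
  (r ∷ʳ M) zero    = r
  (r ∷ʳ M) (suc i) = M i

  sum-0 : ∀ {n} {t : Row n} → (∀ i → t i ≈ 0#) → sum t ≈ 0#
  sum-0 {n} e = trans (sum-cong-≋ e) (sum-replicate-zero n)

  det-cong : ∀ {n} (M M′ : Mat n) → (∀ i j → M i j ≈ M′ i j) → det ring M ≈ det ring M′
  det-cong {zero}  M M′ e = refl
  det-cong {suc n} M M′ e = sum-cong-≋ λ j →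
    *-cong (*-congˡ {⟨ toℕ j ⟩} (e zero j))
      (det-cong (minor (M ∘ suc) j) (minor (M′ ∘ suc) j) λ i k → e (suc i) (punchIn j k))

  -- Unfolds to `det ring (r ∷ʳ M)`; separating the first row lets linearity in it be stated without
  -- touching the minors.
  expand : ∀ {n} → Row (suc n) → (Fin n → Row (suc n)) → Carrier
  expand r M = sum λ j → ⟨ toℕ j ⟩ * r j * det ring (minor M j)

  expand-linear : ∀ {n} r s x (M : Fin n → Row (suc n)) →
    expand (λ j → r j - x * s j) M ≈ expand r M - x * expand s M
  expand-linear r s x M = begin
    expand (λ j → r j - x * s j) M
      ≈⟨ sum-cong-≋ (λ j → solve 5 (λ e r x s d → e :* (r :- x :* s) :* d := e :* r :* d :+ (:- x) :* (e :* s :* d)) refl ⟨ toℕ j ⟩ (r j) x (s j) (det ring (minor M j))) ⟩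
    sum (λ j → ⟨ toℕ j ⟩ * r j * det ring (minor M j) + (- x) * (⟨ toℕ j ⟩ * s j * det ring (minor M j)))
      ≈⟨ ∑-distrib-+ (λ j → ⟨ toℕ j ⟩ * r j * det ring (minor M j)) (λ j → (- x) * (⟨ toℕ j ⟩ * s j * det ring (minor M j))) ⟩
    expand r M + sum (λ j → (- x) * (⟨ toℕ j ⟩ * s j * det ring (minor M j)))
      ≈⟨ +-congˡ (*-distribˡ-sum (- x) (λ j → ⟨ toℕ j ⟩ * s j * det ring (minor M j))) ⟨
    expand r M + (- x) * expand s M
      ≈⟨ +-congˡ (sym (RP.-‿distribˡ-* _ _)) ⟩
    expand r M - x * expand s M ∎

  -- The second row is the one that matters: row operations are performed from the top down, each
  -- with the unchanged row directly above.
  det-linear₁ : ∀ {n} r s t x (M : Fin n → Row (suc (suc n))) →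
    det ring (r ∷ʳ (λ j → s j - x * t j) ∷ʳ M) ≈ det ring (r ∷ʳ s ∷ʳ M) - x * det ring (r ∷ʳ t ∷ʳ M)
  det-linear₁ r s t x M = begin
    det ring (r ∷ʳ (λ j → s j - x * t j) ∷ʳ M)
      ≈⟨ sum-cong-≋ (λ j → trans (*-congˡ (expand-linear (λ k → s (punchIn j k)) (λ k → t (punchIn j k)) x (λ i k → M i (punchIn j k))))
           (solve 4 (λ e S x T → e :* (S :- x :* T) := e :* S :+ (:- x) :* (e :* T)) refl (⟨ toℕ j ⟩ * r j) (E s j) x (E t j))) ⟩
    sum (λ j → ⟨ toℕ j ⟩ * r j * E s j + (- x) * (⟨ toℕ j ⟩ * r j * E t j))
      ≈⟨ ∑-distrib-+ (λ j → ⟨ toℕ j ⟩ * r j * E s j) (λ j → (- x) * (⟨ toℕ j ⟩ * r j * E t j)) ⟩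
    sum (λ j → ⟨ toℕ j ⟩ * r j * E s j) + sum (λ j → (- x) * (⟨ toℕ j ⟩ * r j * E t j))
      ≈⟨ +-congˡ (*-distribˡ-sum (- x) (λ j → ⟨ toℕ j ⟩ * r j * E t j)) ⟨
    sum (λ j → ⟨ toℕ j ⟩ * r j * E s j) + (- x) * sum (λ j → ⟨ toℕ j ⟩ * r j * E t j)
      ≈⟨ +-congˡ (sym (RP.-‿distribˡ-* _ _)) ⟩
    det ring (r ∷ʳ s ∷ʳ M) - x * det ring (r ∷ʳ t ∷ʳ M) ∎
    where
    E : Row _ → Fin _ → Carrier
    E s j = det ring (minor (s ∷ʳ M) j)

  -- The terms (0 , j) and (suc j , 0) of the double expansion delete the same
  -- two columns with opposite signs.
  double-expansion : ∀ n (a : Row (suc (suc n))) (Φ : (Fin n → Fin (suc (suc n))) → Carrier) →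
    (∀ {f g} → (∀ m → f m ≡ g m) → Φ f ≈ Φ g) →
    sum (λ j → ⟨ toℕ j ⟩ * a j * sum (λ k → ⟨ toℕ k ⟩ * a (punchIn j k) * Φ (λ m → punchIn j (punchIn k m)))) ≈ 0#
  double-expansion n a Φ Φ-cong = begin
    1# * a zero * sum (λ k → ⟨ toℕ k ⟩ * a (suc k) * Φ (λ m → suc (punchIn k m)))
      + sum (λ j → ⟨ suc (toℕ j) ⟩ * a (suc j) * (1# * a zero * Φ (λ m → suc (punchIn j m)) + rest j))
      ≈⟨ +-congʳ (*-distribˡ-sum (1# * a zero) (λ k → ⟨ toℕ k ⟩ * a (suc k) * Φ (λ m → suc (punchIn k m)))) ⟩
    sum (λ k → 1# * a zero * (⟨ toℕ k ⟩ * a (suc k) * Φ (λ m → suc (punchIn k m))))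
      + sum (λ j → ⟨ suc (toℕ j) ⟩ * a (suc j) * (1# * a zero * Φ (λ m → suc (punchIn j m)) + rest j))
      ≈⟨ ∑-distrib-+ (λ k → 1# * a zero * (⟨ toℕ k ⟩ * a (suc k) * Φ (λ m → suc (punchIn k m))))
           (λ j → ⟨ suc (toℕ j) ⟩ * a (suc j) * (1# * a zero * Φ (λ m → suc (punchIn j m)) + rest j)) ⟨
    sum (λ j → 1# * a zero * (⟨ toℕ j ⟩ * a (suc j) * Φ (λ m → suc (punchIn j m)))
        + ⟨ suc (toℕ j) ⟩ * a (suc j) * (1# * a zero * Φ (λ m → suc (punchIn j m)) + rest j))
      ≈⟨ sum-cong-≋ (λ j → solve 5 (λ z e b p r →
            :1 :* z :* (e :* b :* p) :+ ((:- :1) :* e) :* b :* (:1 :* z :* p :+ r) := (:- e) :* b :* r)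
            refl (a zero) ⟨ toℕ j ⟩ (a (suc j)) (Φ (λ m → suc (punchIn j m))) (rest j)) ⟩
    sum (λ j → (- ⟨ toℕ j ⟩) * a (suc j) * rest j)
      ≈⟨ remaining n a Φ Φ-cong ⟩
    0# ∎
    where
    rest : Fin (suc n) → Carrier
    rest j = sum λ k → ⟨ suc (toℕ k) ⟩ * a (suc (punchIn j k)) * Φ (λ m → punchIn (suc j) (punchIn (suc k) m))
    -- No term left over deletes column 0. The two index shifts contribute opposite outer and inner
    -- signs, so this is again a double expansion, with one column fewer; `Φ′` puts the retained
    -- column 0 back in front.
    remaining : ∀ n (a : Row (suc (suc n))) (Φ : (Fin n → Fin (suc (suc n))) → Carrier) →
      (∀ {f g} → (∀ m → f m ≡ g m) → Φ f ≈ Φ g) →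
      sum (λ j → (- ⟨ toℕ j ⟩) * a (suc j) * (sum λ k → ⟨ suc (toℕ k) ⟩ * a (suc (punchIn j k))
        * Φ (λ m → punchIn (suc j) (punchIn (suc k) m)))) ≈ 0#
    remaining zero a Φ Φ-cong = trans (+-identityʳ _) (zeroʳ _)
    remaining (suc n) a Φ Φ-cong = trans
      (sum-cong-≋ λ j → trans (*-congˡ {(- ⟨ toℕ j ⟩) * a (suc j)} (trans
          (sum-cong-≋ λ k → trans
            (*-congˡ {⟨ suc (toℕ k) ⟩ * a (suc (punchIn j k))} (Φ-cong (reindex j k)))
            (solve 3 (λ e b p → ((:- :1) :* e) :* b :* p := (:- :1) :* (e :* b :* p)) refl ⟨ toℕ k ⟩ (a (suc (punchIn j k))) (Φ′ (λ m → punchIn j (punchIn k m)))))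
          (sym (*-distribˡ-sum (- 1#) (λ k → ⟨ toℕ k ⟩ * a (suc (punchIn j k)) * Φ′ (λ m → punchIn j (punchIn k m)))))))
        (solve 3 (λ e b s → (:- e) :* b :* ((:- :1) :* s) := e :* b :* s) refl ⟨ toℕ j ⟩ (a (suc j)) _))
      (double-expansion n (a ∘ suc) Φ′ λ e → Φ-cong λ { zero → ≡.refl ; (suc m) → ≡.cong suc (e m) })
      where
      Φ′ : (Fin n → Fin (suc (suc n))) → Carrier
      Φ′ f = Φ (zero ∷ʳ (suc ∘ f))
      reindex : ∀ j k m → punchIn (suc j) (punchIn (suc k) m) ≡ (zero ∷ʳ (λ m′ → suc (punchIn j (punchIn k m′)))) m
      reindex j k zero    = ≡.refl
      reindex j k (suc m) = ≡.refl

  det-equal-rows : ∀ {n} r (M : Fin n → Row (suc (suc n))) → det ring (r ∷ʳ r ∷ʳ M) ≈ 0#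
  det-equal-rows {n} r M = double-expansion n r (λ f → det ring λ i k → M i (f k))
    λ {f} {g} e → det-cong (λ i k → M i (f k)) (λ i k → M i (g k)) λ i k → reflexive (≡.cong (M i) (e k))

  -- Each row is reduced by the original row above it, not by the already altered one; `u` stands
  -- above the first.
  differences : ∀ {n m} → Carrier → Row m → (Fin n → Row m) → Fin n → Row m
  differences x u v zero    j = v zero j - x * u j
  differences x u v (suc i)   = differences x (v zero) (v ∘ suc) i

  differences-at : ∀ {n m} x u (v : Fin n → Row m) i j →
    differences x u v i j ≈ v i j - x * (u ∷ʳ v) (inject₁ i) j
  differences-at x u v zero    j = refl
  differences-at x u v (suc zero) j = refl
  differences-at x u v (suc (suc i)) j = differences-at x (v zero) (v ∘ suc) (suc i) j

  differences-minor : ∀ {n m} x u (v : Fin n → Row (suc m)) p i j →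
    differences x u v i (punchIn p j) ≡ differences x (λ k → u (punchIn p k)) (λ i k → v i (punchIn p k)) i j
  differences-minor x u v p zero    j = ≡.refl
  differences-minor x u v p (suc i) j = differences-minor x (v zero) (v ∘ suc) p i j

  det-∷ʳ : ∀ {n} r (M M′ : Fin n → Row (suc n)) → (∀ j → det ring (minor M j) ≈ det ring (minor M′ j)) →
    det ring (r ∷ʳ M) ≈ det ring (r ∷ʳ M′)
  det-∷ʳ r M M′ e = sum-cong-≋ λ j → *-congˡ {⟨ toℕ j ⟩ * r j} (e j)

  -- Linearity in the second row produces an extra determinant with two equal rows, which vanishes.
  -- The operations further down take place inside the minors of the expansion along `u`, where
  -- induction applies.
  det-differences : ∀ {n} x u (v : Fin n → Row (suc n)) →
    det ring (u ∷ʳ differences x u v) ≈ det ring (u ∷ʳ v)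
  det-differences {zero}  x u v = det-cong (u ∷ʳ differences x u v) (u ∷ʳ v) λ { zero j → refl }
  det-differences {suc n} x u v = begin
    det ring (u ∷ʳ differences x u v)
      ≈⟨ det-cong (u ∷ʳ differences x u v) (u ∷ʳ (λ j → v zero j - x * u j) ∷ʳ D) (λ { zero j → refl ; (suc zero) j → refl ; (suc (suc i)) j → refl }) ⟩
    det ring (u ∷ʳ (λ j → v zero j - x * u j) ∷ʳ D)
      ≈⟨ det-linear₁ u (v zero) u x D ⟩
    det ring (u ∷ʳ v zero ∷ʳ D) - x * det ring (u ∷ʳ u ∷ʳ D)
      ≈⟨ +-congˡ (trans (-‿cong (trans (*-congˡ (det-equal-rows u D)) (zeroʳ x))) RP.-0#≈0#) ⟩
    det ring (u ∷ʳ v zero ∷ʳ D) + 0#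
      ≈⟨ +-identityʳ _ ⟩
    det ring (u ∷ʳ v zero ∷ʳ D)
      ≈⟨ det-∷ʳ u (v zero ∷ʳ D) v (λ j → begin
           det ring (minor (v zero ∷ʳ D) j)
             ≈⟨ det-cong (minor (v zero ∷ʳ D) j) ((λ k → v zero (punchIn j k)) ∷ʳ differences x (λ k → v zero (punchIn j k)) (λ i k → v (suc i) (punchIn j k)))
                  (λ { zero k → refl ; (suc i) k → reflexive (differences-minor x (v zero) (v ∘ suc) j i k) }) ⟩
           det ring ((λ k → v zero (punchIn j k)) ∷ʳ differences x (λ k → v zero (punchIn j k)) (λ i k → v (suc i) (punchIn j k)))
             ≈⟨ det-differences x (λ k → v zero (punchIn j k)) (λ i k → v (suc i) (punchIn j k)) ⟩
           det ring ((λ k → v zero (punchIn j k)) ∷ʳ (λ i k → v (suc i) (punchIn j k)))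
             ≈⟨ det-cong ((λ k → v zero (punchIn j k)) ∷ʳ (λ i k → v (suc i) (punchIn j k))) (minor v j)
                  (λ { zero k → refl ; (suc i) k → refl }) ⟩
           det ring (minor v j) ∎) ⟩
    det ring (u ∷ʳ v) ∎
    where
    D : Fin n → Row (suc (suc n))
    D = differences x (v zero) (v ∘ suc)

  -- The corner entry contributes the same term to both expansions. Elsewhere, expanding each minor
  -- along its first column gives a double sum over pairs (i , j) whose terms are symmetric in the
  -- roles of row and column.
  det-column-expansion : ∀ {n} (M : Mat (suc n)) →
    det ring M ≈ sum λ i → ⟨ toℕ i ⟩ * M i zero * det ring (λ a b → M (punchIn i a) (suc b))
  det-column-expansion {zero}  M = refl
  det-column-expansion {suc n} M = +-congˡ (begin
    sum (λ j → ⟨ suc (toℕ j) ⟩ * M zero (suc j) * det ring (minor (M ∘ suc) (suc j)))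
      ≈⟨ sum-cong-≋ (λ j → *-congˡ {⟨ suc (toℕ j) ⟩ * M zero (suc j)} (det-column-expansion (minor (M ∘ suc) (suc j)))) ⟩
    sum (λ j → ⟨ suc (toℕ j) ⟩ * M zero (suc j) * sum (λ i → ⟨ toℕ i ⟩ * M (suc i) zero * D i j))
      ≈⟨ sum-cong-≋ (λ j → *-distribˡ-sum (⟨ suc (toℕ j) ⟩ * M zero (suc j)) (λ i → ⟨ toℕ i ⟩ * M (suc i) zero * D i j)) ⟩
    sum (λ j → sum λ i → ⟨ suc (toℕ j) ⟩ * M zero (suc j) * (⟨ toℕ i ⟩ * M (suc i) zero * D i j))
      ≈⟨ ∑-comm (λ j i → ⟨ suc (toℕ j) ⟩ * M zero (suc j) * (⟨ toℕ i ⟩ * M (suc i) zero * D i j)) ⟩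
    sum (λ i → sum λ j → ⟨ suc (toℕ j) ⟩ * M zero (suc j) * (⟨ toℕ i ⟩ * M (suc i) zero * D i j))
      ≈⟨ sum-cong-≋ (λ i → sum-cong-≋ λ j →
           solve 5 (λ e a f b d → ((:- :1) :* e) :* a :* (f :* b :* d) := ((:- :1) :* f) :* b :* (e :* a :* d)) refl
             ⟨ toℕ j ⟩ (M zero (suc j)) ⟨ toℕ i ⟩ (M (suc i) zero) (D i j)) ⟩
    sum (λ i → sum λ j → ⟨ suc (toℕ i) ⟩ * M (suc i) zero * (⟨ toℕ j ⟩ * M zero (suc j) * D i j))
      ≈⟨ sum-cong-≋ (λ i → *-distribˡ-sum (⟨ suc (toℕ i) ⟩ * M (suc i) zero) (λ j → ⟨ toℕ j ⟩ * M zero (suc j) * D i j)) ⟨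
    sum (λ i → ⟨ suc (toℕ i) ⟩ * M (suc i) zero * det ring (λ a b → M (punchIn (suc i) a) (suc b)))
      ∎)
    where
    D : Fin (suc n) → Fin (suc n) → Carrier
    D i j = det ring (λ a b → M (suc (punchIn i a)) (suc (punchIn j b)))

  det-transpose : ∀ {n} (M : Mat n) → det ring (λ i j → M j i) ≈ det ring M
  det-transpose {zero}  M = refl
  det-transpose {suc n} M = trans
    (sum-cong-≋ λ j → *-congˡ {⟨ toℕ j ⟩ * M j zero} (det-transpose (λ a b → M (punchIn j a) (suc b))))
    (sym (det-column-expansion M))

-- Hankel determinants of linearly recurrent sequences

module Hankel {c ℓ} (R : CommutativeRing c ℓ) where
  open CommutativeRing R hiding (zero)
  open BigOperators ring using (sum; product; _^_)
  open Determinant R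
  private
    open SetoidReasoning setoid
    open Solver R
    module ∏ = MonoidSum *-commutativeMonoid
    module ^ = MonoidMult *-monoid

  Seq : Set c
  Seq = ℕ → Carrier

  -- With τ the shift, ∇ x = τ - x and ∇* x = ∏ₖ (τ - xₖ).
  ∇ : Carrier → Seq → Seq
  ∇ x s n = s (suc n) - x * s n

  ∇* : ∀ {n} → Row n → Seq → Seq
  ∇* {zero}  x s = s
  ∇* {suc n} x s = ∇* (x ∘ suc) (∇ (x zero) s)

  ∇-cong : ∀ x {s t} → (∀ n → s n ≈ t n) → ∀ n → ∇ x s n ≈ ∇ x t n
  ∇-cong x e n = +-cong (e (suc n)) (-‿cong (*-congˡ (e n)))

  ∇*-cong : ∀ {n} (x : Row n) {s t} → (∀ n → s n ≈ t n) → ∀ n → ∇* x s n ≈ ∇* x t n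
  ∇*-cong {zero}  x e = e
  ∇*-cong {suc n} x e = ∇*-cong (x ∘ suc) (∇-cong (x zero) e)

  ∇*-cong-≡ : ∀ {n} {x y : Row n} s → (∀ i → x i ≡ y i) → ∀ k → ∇* x s k ≈ ∇* y s k
  ∇*-cong-≡ {zero}          s e k = refl
  ∇*-cong-≡ {suc n} {x} {y} s e k = trans
    (∇*-cong (x ∘ suc) (λ m → reflexive (≡.cong (λ a → ∇ a s m) (e zero))) k)
    (∇*-cong-≡ (∇ (y zero) s) (e ∘ suc) k)

  ∇-comm : ∀ x y s n → ∇ x (∇ y s) n ≈ ∇ y (∇ x s) n
  ∇-comm x y s n = solve 5 (λ x y a b c → (a :- y :* b) :- x :* (b :- y :* c) := (a :- x :* b) :- y :* (b :- x :* c))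
    refl x y (s (suc (suc n))) (s (suc n)) (s n)

  ∇*-init-last : ∀ {n} (x : Row (suc n)) s k → ∇* x s k ≈ ∇* (x ∘ inject₁) (∇ (x (fromℕ n)) s) k
  ∇*-init-last {zero}  x s k = refl
  ∇*-init-last {suc n} x s k = trans
    (∇*-init-last (x ∘ suc) (∇ (x zero) s) k)
    (∇*-cong (x ∘ suc ∘ inject₁) (∇-comm (x (fromℕ (suc n))) (x zero) s) k)

  -- Row i is ∏_{k<i} (τ - zₖ) applied to s.
  newton : ∀ {n} → Row n → Seq → Fin (suc n) → Seq
  newton         z s zero    = s
  newton {suc n} z s (suc i) = newton (z ∘ suc) (∇ (z zero) s) i

  newton-∇ : ∀ {n} (z : Row n) c s i k → newton z (∇ c s) i k ≈ ∇ c (newton z s i) k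
  newton-∇         z c s zero    k = refl
  newton-∇ {suc n} z c s (suc i) k = trans
    (newton-cong (z ∘ suc) (∇-comm (z zero) c s) i k)
    (newton-∇ (z ∘ suc) c (∇ (z zero) s) i k)
    where
    newton-cong : ∀ {n} (z : Row n) {s t} → (∀ n → s n ≈ t n) → ∀ i k → newton z s i k ≈ newton z t i k
    newton-cong         z e zero    k = e k
    newton-cong {suc n} z e (suc i) k = newton-cong (z ∘ suc) (∇-cong (z zero) e) i k

  newton-last : ∀ {n} (z : Row n) s k → newton z s (fromℕ n) k ≡ ∇* z s k
  newton-last {zero}  z s k = ≡.refl
  newton-last {suc n} z s k = newton-last (z ∘ suc) (∇ (z zero) s) k

  newton-init : ∀ {n} (z : Row (suc n)) s i k → newton z s (inject₁ i) k ≡ newton (z ∘ inject₁) s i k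
  newton-init         z s zero    k = ≡.refl
  newton-init {suc n} z s (suc i) k = newton-init (z ∘ suc) (∇ (z zero) s) i k

  -- Subtracting `z zero` times the row above turns every later row into a row of the shifted
  -- problem for `∇ (z zero) s`. The column offsets `p` are arbitrary because the induction passes
  -- to minors, which omit one of them.
  det-newton : ∀ {n} (z : Row n) s (p : Fin (suc n) → ℕ) →
    det ring {suc n} (λ i j → s (toℕ i ℕ.+ p j)) ≈ det ring (λ i j → newton z s i (p j))
  det-newton {zero}  z s p = det-cong (λ i j → s (toℕ i ℕ.+ p j)) (λ i j → newton z s i (p j)) λ { zero j → refl }
  det-newton {suc n} z s p = begin
    det ring {suc (suc n)} M
      ≈⟨ det-cong M (M zero ∷ʳ M ∘ suc) (λ { zero j → refl ; (suc i) j → refl }) ⟩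
    det ring (M zero ∷ʳ M ∘ suc)
      ≈⟨ det-differences (z zero) (M zero) (M ∘ suc) ⟨
    det ring (M zero ∷ʳ differences (z zero) (M zero) (M ∘ suc))
      ≈⟨ det-cong (M zero ∷ʳ differences (z zero) (M zero) (M ∘ suc)) (M zero ∷ʳ M′)
           (λ { zero j → refl ; (suc i) j → trans (differences-at (z zero) (M zero) (M ∘ suc) i j)
                  (+-congˡ (-‿cong (*-congˡ (row i j)))) }) ⟩
    det ring (M zero ∷ʳ M′)
      ≈⟨ det-∷ʳ (M zero) M′ (λ i j → newton (z ∘ suc) (∇ (z zero) s) i (p j))
           (λ k → det-newton (z ∘ suc) (∇ (z zero) s) (p ∘ punchIn k)) ⟩
    det ring (M zero ∷ʳ λ i j → newton (z ∘ suc) (∇ (z zero) s) i (p j))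
      ≈⟨ det-cong (M zero ∷ʳ λ i j → newton (z ∘ suc) (∇ (z zero) s) i (p j)) (λ i j → newton z s i (p j))
           (λ { zero j → refl ; (suc i) j → refl }) ⟩
    det ring (λ i j → newton z s i (p j)) ∎
    where
    M : Mat (suc (suc n))
    M i j = s (toℕ i ℕ.+ p j)
    M′ : Fin (suc n) → Row (suc (suc n))
    M′ i j = ∇ (z zero) s (toℕ i ℕ.+ p j)
    row : ∀ i j → (M zero ∷ʳ M ∘ suc) (inject₁ i) j ≈ s (toℕ i ℕ.+ p j)
    row zero    j = refl
    row (suc i) j = reflexive (≡.cong (λ k → s (suc k ℕ.+ p j)) (Finₚ.toℕ-inject₁ i))

  det-zero-row : ∀ {n} (M : Mat n) r → (∀ j → M r j ≈ 0#) → det ring M ≈ 0#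
  det-zero-row {suc n} M zero    e = sum-0 λ j → trans (*-congʳ (trans (*-congˡ {⟨ toℕ j ⟩} (e j)) (zeroʳ _))) (zeroˡ (det ring (minor (M ∘ suc) j)))
  det-zero-row {suc n} M (suc r) e = sum-0 λ j → trans
    (*-congˡ {⟨ toℕ j ⟩ * M zero j} (det-zero-row (minor (M ∘ suc) j) r (λ k → e (punchIn j k)))) (zeroʳ _)

  punchIn-fromℕ : ∀ {n} (i : Fin n) → punchIn (fromℕ n) i ≡ inject₁ i
  punchIn-fromℕ zero    = ≡.refl
  punchIn-fromℕ (suc i) = ≡.cong suc (punchIn-fromℕ i)

  punchIn-inject₁-fromℕ : ∀ {n} (i : Fin (suc n)) → punchIn (inject₁ i) (fromℕ n) ≡ fromℕ (suc n)
  punchIn-inject₁-fromℕ zero = ≡.refl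
  punchIn-inject₁-fromℕ {suc n} (suc i) = ≡.cong suc (punchIn-inject₁-fromℕ i)

  punchIn-inject₁ : ∀ {n} (i : Fin (suc n)) (k : Fin n) → punchIn (inject₁ i) (inject₁ k) ≡ inject₁ (punchIn i k)
  punchIn-inject₁ zero    k       = ≡.refl
  punchIn-inject₁ (suc i) zero    = ≡.refl
  punchIn-inject₁ (suc i) (suc k) = ≡.cong suc (punchIn-inject₁ i k)

  -- Expand along column 0: every minor but the last still contains the last row, which is zero
  -- there.
  det-sparse-last-row : ∀ {n} (M : Mat (suc n)) → (∀ j → M (fromℕ n) (suc j) ≈ 0#) →
    det ring M ≈ ⟨ n ⟩ * M (fromℕ n) zero * det ring (λ i j → M (inject₁ i) (suc j))
  det-sparse-last-row {n} M e = begin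
    det ring M
      ≈⟨ det-column-expansion M ⟩
    sum (λ i → ⟨ toℕ i ⟩ * M i zero * det ring (D i))
      ≈⟨ MonoidSum.sum-init-last +-commutativeMonoid (λ i → ⟨ toℕ i ⟩ * M i zero * det ring (D i)) ⟩
    sum (λ i → ⟨ toℕ (inject₁ i) ⟩ * M (inject₁ i) zero * det ring (D (inject₁ i)))
      + ⟨ toℕ (fromℕ n) ⟩ * M (fromℕ n) zero * det ring (D (fromℕ n))
      ≈⟨ +-cong (sum-0 (λ i → trans (*-congˡ {⟨ toℕ (inject₁ i) ⟩ * M (inject₁ i) zero} (vanish i)) (zeroʳ _)))
           (*-cong (*-congʳ (reflexive (≡.cong ⟨_⟩ (Finₚ.toℕ-fromℕ n))))
             (det-cong (D (fromℕ n)) (λ i j → M (inject₁ i) (suc j)) λ i j → reflexive (≡.cong (λ k → M k (suc j)) (punchIn-fromℕ i)))) ⟩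
    0# + ⟨ n ⟩ * M (fromℕ n) zero * det ring (λ i j → M (inject₁ i) (suc j))
      ≈⟨ +-identityˡ _ ⟩
    ⟨ n ⟩ * M (fromℕ n) zero * det ring (λ i j → M (inject₁ i) (suc j)) ∎
    where
    D : Fin (suc n) → Mat n
    D i a b = M (punchIn i a) (suc b)
    vanish : ∀ i → det ring (D (inject₁ i)) ≈ 0#
    vanish i = det-minor n M e i
      where
      det-minor : ∀ n (M : Mat (suc n)) → (∀ j → M (fromℕ n) (suc j) ≈ 0#) →
        ∀ i → det ring (λ a b → M (punchIn (inject₁ i) a) (suc b)) ≈ 0#
      det-minor (suc n) M e i = det-zero-row (λ a b → M (punchIn (inject₁ i) a) (suc b)) (fromℕ n)
        λ j → trans (reflexive (≡.cong (λ k → M k (suc j)) (punchIn-inject₁-fromℕ i))) (e j)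

  det-column-differences : ∀ {n} c (M : Mat (suc n)) →
    det ring M ≈ det ring (λ i → M i zero ∷ʳ (λ j → M i (suc j) - c * M i (inject₁ j)))
  det-column-differences {n} c M = begin
    det ring M
      ≈⟨ det-transpose M ⟨
    det ring Mᵀ
      ≈⟨ det-cong Mᵀ (Mᵀ zero ∷ʳ Mᵀ ∘ suc) (λ { zero i → refl ; (suc j) i → refl }) ⟩
    det ring (Mᵀ zero ∷ʳ Mᵀ ∘ suc)
      ≈⟨ det-differences c (Mᵀ zero) (Mᵀ ∘ suc) ⟨
    det ring (Mᵀ zero ∷ʳ differences c (Mᵀ zero) (Mᵀ ∘ suc))
      ≈⟨ det-cong (Mᵀ zero ∷ʳ differences c (Mᵀ zero) (Mᵀ ∘ suc)) (λ j i → M′ i j)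
           (λ { zero i → refl ; (suc j) i → trans (differences-at c (Mᵀ zero) (Mᵀ ∘ suc) j i)
                (+-congˡ (-‿cong (*-congˡ (column j i)))) }) ⟩
    det ring (λ j i → M′ i j)
      ≈⟨ det-transpose M′ ⟩
    det ring M′ ∎
    where
    Mᵀ M′ : Mat (suc n)
    Mᵀ j i = M i j
    M′ i = M i zero ∷ʳ (λ j → M i (suc j) - c * M i (inject₁ j))
    column : ∀ j i → (Mᵀ zero ∷ʳ Mᵀ ∘ suc) (inject₁ j) i ≈ M i (inject₁ j)
    column zero    i = refl
    column (suc j) i = refl

  -- Induction from the far end. Subtracting from each column the last node `y` times its left
  -- neighbour applies τ - y to all columns but the first. This clears the last row except for its
  -- corner entry, and what remains is the same problem for `∇ y s` with the last node removed.
  det-newton-product : ∀ {n} (x : Row (suc n)) s → (∀ k → ∇* x s k ≈ 0#) →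
    det ring {suc n} (λ i j → newton (x ∘ inject₁) s i (toℕ j))
      ≈ ⟨ suc n C 2 ⟩ * product (λ m → ∇* (x ∘ punchIn m) s 0)
  det-newton-product {zero}  x s e = solve 1 (λ a → :1 :* a :* :1 :+ :0 := :1 :* (a :* :1)) refl (s 0)
  det-newton-product {suc n} x s e = begin
    det ring {suc (suc n)} (λ i j → newton z s i (toℕ j))
      ≈⟨ det-column-differences y (λ i j → newton z s i (toℕ j)) ⟩
    det ring M
      -- Beyond column 0 the last row now carries all factors τ - xₖ, so it consists of values of
      -- `∇* x s`, zero by assumption.
      ≈⟨ det-sparse-last-row M (λ j → trans (entry (fromℕ (suc n)) j)
           (trans (reflexive (newton-last z (∇ y s) (toℕ j))) (trans (sym (∇*-init-last x s (toℕ j))) (e (toℕ j))))) ⟩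
    ⟨ suc n ⟩ * newton z s (fromℕ (suc n)) 0 * det ring (λ i j → M (inject₁ i) (suc j))
      ≈⟨ *-cong (*-congˡ (reflexive (newton-last z s 0)))
           (det-cong (λ i j → M (inject₁ i) (suc j)) (λ i j → newton (z ∘ inject₁) (∇ y s) i (toℕ j))
             λ i j → trans (entry (inject₁ i) j) (reflexive (newton-init z (∇ y s) i (toℕ j)))) ⟩
    ⟨ suc n ⟩ * ∇* z s 0 * det ring {suc n} (λ i j → newton (z ∘ inject₁) (∇ y s) i (toℕ j))
      ≈⟨ *-congˡ (det-newton-product z (∇ y s) (λ k → trans (sym (∇*-init-last x s k)) (e k))) ⟩
    ⟨ suc n ⟩ * ∇* z s 0 * (⟨ suc n C 2 ⟩ * product (λ m → ∇* (z ∘ punchIn m) (∇ y s) 0))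
      ≈⟨ solve 4 (λ a b c d → a :* b :* (c :* d) := (a :* c) :* (d :* b)) refl ⟨ suc n ⟩ (∇* z s 0) ⟨ suc n C 2 ⟩ (product (λ m → ∇* (z ∘ punchIn m) (∇ y s) 0)) ⟩
    (⟨ suc n ⟩ * ⟨ suc n C 2 ⟩) * (product (λ m → ∇* (z ∘ punchIn m) (∇ y s) 0) * ∇* z s 0)
      ≈⟨ *-cong sign (*-cong (∏.sum-cong-≋ κ) (∇*-cong-≡ s (λ i → ≡.sym (≡.cong x (punchIn-fromℕ i))) 0)) ⟩
    ⟨ suc (suc n) C 2 ⟩ * (product (λ m → ∇* (x ∘ punchIn (inject₁ m)) s 0) * ∇* (x ∘ punchIn (fromℕ (suc n))) s 0)
      ≈⟨ *-congˡ (∏.sum-init-last (λ m → ∇* (x ∘ punchIn m) s 0)) ⟨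
    ⟨ suc (suc n) C 2 ⟩ * product (λ m → ∇* (x ∘ punchIn m) s 0) ∎
    where
    y = x (fromℕ (suc n))
    z = x ∘ inject₁
    M : Mat (suc (suc n))
    M i = newton z s i 0 ∷ʳ (λ j → newton z s i (suc (toℕ j)) - y * newton z s i (toℕ (inject₁ j)))
    entry : ∀ i j → M i (suc j) ≈ newton z (∇ y s) i (toℕ j)
    entry i j = trans (reflexive (≡.cong (λ k → newton z s i (suc (toℕ j)) - y * newton z s i k) (Finₚ.toℕ-inject₁ j)))
      (sym (newton-∇ z y s i (toℕ j)))
    -- Pascal's rule, with `suc n` read as the binomial coefficient `suc n C 1`.
    sign : ⟨ suc n ⟩ * ⟨ suc n C 2 ⟩ ≈ ⟨ suc (suc n) C 2 ⟩
    sign = trans (sym (^.×-homo-+ (- 1#) (suc n) (suc n C 2)))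
      (reflexive (≡.cong ⟨_⟩ (≡.trans (≡.cong (ℕ._+ (suc n C 2)) (≡.sym (nC1≡n (suc n)))) (nCk+nC[k+1]≡[n+1]C[k+1] (suc n) 1))))
    κ : ∀ m → ∇* (z ∘ punchIn m) (∇ y s) 0 ≈ ∇* (x ∘ punchIn (inject₁ m)) s 0
    κ m = sym (trans (∇*-init-last (x ∘ punchIn (inject₁ m)) s 0) (trans
      (∇*-cong-≡ (∇ (x (punchIn (inject₁ m) (fromℕ n))) s) (λ k → ≡.cong x (punchIn-inject₁ m k)) 0)
      (∇*-cong (z ∘ punchIn m) (λ k → reflexive (≡.cong (λ i → ∇ (x i) s k) (punchIn-inject₁-fromℕ m))) 0)))

  det-hankel : ∀ {n} (x : Row (suc n)) s → (∀ k → ∇* x s k ≈ 0#) →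
    det ring {suc n} (λ i j → s (toℕ i ℕ.+ toℕ j)) ≈ ⟨ suc n C 2 ⟩ * product (λ m → ∇* (x ∘ punchIn m) s 0)
  det-hankel x s e = trans (det-newton (x ∘ inject₁) s toℕ) (det-newton-product x s e)

-- Signs, Kronecker deltas and sums over the signed index set

module SignedSums {c ℓ} (A : Ring c ℓ) (N : ℕ) where
  open Ring A hiding (zero)
  open BigOperators A using (sum)
  private
    module RP = RingProps A
    open SetoidReasoning setoid
  open SemiringSum semiring using (sum-cong-≋; ∑-distrib-+; *-distribˡ-sum; *-distribʳ-sum; sum-replicate-zero)

  I : Set
  I = Sign × Fin N

  infix 8 ⁻_
  ⁻_ : I → I
  ⁻ (s , i) = Sign.opposite s , i

  ⟪_⟫ : I → Parity
  ⟪ s , _ ⟫ = ℙ.fromSign s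

  ⁻-involutive : ∀ i → ⁻ ⁻ i ≡ i
  ⁻-involutive (Sign.+ , i) = ≡.refl
  ⁻-involutive (Sign.- , i) = ≡.refl

  middle : ∀ k m l → (k ℙ.+ m) ℙ.+ (m ℙ.+ l) ≡ k ℙ.+ l
  middle 0ℙ 0ℙ l = ≡.refl
  middle 0ℙ 1ℙ 0ℙ = ≡.refl
  middle 0ℙ 1ℙ 1ℙ = ≡.refl
  middle 1ℙ 0ℙ l = ≡.refl
  middle 1ℙ 1ℙ l = ≡.refl

  -- Signs act by negation because a bare ring `A` carries no scalars; in the enveloping algebra
  -- `sgn-*` identifies this with multiplication by `scalar (sgn p)`.
  σ : Parity → Carrier → Carrier
  σ 0ℙ u = u
  σ 1ℙ u = - u

  σ-cong : ∀ p {u v} → u ≈ v → σ p u ≈ σ p v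
  σ-cong 0ℙ e = e
  σ-cong 1ℙ e = -‿cong e

  σ-≡ : ∀ {p q} u → p ≡ q → σ p u ≈ σ q u
  σ-≡ u ≡.refl = refl

  σ-σ : ∀ p q u → σ p (σ q u) ≈ σ (p ℙ.+ q) u
  σ-σ 0ℙ q  u = refl
  σ-σ 1ℙ 0ℙ u = refl
  σ-σ 1ℙ 1ℙ u = RP.-‿involutive u

  σ-+ : ∀ p u v → σ p (u + v) ≈ σ p u + σ p v
  σ-+ 0ℙ u v = refl
  σ-+ 1ℙ u v = sym (RP.-‿+-comm u v)

  σ-*ˡ : ∀ p u v → σ p u * v ≈ σ p (u * v)
  σ-*ˡ 0ℙ u v = refl
  σ-*ˡ 1ℙ u v = sym (RP.-‿distribˡ-* u v)

  σ-*ʳ : ∀ p u v → u * σ p v ≈ σ p (u * v)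
  σ-*ʳ 0ℙ u v = refl
  σ-*ʳ 1ℙ u v = sym (RP.-‿distribʳ-* u v)

  σ-0 : ∀ p → σ p 0# ≈ 0#
  σ-0 0ℙ = refl
  σ-0 1ℙ = RP.-0#≈0#

  σ-cancel : ∀ p u → σ (1ℙ ℙ.+ p) u + σ p u ≈ 0#
  σ-cancel 0ℙ u = -‿inverseˡ u
  σ-cancel 1ℙ u = -‿inverseʳ u

  _≡ᴵ_ : I → I → Bool
  (s , i) ≡ᴵ (t , j) = does (s Signₚ.≟ t) ∧ does (i Finₚ.≟ j)

  δ : I → I → Carrier → Carrier
  δ i j u = if i ≡ᴵ j then u else 0#

  if-cong : ∀ b {u v} → u ≈ v → (if b then u else 0#) ≈ (if b then v else 0#)
  if-cong true  e = e
  if-cong false e = refl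

  δ-cong : ∀ i j {u v} → u ≈ v → δ i j u ≈ δ i j v
  δ-cong i j = if-cong (i ≡ᴵ j)

  δ-refl : ∀ i u → δ i i u ≈ u
  δ-refl (s , i) u with s Signₚ.≟ s | i Finₚ.≟ i
  ... | yes _ | yes _ = refl
  ... | no ¬e | _     = ⊥-elim (¬e ≡.refl)
  ... | yes _ | no ¬e = ⊥-elim (¬e ≡.refl)

  δ-≢ : ∀ i j u → i ≢ j → δ i j u ≈ 0#
  δ-≢ (s , i) (t , j) u i≢j with s Signₚ.≟ t | i Finₚ.≟ j
  ... | yes ≡.refl | yes ≡.refl = ⊥-elim (i≢j ≡.refl)
  ... | no _  | _    = refl
  ... | yes _ | no _ = refl

  if-*ˡ : ∀ b u v → (if b then u else 0#) * v ≈ (if b then u * v else 0#)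
  if-*ˡ true  u v = refl
  if-*ˡ false u v = zeroˡ v

  δ-*ˡ : ∀ i j u v → δ i j u * v ≈ δ i j (u * v)
  δ-*ˡ i j = if-*ˡ (i ≡ᴵ j)

  if-*ʳ : ∀ b u v → u * (if b then v else 0#) ≈ (if b then u * v else 0#)
  if-*ʳ true  u v = refl
  if-*ʳ false u v = zeroʳ u

  δ-*ʳ : ∀ i j u v → u * δ i j v ≈ δ i j (u * v)
  δ-*ʳ i j = if-*ʳ (i ≡ᴵ j)

  if-σ : ∀ b p u → σ p (if b then u else 0#) ≈ (if b then σ p u else 0#)
  if-σ true  p u = refl
  if-σ false p u = σ-0 p

  δ-σ : ∀ i j p u → σ p (δ i j u) ≈ δ i j (σ p u)
  δ-σ i j = if-σ (i ≡ᴵ j)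

  -- Definitionally equal to Queer.sumI at the additive monoid of A.
  ΣI : (I → Carrier) → Carrier
  ΣI f = sum (λ i → f (Sign.- , i)) + sum (λ i → f (Sign.+ , i))

  ΣI-cong : ∀ {f g : I → Carrier} → (∀ i → f i ≈ g i) → ΣI f ≈ ΣI g
  ΣI-cong e = +-cong (sum-cong-≋ (λ i → e (Sign.- , i))) (sum-cong-≋ (λ i → e (Sign.+ , i)))

  ΣI-+ : ∀ f g → ΣI (λ i → f i + g i) ≈ ΣI f + ΣI g
  ΣI-+ f g = trans
    (+-cong (∑-distrib-+ (λ i → f (Sign.- , i)) (λ i → g (Sign.- , i))) (∑-distrib-+ (λ i → f (Sign.+ , i)) (λ i → g (Sign.+ , i))))
    (CommSemigroupProps.interchange +-commutativeSemigroup _ _ _ _)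

  ΣI-*ˡ : ∀ u f → u * ΣI f ≈ ΣI (λ i → u * f i)
  ΣI-*ˡ u f = trans (distribˡ u _ _)
    (+-cong (*-distribˡ-sum u (λ i → f (Sign.- , i))) (*-distribˡ-sum u (λ i → f (Sign.+ , i))))

  ΣI-*ʳ : ∀ u f → ΣI f * u ≈ ΣI (λ i → f i * u)
  ΣI-*ʳ u f = trans (distribʳ u _ _)
    (+-cong (*-distribʳ-sum u (λ i → f (Sign.- , i))) (*-distribʳ-sum u (λ i → f (Sign.+ , i))))

  ΣI-0 : ΣI (λ _ → 0#) ≈ 0#
  ΣI-0 = trans (+-cong (sum-replicate-zero N) (sum-replicate-zero N)) (+-identityˡ 0#)

  ΣI-⁻ : ∀ f → ΣI (λ i → f (⁻ i)) ≈ ΣI f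
  ΣI-⁻ f = +-comm _ _

  ΣI-σ : ∀ p f → σ p (ΣI f) ≈ ΣI (λ i → σ p (f i))
  ΣI-σ 0ℙ f = refl
  ΣI-σ 1ℙ f = begin
    - ΣI f                    ≈⟨ RP.-1*x≈-x _ ⟨
    - 1# * ΣI f               ≈⟨ ΣI-*ˡ (- 1#) f ⟩
    ΣI (λ i → - 1# * f i)     ≈⟨ ΣI-cong (λ i → RP.-1*x≈-x (f i)) ⟩
    ΣI (λ i → - f i)          ∎

  if-ΣI : ∀ b (f : I → Carrier) → (if b then ΣI f else 0#) ≈ ΣI (λ m → if b then f m else 0#)
  if-ΣI true  f = refl
  if-ΣI false f = sym ΣI-0

  δ-ΣI : ∀ i j (f : I → Carrier) → δ i j (ΣI f) ≈ ΣI (λ m → δ i j (f m))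
  δ-ΣI i j = if-ΣI (i ≡ᴵ j)

  sum-δ : ∀ {n} (i : Fin n) (f : Fin n → Carrier) → sum (λ j → if does (i Finₚ.≟ j) then f j else 0#) ≈ f i
  sum-δ {suc n} zero    f = trans (+-congˡ (sum-replicate-zero n)) (+-identityʳ _)
  sum-δ {suc n} (suc i) f = trans (+-identityˡ _) (sum-δ i (f ∘ suc))

  collapse : ∀ i (f : I → Carrier) → ΣI (λ j → δ i j (f j)) ≈ f i
  collapse (Sign.- , i) f = trans (+-cong (sum-δ i (λ j → f (Sign.- , j))) (sum-replicate-zero N)) (+-identityʳ _)
  collapse (Sign.+ , i) f = trans (+-cong (sum-replicate-zero N) (sum-δ i (λ j → f (Sign.+ , j)))) (+-identityˡ _)

  collapse⁻ : ∀ i (f : I → Carrier) → ΣI (λ j → δ i (⁻ j) (f j)) ≈ f (⁻ i)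
  collapse⁻ i f = begin
    ΣI (λ j → δ i (⁻ j) (f j))           ≈⟨ ΣI-cong (λ j → δ-cong i (⁻ j) (reflexive (≡.cong f (≡.sym (⁻-involutive j))))) ⟩
    ΣI (λ j → δ i (⁻ j) (f (⁻ ⁻ j)))     ≈⟨ ΣI-⁻ (λ j → δ i j (f (⁻ j))) ⟩
    ΣI (λ j → δ i j (f (⁻ j)))           ≈⟨ collapse i (λ j → f (⁻ j)) ⟩
    f (⁻ i)                              ∎

-- Superbrackets with the generators, the signed matrix product and its trace

module QueerCommutation {c ℓ} (A : Ring c ℓ) (N : ℕ) (F : Sign × Fin N → Sign × Fin N → Ring.Carrier A) where
  open Ring A hiding (zero)
  open SignedSums A N public
  open SetoidReasoning setoid
  open CommutativeMonoidSolver +-commutativeMonoid using (solve; _⊕_; _⊜_)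

  s : I → I → I → I → Parity
  s i j k l = (⟪ i ⟫ ℙ.+ ⟪ j ⟫) ℙ.* (⟪ k ⟫ ℙ.+ ⟪ l ⟫)

  -- For X = F this is the superbracket of two generators of the queer Lie superalgebra. The summand
  -- `1ℙ` in the exponents is the minus sign in front of the second product.
  ad : (I → I → Carrier) → I → I → I → I → Carrier
  ad X i j k l = (δ j k (X i l) + δ j (⁻ k) (X (⁻ i) l))
    + (σ (1ℙ ℙ.+ s i j k l) (δ i l (X k j)) + σ (1ℙ ℙ.+ s i j k l) (δ (⁻ i) l (X k (⁻ j))))

  -- The superbrackets [F i j , X k l} are those of the adjoint action of F.
  Adjoint : (I → I → Carrier) → Set ℓ
  Adjoint X = ∀ i j k l → F i j * X k l ≈ σ (s i j k l) (X k l * F i j) + ad X i j k l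

  infixl 7 _⋆_
  -- The sign attached to the summation index is the one that interior indices carry in the cyclic
  -- elements, so iterating this product gives the signed path sums.
  _⋆_ : (I → I → Carrier) → (I → I → Carrier) → I → I → Carrier
  (X ⋆ Y) k l = ΣI λ m → σ ⟪ m ⟫ (X k m * Y m l)

  σδ*ˡ : ∀ p q i j u v → σ p (σ q (δ i j u) * v) ≈ δ i j (σ (p ℙ.+ q) (u * v))
  σδ*ˡ p q i j u v = begin
    σ p (σ q (δ i j u) * v)     ≈⟨ σ-cong p (σ-*ˡ q _ v) ⟩
    σ p (σ q (δ i j u * v))     ≈⟨ σ-σ p q _ ⟩
    σ (p ℙ.+ q) (δ i j u * v)   ≈⟨ σ-cong (p ℙ.+ q) (δ-*ˡ i j u v) ⟩
    σ (p ℙ.+ q) (δ i j (u * v)) ≈⟨ δ-σ i j (p ℙ.+ q) _ ⟩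
    δ i j (σ (p ℙ.+ q) (u * v)) ∎

  σδ*ʳ : ∀ p q i j u v → σ p (u * σ q (δ i j v)) ≈ δ i j (σ (p ℙ.+ q) (u * v))
  σδ*ʳ p q i j u v = begin
    σ p (u * σ q (δ i j v))     ≈⟨ σ-cong p (σ-*ʳ q u _) ⟩
    σ p (σ q (u * δ i j v))     ≈⟨ σ-σ p q _ ⟩
    σ (p ℙ.+ q) (u * δ i j v)   ≈⟨ σ-cong (p ℙ.+ q) (δ-*ʳ i j u v) ⟩
    σ (p ℙ.+ q) (δ i j (u * v)) ≈⟨ δ-σ i j (p ℙ.+ q) _ ⟩
    δ i j (σ (p ℙ.+ q) (u * v)) ∎

  -- The Leibniz rule: bracketing each summand with `F i j` gives four terms from `F k m` and four
  -- from `X m l`. Those whose delta involves an outer index (`a`, `b`, `g`, `h`) assemble to the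
  -- bracket of the product; those whose delta fixes the summation index (`c₁`, `d`, `e`, `f`)
  -- cancel in pairs after summation.
  adjoint-⋆ : ∀ {X} → Adjoint F → Adjoint X → Adjoint (F ⋆ X)
  adjoint-⋆ {X} adF adX i j k l = begin
    F i j * (F ⋆ X) k l
      ≈⟨ ΣI-*ˡ (F i j) (λ m → σ ⟪ m ⟫ (F k m * X m l)) ⟩
    ΣI (λ m → F i j * σ ⟪ m ⟫ (F k m * X m l))
      ≈⟨ ΣI-cong expand ⟩
    ΣI (λ m → σ (s i j k l) (σ ⟪ m ⟫ (F k m * X m l) * F i j) + ((a m + b m + (c₁ m + d m)) + (e m + f m + (g m + h m))))
      ≈⟨ ΣI-+ (λ m → σ (s i j k l) (σ ⟪ m ⟫ (F k m * X m l) * F i j)) (λ m → (a m + b m + (c₁ m + d m)) + (e m + f m + (g m + h m))) ⟩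
    ΣI (λ m → σ (s i j k l) (σ ⟪ m ⟫ (F k m * X m l) * F i j)) + ΣI (λ m → (a m + b m + (c₁ m + d m)) + (e m + f m + (g m + h m)))
      ≈⟨ +-cong (trans (sym (ΣI-σ (s i j k l) (λ m → σ ⟪ m ⟫ (F k m * X m l) * F i j)))
             (σ-cong (s i j k l) (sym (ΣI-*ʳ (F i j) (λ m → σ ⟪ m ⟫ (F k m * X m l))))))
           (trans (ΣI-+ (λ m → a m + b m + (c₁ m + d m)) (λ m → e m + f m + (g m + h m)))
             (+-cong (split a b c₁ d) (split e f g h))) ⟩
    σ (s i j k l) ((F ⋆ X) k l * F i j) + ((ΣI a + ΣI b + (ΣI c₁ + ΣI d)) + (ΣI e + ΣI f + (ΣI g + ΣI h)))
      ≈⟨ +-congˡ (solve 8 (λ a b c d e f g h → ((a ⊕ b) ⊕ (c ⊕ d)) ⊕ ((e ⊕ f) ⊕ (g ⊕ h)) ⊜ ((a ⊕ b) ⊕ (g ⊕ h)) ⊕ ((c ⊕ e) ⊕ (d ⊕ f)))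
           refl (ΣI a) (ΣI b) (ΣI c₁) (ΣI d) (ΣI e) (ΣI f) (ΣI g) (ΣI h)) ⟩
    σ (s i j k l) ((F ⋆ X) k l * F i j) + (((ΣI a + ΣI b) + (ΣI g + ΣI h)) + ((ΣI c₁ + ΣI e) + (ΣI d + ΣI f)))
      ≈⟨ +-congˡ (+-cong (+-cong (+-cong (δ-ΣI j k (λ m → σ ⟪ m ⟫ (F i m * X m l))) (δ-ΣI j (⁻ k) (λ m → σ ⟪ m ⟫ (F (⁻ i) m * X m l)))) (+-cong Σg Σh)) (+-cong cancel-ce cancel-df)) ⟨
    σ (s i j k l) ((F ⋆ X) k l * F i j) + (ad (F ⋆ X) i j k l + (0# + 0#))
      ≈⟨ +-congˡ (trans (+-congˡ (+-identityˡ 0#)) (+-identityʳ _)) ⟩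
    σ (s i j k l) ((F ⋆ X) k l * F i j) + ad (F ⋆ X) i j k l ∎
    where
    p : I → Parity
    p m = ⟪ m ⟫ ℙ.+ s i j k m
    a b c₁ d e f g h : I → Carrier
    a m = δ j k (σ ⟪ m ⟫ (F i m * X m l))
    b m = δ j (⁻ k) (σ ⟪ m ⟫ (F (⁻ i) m * X m l))
    c₁ m = δ i m (σ (⟪ m ⟫ ℙ.+ (1ℙ ℙ.+ s i j k m)) (F k j * X m l))
    d m = δ (⁻ i) m (σ (⟪ m ⟫ ℙ.+ (1ℙ ℙ.+ s i j k m)) (F k (⁻ j) * X m l))
    e m = δ j m (σ (p m) (F k m * X i l))
    f m = δ j (⁻ m) (σ (p m) (F k m * X (⁻ i) l))
    g m = δ i l (σ (p m ℙ.+ (1ℙ ℙ.+ s i j m l)) (F k m * X m j))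
    h m = δ (⁻ i) l (σ (p m ℙ.+ (1ℙ ℙ.+ s i j m l)) (F k m * X m (⁻ j)))
    split : ∀ a b c d → ΣI (λ m → a m + b m + (c m + d m)) ≈ ΣI a + ΣI b + (ΣI c + ΣI d)
    split a b c d = trans (ΣI-+ (λ m → a m + b m) (λ m → c m + d m)) (+-cong (ΣI-+ a b) (ΣI-+ c d))

    sign-product : ∀ m → ⟪ m ⟫ ℙ.+ (s i j k m ℙ.+ s i j m l) ≡ s i j k l ℙ.+ ⟪ m ⟫
    sign-product m = lemma ⟪ m ⟫ (⟪ i ⟫ ℙ.+ ⟪ j ⟫) ⟪ k ⟫ ⟪ l ⟫
      where
      lemma : ∀ m t k l → m ℙ.+ ((t ℙ.* (k ℙ.+ m)) ℙ.+ (t ℙ.* (m ℙ.+ l))) ≡ (t ℙ.* (k ℙ.+ l)) ℙ.+ m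
      lemma m 0ℙ k l = ℙₚ.+-identityʳ m
      lemma 0ℙ 1ℙ 0ℙ 0ℙ = ≡.refl
      lemma 0ℙ 1ℙ 1ℙ 0ℙ = ≡.refl
      lemma 0ℙ 1ℙ 0ℙ 1ℙ = ≡.refl
      lemma 0ℙ 1ℙ 1ℙ 1ℙ = ≡.refl
      lemma 1ℙ 1ℙ 0ℙ 0ℙ = ≡.refl
      lemma 1ℙ 1ℙ 0ℙ 1ℙ = ≡.refl
      lemma 1ℙ 1ℙ 1ℙ 0ℙ = ≡.refl
      lemma 1ℙ 1ℙ 1ℙ 1ℙ = ≡.refl

    +-4 : ∀ p w x y z → σ p (w + x + (y + z)) ≈ σ p w + σ p x + (σ p y + σ p z)
    +-4 p w x y z = trans (σ-+ p _ _) (+-cong (σ-+ p w x) (σ-+ p y z))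

    expand : ∀ m → F i j * σ ⟪ m ⟫ (F k m * X m l) ≈
      σ (s i j k l) (σ ⟪ m ⟫ (F k m * X m l) * F i j) + ((a m + b m + (c₁ m + d m)) + (e m + f m + (g m + h m)))
    expand m = begin
      F i j * σ ⟪ m ⟫ (F k m * X m l)
        ≈⟨ trans (σ-*ʳ ⟪ m ⟫ _ _) (σ-cong ⟪ m ⟫ (sym (*-assoc _ _ _))) ⟩
      σ ⟪ m ⟫ (F i j * F k m * X m l)
        ≈⟨ σ-cong ⟪ m ⟫ (trans (*-congʳ (adF i j k m)) (distribʳ _ _ _)) ⟩
      σ ⟪ m ⟫ (σ (s i j k m) (F k m * F i j) * X m l + ad F i j k m * X m l)
        ≈⟨ trans (σ-+ ⟪ m ⟫ _ _) (+-congʳ (σ-cong ⟪ m ⟫ (trans (σ-*ˡ (s i j k m) _ _) (σ-cong (s i j k m) (*-assoc _ _ _))))) ⟩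
      σ ⟪ m ⟫ (σ (s i j k m) (F k m * (F i j * X m l))) + σ ⟪ m ⟫ (ad F i j k m * X m l)
        ≈⟨ +-cong (trans (σ-σ ⟪ m ⟫ (s i j k m) _) (σ-cong (p m) (trans (*-congˡ (adX i j m l)) (distribˡ _ _ _)))) left ⟩
      σ (p m) (F k m * σ (s i j m l) (X m l * F i j) + F k m * ad X i j m l) + (a m + b m + (c₁ m + d m))
        ≈⟨ +-congʳ (trans (σ-+ (p m) _ _) (+-cong main right)) ⟩
      σ (s i j k l) (σ ⟪ m ⟫ (F k m * X m l) * F i j) + (e m + f m + (g m + h m)) + (a m + b m + (c₁ m + d m))
        ≈⟨ trans (+-assoc _ _ _) (+-congˡ (+-comm _ _)) ⟩
      σ (s i j k l) (σ ⟪ m ⟫ (F k m * X m l) * F i j) + ((a m + b m + (c₁ m + d m)) + (e m + f m + (g m + h m))) ∎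
      where
      main : σ (p m) (F k m * σ (s i j m l) (X m l * F i j)) ≈ σ (s i j k l) (σ ⟪ m ⟫ (F k m * X m l) * F i j)
      main = begin
        σ (p m) (F k m * σ (s i j m l) (X m l * F i j))
          ≈⟨ σ-cong (p m) (trans (σ-*ʳ (s i j m l) _ _) (σ-cong (s i j m l) (sym (*-assoc _ _ _)))) ⟩
        σ (p m) (σ (s i j m l) (F k m * X m l * F i j))
          ≈⟨ trans (σ-σ (p m) (s i j m l) _) (σ-≡ _ (≡.trans (ℙₚ.+-assoc ⟪ m ⟫ (s i j k m) (s i j m l)) (sign-product m))) ⟩
        σ (s i j k l ℙ.+ ⟪ m ⟫) (F k m * X m l * F i j)
          ≈⟨ trans (sym (σ-σ (s i j k l) ⟪ m ⟫ _)) (σ-cong (s i j k l) (sym (σ-*ˡ ⟪ m ⟫ _ _))) ⟩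
        σ (s i j k l) (σ ⟪ m ⟫ (F k m * X m l) * F i j) ∎
      plainˡ : ∀ x y u → σ ⟪ m ⟫ (δ x y u * X m l) ≈ δ x y (σ ⟪ m ⟫ (u * X m l))
      plainˡ x y u = trans (σ-cong ⟪ m ⟫ (δ-*ˡ x y u _)) (δ-σ x y ⟪ m ⟫ _)
      plainʳ : ∀ x y u → σ (p m) (F k m * δ x y u) ≈ δ x y (σ (p m) (F k m * u))
      plainʳ x y u = trans (σ-cong (p m) (δ-*ʳ x y _ u)) (δ-σ x y (p m) _)
      left : σ ⟪ m ⟫ (ad F i j k m * X m l) ≈ a m + b m + (c₁ m + d m)
      left = trans
        (σ-cong ⟪ m ⟫ (trans (distribʳ _ _ _) (+-cong (distribʳ _ _ _) (distribʳ _ _ _))))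
        (trans (+-4 ⟪ m ⟫ _ _ _ _)
          (+-cong (+-cong (plainˡ j k (F i m)) (plainˡ j (⁻ k) (F (⁻ i) m)))
            (+-cong (σδ*ˡ ⟪ m ⟫ (1ℙ ℙ.+ s i j k m) i m (F k j) (X m l)) (σδ*ˡ ⟪ m ⟫ (1ℙ ℙ.+ s i j k m) (⁻ i) m (F k (⁻ j)) (X m l)))))
      right : σ (p m) (F k m * ad X i j m l) ≈ e m + f m + (g m + h m)
      right = trans
        (σ-cong (p m) (trans (distribˡ _ _ _) (+-cong (distribˡ _ _ _) (distribˡ _ _ _))))
        (trans (+-4 (p m) _ _ _ _)
          (+-cong (+-cong (plainʳ j m (X i l)) (plainʳ j (⁻ m) (X (⁻ i) l)))
            (+-cong (σδ*ʳ (p m) (1ℙ ℙ.+ s i j m l) i l (F k m) (X m j)) (σδ*ʳ (p m) (1ℙ ℙ.+ s i j m l) (⁻ i) l (F k m) (X m (⁻ j))))))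

    sign-gh : ∀ m → p m ℙ.+ (1ℙ ℙ.+ s i j m l) ≡ (1ℙ ℙ.+ s i j k l) ℙ.+ ⟪ m ⟫
    sign-gh m = ≡.trans (shuffle ⟪ m ⟫ (s i j k m) (s i j m l)) (≡.trans (≡.cong (1ℙ ℙ.+_) (sign-product m)) (≡.sym (ℙₚ.+-assoc 1ℙ (s i j k l) ⟪ m ⟫)))
      where
      shuffle : ∀ m x y → (m ℙ.+ x) ℙ.+ (1ℙ ℙ.+ y) ≡ 1ℙ ℙ.+ (m ℙ.+ (x ℙ.+ y))
      shuffle 0ℙ 0ℙ y = ≡.refl
      shuffle 0ℙ 1ℙ y = ≡.refl
      shuffle 1ℙ 0ℙ 0ℙ = ≡.refl
      shuffle 1ℙ 0ℙ 1ℙ = ≡.refl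
      shuffle 1ℙ 1ℙ 0ℙ = ≡.refl
      shuffle 1ℙ 1ℙ 1ℙ = ≡.refl

    Σgh : ∀ x y → σ (1ℙ ℙ.+ s i j k l) (δ x l ((F ⋆ X) k y)) ≈ ΣI (λ m → δ x l (σ (p m ℙ.+ (1ℙ ℙ.+ s i j m l)) (F k m * X m y)))
    Σgh x y = begin
      σ q (δ x l ((F ⋆ X) k y))            ≈⟨ δ-σ x l q _ ⟩
      δ x l (σ q ((F ⋆ X) k y))            ≈⟨ δ-cong x l (ΣI-σ q (λ m → σ ⟪ m ⟫ (F k m * X m y))) ⟩
      δ x l (ΣI λ m → σ q (σ ⟪ m ⟫ (F k m * X m y))) ≈⟨ δ-ΣI x l (λ m → σ q (σ ⟪ m ⟫ (F k m * X m y))) ⟩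
      ΣI (λ m → δ x l (σ q (σ ⟪ m ⟫ (F k m * X m y)))) ≈⟨ ΣI-cong (λ m → δ-cong x l (trans (σ-σ q ⟪ m ⟫ (F k m * X m y)) (σ-≡ (F k m * X m y) (≡.sym (sign-gh m))))) ⟩
      ΣI (λ m → δ x l (σ (p m ℙ.+ (1ℙ ℙ.+ s i j m l)) (F k m * X m y))) ∎
      where
      q = 1ℙ ℙ.+ s i j k l
    Σg : σ (1ℙ ℙ.+ s i j k l) (δ i l ((F ⋆ X) k j)) ≈ ΣI g
    Σg = Σgh i j
    Σh : σ (1ℙ ℙ.+ s i j k l) (δ (⁻ i) l ((F ⋆ X) k (⁻ j))) ≈ ΣI h
    Σh = Σgh (⁻ i) (⁻ j)

    opposite-parity : ∀ (x : I) → ⟪ ⁻ x ⟫ ≡ 1ℙ ℙ.+ ⟪ x ⟫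
    opposite-parity (Sign.+ , _) = ≡.refl
    opposite-parity (Sign.- , _) = ≡.refl
    sign-ce : ⟪ i ⟫ ℙ.+ (1ℙ ℙ.+ s i j k i) ≡ 1ℙ ℙ.+ (⟪ j ⟫ ℙ.+ s i j k j)
    sign-ce = lemma ⟪ i ⟫ ⟪ j ⟫ ⟪ k ⟫
      where
      lemma : ∀ i j k → i ℙ.+ (1ℙ ℙ.+ ((i ℙ.+ j) ℙ.* (k ℙ.+ i))) ≡ 1ℙ ℙ.+ (j ℙ.+ ((i ℙ.+ j) ℙ.* (k ℙ.+ j)))
      lemma 0ℙ 0ℙ k  = ≡.refl
      lemma 0ℙ 1ℙ 0ℙ = ≡.refl
      lemma 0ℙ 1ℙ 1ℙ = ≡.refl
      lemma 1ℙ 0ℙ 0ℙ = ≡.refl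
      lemma 1ℙ 0ℙ 1ℙ = ≡.refl
      lemma 1ℙ 1ℙ k  = ≡.refl
    sign-df : ⟪ ⁻ i ⟫ ℙ.+ (1ℙ ℙ.+ s i j k (⁻ i)) ≡ 1ℙ ℙ.+ (⟪ ⁻ j ⟫ ℙ.+ s i j k (⁻ j))
    sign-df rewrite opposite-parity i | opposite-parity j = lemma ⟪ i ⟫ ⟪ j ⟫ ⟪ k ⟫
      where
      lemma : ∀ i j k → (1ℙ ℙ.+ i) ℙ.+ (1ℙ ℙ.+ ((i ℙ.+ j) ℙ.* (k ℙ.+ (1ℙ ℙ.+ i))))
        ≡ 1ℙ ℙ.+ ((1ℙ ℙ.+ j) ℙ.+ ((i ℙ.+ j) ℙ.* (k ℙ.+ (1ℙ ℙ.+ j))))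
      lemma 0ℙ 0ℙ k  = ≡.refl
      lemma 0ℙ 1ℙ 0ℙ = ≡.refl
      lemma 0ℙ 1ℙ 1ℙ = ≡.refl
      lemma 1ℙ 0ℙ 0ℙ = ≡.refl
      lemma 1ℙ 0ℙ 1ℙ = ≡.refl
      lemma 1ℙ 1ℙ k  = ≡.refl

    -- The deltas set m = i in `c₁` and m = j in `e`; both become `F k j * X i l`, with opposite
    -- signs by `sign-ce`. The pair `d`, `f` works alike with m = -i and m = -j.
    cancel-ce : 0# ≈ ΣI c₁ + ΣI e
    cancel-ce = sym (trans
      (+-cong (trans (collapse i (λ m → σ (⟪ m ⟫ ℙ.+ (1ℙ ℙ.+ s i j k m)) (F k j * X m l))) (σ-≡ _ sign-ce))
              (collapse j (λ m → σ (p m) (F k m * X i l))))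
      (σ-cancel (p j) _))
    cancel-df : 0# ≈ ΣI d + ΣI f
    cancel-df = sym (trans
      (+-cong (trans (collapse (⁻ i) (λ m → σ (⟪ m ⟫ ℙ.+ (1ℙ ℙ.+ s i j k m)) (F k (⁻ j) * X m l))) (σ-≡ _ sign-df))
              (collapse⁻ j (λ m → σ (p m) (F k m * X (⁻ i) l))))
      (σ-cancel (p (⁻ j)) _))

  -- A diagonal entry has parity zero, so no sign arises in exchanging the factors. The four delta
  -- terms collapse to `X i j` and `X (⁻ i) (⁻ j)`, each once with either sign.
  adjoint-trace : ∀ {X} → Adjoint X → ∀ i j → F i j * ΣI (λ k → X k k) ≈ ΣI (λ k → X k k) * F i j
  adjoint-trace {X} adX i j = begin
    F i j * ΣI (λ k → X k k)
      ≈⟨ ΣI-*ˡ (F i j) (λ k → X k k) ⟩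
    ΣI (λ k → F i j * X k k)
      ≈⟨ ΣI-cong (λ k → trans (adX i j k k) (+-cong (σ-≡ _ (even ⟪ k ⟫))
           (+-congˡ (+-cong (trans (σ-≡ _ (≡.cong (1ℙ ℙ.+_) (even ⟪ k ⟫))) (δ-σ i k 1ℙ _))
             (trans (σ-≡ _ (≡.cong (1ℙ ℙ.+_) (even ⟪ k ⟫))) (δ-σ (⁻ i) k 1ℙ _)))))) ⟩
    ΣI (λ k → X k k * F i j + ((a k + b k) + (c₁ k + d k)))
      ≈⟨ trans (ΣI-+ (λ k → X k k * F i j) (λ k → (a k + b k) + (c₁ k + d k))) (+-congˡ (trans (ΣI-+ (λ k → a k + b k) (λ k → c₁ k + d k)) (+-cong (ΣI-+ a b) (ΣI-+ c₁ d)))) ⟩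
    ΣI (λ k → X k k * F i j) + ((ΣI a + ΣI b) + (ΣI c₁ + ΣI d))
      ≈⟨ +-cong (sym (ΣI-*ʳ (F i j) (λ k → X k k)))
           (+-cong (+-cong (collapse j (λ k → X i k)) (collapse⁻ j (λ k → X (⁻ i) k)))
                   (+-cong (collapse i (λ k → - X k j)) (collapse (⁻ i) (λ k → - X k (⁻ j))))) ⟩
    ΣI (λ k → X k k) * F i j + ((X i j + X (⁻ i) (⁻ j)) + (- X i j + - X (⁻ i) (⁻ j)))
      ≈⟨ +-congˡ (trans (CommSemigroupProps.interchange +-commutativeSemigroup _ _ _ _)
           (trans (+-cong (-‿inverseʳ _) (-‿inverseʳ _)) (+-identityˡ 0#))) ⟩
    ΣI (λ k → X k k) * F i j + 0#
      ≈⟨ +-identityʳ _ ⟩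
    ΣI (λ k → X k k) * F i j ∎
    where
    even : ∀ p → (⟪ i ⟫ ℙ.+ ⟪ j ⟫) ℙ.* (p ℙ.+ p) ≡ 0ℙ
    even 0ℙ = ℙₚ.*-zeroʳ (⟪ i ⟫ ℙ.+ ⟪ j ⟫)
    even 1ℙ = ℙₚ.*-zeroʳ (⟪ i ⟫ ℙ.+ ⟪ j ⟫)
    a b c₁ d : I → Carrier
    a k = δ j k (X i k)
    b k = δ j (⁻ k) (X (⁻ i) k)
    c₁ k = δ i k (- X k j)
    d k = δ (⁻ i) k (- X k (⁻ j))

module SuffixSum {c ℓ} (A : Ring c ℓ) where
  open Ring A using (Carrier; _≈_; semiring)
  open BigOperators A using (sum)

  -- Defined by recursion on the index instead of by a test of order, so that dropping the first
  -- variable is a definitional step.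
  sum> : ∀ {n} → Fin n → (Fin n → Carrier) → Carrier
  sum> zero    t = sum (t ∘ suc)
  sum> (suc i) t = sum> i (t ∘ suc)

  sum>-cong : ∀ {n} (κ : Fin n) {t u : Fin n → Carrier} → (∀ i → t i ≈ u i) → sum> κ t ≈ sum> κ u
  sum>-cong zero    e = SemiringSum.sum-cong-≋ semiring (e ∘ suc)
  sum>-cong (suc κ) e = sum>-cong κ (e ∘ suc)

-- Congruence modulo a left ideal

module LeftIdeal {c ℓ j} (A : Ring c ℓ) (J : Ring.Carrier A → Set j)
  (J-0 : J (Ring.0# A))
  (J-+ : ∀ {u v} → J u → J v → J (Ring._+_ A u v))
  (J-*ˡ : ∀ u {v} → J v → J (Ring._*_ A u v))
  (J-resp : ∀ {u v} → Ring._≈_ A u v → J u → J v) where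
  open Ring A hiding (zero)
  open BigOperators A using (sum)
  open SuffixSum A
  private
    module RP = RingProps A
    module CS = CommSemigroupProps +-commutativeSemigroup

  infix 4 _≋_
  -- A record, so that `u` and `v` are recovered by unification, which their difference alone would
  -- not permit.
  record _≋_ (u v : Carrier) : Set j where
    constructor congruent
    field J-difference : J (u - v)
  open _≋_ public

  J-neg : ∀ {u} → J u → J (- u)
  J-neg {u} e = J-resp (RP.-1*x≈-x u) (J-*ˡ (- 1#) e)

  ≈⇒≋ : ∀ {u v} → u ≈ v → u ≋ v
  ≈⇒≋ {u} {v} e = congruent (J-resp (sym (trans (+-congʳ e) (-‿inverseʳ v))) J-0)

  ≋-refl : ∀ {u} → u ≋ u
  ≋-refl = ≈⇒≋ refl

  ≋-trans : ∀ {u v w} → u ≋ v → v ≋ w → u ≋ w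
  ≋-trans {u} {v} {w} (congruent e) (congruent f) = congruent (J-resp
    (trans (+-assoc u (- v) (v - w)) (+-congˡ (trans (sym (+-assoc (- v) v (- w))) (trans (+-congʳ (-‿inverseˡ v)) (+-identityˡ _)))))
    (J-+ e f))

  ≋-+ : ∀ {u u′ v v′} → u ≋ u′ → v ≋ v′ → u + v ≋ u′ + v′
  ≋-+ {u} {u′} {v} {v′} (congruent e) (congruent f) = congruent (J-resp
    (trans (CS.interchange u (- u′) v (- v′)) (+-congˡ (RP.-‿+-comm u′ v′)))
    (J-+ e f))

  ≋-neg : ∀ {u v} → u ≋ v → - u ≋ - v
  ≋-neg {u} {v} (congruent e) = congruent (J-resp (sym (RP.-‿+-comm u (- v))) (J-neg e))

  ≋-*ˡ : ∀ u {v w} → v ≋ w → u * v ≋ u * w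
  ≋-*ˡ u {v} {w} (congruent e) = congruent (J-resp (RP.x[y-z]≈xy-xz u v w) (J-*ˡ u e))

  J⇒≋0 : ∀ {u} → J u → u ≋ 0#
  J⇒≋0 e = congruent (J-resp (sym (trans (+-congˡ RP.-0#≈0#) (+-identityʳ _))) e)

  ≋0⇒J : ∀ {u} → u ≋ 0# → J u
  ≋0⇒J (congruent e) = J-resp (trans (+-congˡ RP.-0#≈0#) (+-identityʳ _)) e

  ≋-sum : ∀ {n} {t u : Fin n → Carrier} → (∀ i → t i ≋ u i) → sum t ≋ sum u
  ≋-sum {zero}  e = ≋-refl
  ≋-sum {suc n} e = ≋-+ (e zero) (≋-sum (e ∘ suc))

  sum>-≋ : ∀ {n} (κ : Fin n) {t u : Fin n → Carrier} → (∀ i → t i ≋ u i) → sum> κ t ≋ sum> κ u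
  sum>-≋ zero    e = ≋-sum (e ∘ suc)
  sum>-≋ (suc κ) e = sum>-≋ κ (e ∘ suc)

  sum-split : ∀ {n} (κ : Fin n) (t u : Fin n → Carrier) → (∀ μ → μ Fin.< κ → t μ ≋ 0#) →
    (∀ μ → κ Fin.< μ → t μ ≋ u μ) → sum t ≋ t κ + sum> κ u
  sum-split zero    t u e f = ≋-+ ≋-refl (≋-sum (λ μ → f (suc μ) (s≤s z≤n)))
  sum-split (suc κ) t u e f = ≋-trans
    (≋-+ (e zero (s≤s z≤n)) (sum-split κ (t ∘ suc) (u ∘ suc) (λ μ lt → e (suc μ) (s≤s lt)) (λ μ lt → f (suc μ) (s≤s lt))))
    (≈⇒≋ (+-identityˡ _))

-- The triangular recursion for the diagonal entries modulo a left ideal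

module HarishChandraRecursion {c ℓ j} (A : Ring c ℓ) (N : ℕ)
  (F : Sign × Fin N → Sign × Fin N → Ring.Carrier A)
  (adjoint-F : QueerCommutation.Adjoint A N F F)
  (F-⁻ : ∀ i k → Ring._≈_ A (F (SignedSums.⁻_ A N i) (SignedSums.⁻_ A N k)) (F i k))
  (halve : ∀ {u v} → Ring._≈_ A (Ring._+_ A u u) (Ring._+_ A v v) → Ring._≈_ A u v)
  (J : Ring.Carrier A → Set j)
  (J-0 : J (Ring.0# A))
  (J-+ : ∀ {u v} → J u → J v → J (Ring._+_ A u v))
  (J-*ˡ : ∀ u {v} → J v → J (Ring._*_ A u v))
  (J-resp : ∀ {u v} → Ring._≈_ A u v → J u → J v)
  (J-F : ∀ k m → proj₂ k Fin.< proj₂ m → J (F k m)) where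
  open Ring A hiding (zero)
  open BigOperators A using (sum)
  open SuffixSum A
  open QueerCommutation A N F
  open LeftIdeal A J J-0 J-+ J-*ˡ J-resp public
  private
    module RP = RingProps A
    module CS = CommSemigroupProps +-commutativeSemigroup
    open SemiringSum semiring using (sum-cong-≋; ∑-distrib-+)
    open SetoidReasoning setoid

  pos neg : Fin N → I
  pos i = Sign.+ , i
  neg i = Sign.- , i

  Triangular : (I → I → Carrier) → Set j
  Triangular X = ∀ k l → proj₂ k Fin.< proj₂ l → J (X k l)

  Even : (I → I → Carrier) → Set ℓ
  Even X = ∀ i k → X (⁻ i) (⁻ k) ≈ X i k

  J-σ : ∀ p {u} → J u → J (σ p u)
  J-σ 0ℙ e = e
  J-σ 1ℙ e = J-neg e

  J-sum : ∀ {n} {t : Fin n → Carrier} → (∀ i → J (t i)) → J (sum t)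
  J-sum {zero}  e = J-0
  J-sum {suc n} e = J-+ (e zero) (J-sum (e ∘ suc))

  J-δ : ∀ i k {u} → J u → J (δ i k u)
  J-δ i k {u} e with i ≡ᴵ k
  ... | true  = e
  ... | false = J-0

  -- Moved to the right of `X m l`, the factor `F k m` puts the product into the left ideal; only
  -- the bracket is left.
  raising : ∀ {X} → Adjoint X → ∀ k m l → proj₂ k Fin.< proj₂ m → F k m * X m l ≋ ad X k m m l
  raising {X} adX k m l k<m = ≋-trans (≈⇒≋ (adX k m m l))
    (≋-trans (≋-+ (J⇒≋0 (J-σ (s k m m l) (J-*ˡ (X m l) (J-F k m k<m)))) ≋-refl) (≈⇒≋ (+-identityˡ _)))

  self≢⁻ : ∀ (m : I) → m ≢ ⁻ m
  self≢⁻ (Sign.+ , _) ()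
  self≢⁻ (Sign.- , _) ()

  -- If |m| < |l|, the second factor of a summand lies in the ideal. Otherwise |k| < |l| ≤ |m|, so
  -- `raising` applies. Its bracket contains only entries of X in rows k and -k, column l, which lie
  -- in the ideal, and deltas comparing ±k with l, which vanish.
  triangular-⋆ : ∀ {X} → Adjoint X → Triangular X → Triangular (F ⋆ X)
  triangular-⋆ {X} adX tri k l k<l = J-+ (J-sum (λ μ → J-neg (term (neg μ)))) (J-sum (λ μ → term (pos μ)))
    where
    term : ∀ m → J (F k m * X m l)
    term m with Finₚ._<?_ (proj₂ m) (proj₂ l)
    ... | yes m<l = J-*ˡ (F k m) (tri m l m<l)
    ... | no  m≮l = ≋0⇒J (≋-trans (raising adX k m l (ℕₚ.<-≤-trans k<l (ℕₚ.≮⇒≥ m≮l))) (J⇒≋0 (J-+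
      (J-+ (J-δ m m (tri k l k<l)) (J-δ m (⁻ m) (tri (⁻ k) l k<l)))
      (J-+ (J-σ (1ℙ ℙ.+ s k m m l) (J-resp (sym (δ-≢ k l _ λ { ≡.refl → ℕₚ.<-irrefl ≡.refl k<l })) J-0))
           (J-σ (1ℙ ℙ.+ s k m m l) (J-resp (sym (δ-≢ (⁻ k) l _ λ { ≡.refl → ℕₚ.<-irrefl ≡.refl k<l })) J-0))))))

  row : (I → I → Carrier) → I → I → Fin N → Carrier
  row X k l μ = - (F k (neg μ) * X (neg μ) l) + F k (pos μ) * X (pos μ) l

  ⋆-row : ∀ X k l → (F ⋆ X) k l ≈ sum (row X k l)
  ⋆-row X k l = sym (∑-distrib-+ (λ μ → - (F k (neg μ) * X (neg μ) l)) (λ μ → F k (pos μ) * X (pos μ) l))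

  row-below : ∀ {X} → Triangular X → ∀ k l μ → μ Fin.< proj₂ l → row X k l μ ≋ 0#
  row-below {X} tri k l μ μ<l = J⇒≋0 (J-+ (J-neg (J-*ˡ (F k (neg μ)) (tri (neg μ) l μ<l))) (J-*ˡ (F k (pos μ)) (tri (pos μ) l μ<l)))

  bracket-diagonal : ∀ X k m → ad X k m m k ≈ X k k + σ (1ℙ ℙ.+ s k m m k) (X m m)
  bracket-diagonal X k m = +-cong
    (trans (+-cong (δ-refl m _) (δ-≢ m (⁻ m) _ (self≢⁻ m))) (+-identityʳ _))
    (trans (+-cong (σ-cong q (δ-refl k _)) (trans (σ-cong q (δ-≢ (⁻ k) k _ (self≢⁻ k ∘ ≡.sym))) (σ-0 q))) (+-identityʳ _))
    where
    q = 1ℙ ℙ.+ s k m m k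

  bracket-antidiagonal : ∀ X k m → ad X k m m (⁻ k) ≈ X k (⁻ k) + σ (1ℙ ℙ.+ s k m m (⁻ k)) (X m (⁻ m))
  bracket-antidiagonal X k m = +-cong
    (trans (+-cong (δ-refl m _) (δ-≢ m (⁻ m) _ (self≢⁻ m))) (+-identityʳ _))
    (trans (+-cong (trans (σ-cong q (δ-≢ k (⁻ k) _ (self≢⁻ k))) (σ-0 q)) (σ-cong q (δ-refl (⁻ k) _))) (+-identityˡ _))
    where
    q = 1ℙ ℙ.+ s k m m (⁻ k)

  cancel-first : ∀ u v w → - (u + v) + (u + w) ≈ - v + w
  cancel-first u v w = begin
    - (u + v) + (u + w)     ≈⟨ +-congʳ (RP.-‿+-comm u v) ⟨
    - u + - v + (u + w)     ≈⟨ CS.interchange _ _ _ _ ⟩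
    - u + u + (- v + w)     ≈⟨ +-congʳ (-‿inverseˡ u) ⟩
    0# + (- v + w)          ≈⟨ +-identityˡ _ ⟩
    - v + w                 ∎

  -- For each μ > κ the brackets for -μ and μ both contain `X (pos κ) (pos κ)`; the sign built into
  -- `⋆` makes these two copies cancel, leaving only the diagonal entries at -μ and μ.
  diagonal-step : ∀ {X} → Adjoint X → Triangular X → ∀ κ →
    (F ⋆ X) (pos κ) (pos κ) ≋ row X (pos κ) (pos κ) κ + sum> κ (λ μ → - X (neg μ) (neg μ) - X (pos μ) (pos μ))
  diagonal-step {X} adX tri κ = ≋-trans (≈⇒≋ (⋆-row X (pos κ) (pos κ)))
    (sum-split κ (row X (pos κ) (pos κ)) _ (row-below tri (pos κ) (pos κ))
      λ μ κ<μ → ≋-trans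
        (≋-+ (≋-neg (≋-trans (raising adX (pos κ) (neg μ) (pos κ) κ<μ) (≈⇒≋ (bracket-diagonal X (pos κ) (neg μ)))))
             (≋-trans (raising adX (pos κ) (pos μ) (pos κ) κ<μ) (≈⇒≋ (bracket-diagonal X (pos κ) (pos μ)))))
        (≈⇒≋ (cancel-first _ _ _)))

  antidiagonal-step : ∀ {X} → Adjoint X → Triangular X → ∀ κ →
    (F ⋆ X) (neg κ) (pos κ) ≋ row X (neg κ) (pos κ) κ + sum> κ (λ μ → - - X (neg μ) (pos μ) - X (pos μ) (neg μ))
  antidiagonal-step {X} adX tri κ = ≋-trans (≈⇒≋ (⋆-row X (neg κ) (pos κ)))
    (sum-split κ (row X (neg κ) (pos κ)) _ (row-below tri (neg κ) (pos κ))
      λ μ κ<μ → ≋-trans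
        (≋-+ (≋-neg (≋-trans (raising adX (neg κ) (neg μ) (pos κ) κ<μ) (≈⇒≋ (bracket-antidiagonal X (neg κ) (neg μ)))))
             (≋-trans (raising adX (neg κ) (pos μ) (pos κ) κ<μ) (≈⇒≋ (bracket-antidiagonal X (neg κ) (pos μ)))))
        (≈⇒≋ (cancel-first _ _ _)))

  -- Replacing the summation index by its opposite leaves both factors unchanged and flips the sign
  -- attached to it.
  odd-⋆ : ∀ {X} → Even X → ∀ i k → (F ⋆ X) (⁻ i) (⁻ k) ≈ - (F ⋆ X) i k
  odd-⋆ {X} ev i k = begin
    ΣI (λ m → σ ⟪ m ⟫ (F (⁻ i) m * X m (⁻ k)))
      ≈⟨ ΣI-⁻ (λ m → σ ⟪ m ⟫ (F (⁻ i) m * X m (⁻ k))) ⟨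
    ΣI (λ m → σ ⟪ ⁻ m ⟫ (F (⁻ i) (⁻ m) * X (⁻ m) (⁻ k)))
      ≈⟨ ΣI-cong (λ m → trans (σ-cong ⟪ ⁻ m ⟫ (*-cong (F-⁻ i m) (ev m k))) (flip m _)) ⟩
    ΣI (λ m → - σ ⟪ m ⟫ (F i m * X m k))
      ≈⟨ ΣI-σ 1ℙ (λ m → σ ⟪ m ⟫ (F i m * X m k)) ⟨
    - (F ⋆ X) i k ∎
    where
    flip : ∀ m u → σ ⟪ ⁻ m ⟫ u ≈ - σ ⟪ m ⟫ u
    flip (Sign.+ , _) u = refl
    flip (Sign.- , _) u = sym (RP.-‿involutive u)

  even-⋆⋆ : ∀ {X} → Even X → Even (F ⋆ (F ⋆ X))
  even-⋆⋆ {X} ev i k = begin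
    ΣI (λ m → σ ⟪ m ⟫ (F (⁻ i) m * (F ⋆ X) m (⁻ k)))
      ≈⟨ ΣI-⁻ (λ m → σ ⟪ m ⟫ (F (⁻ i) m * (F ⋆ X) m (⁻ k))) ⟨
    ΣI (λ m → σ ⟪ ⁻ m ⟫ (F (⁻ i) (⁻ m) * (F ⋆ X) (⁻ m) (⁻ k)))
      ≈⟨ ΣI-cong (λ m → trans (σ-cong ⟪ ⁻ m ⟫ (trans (*-cong (F-⁻ i m) (odd-⋆ ev m k)) (sym (RP.-‿distribʳ-* _ _)))) (flip m _)) ⟩
    ΣI (λ m → σ ⟪ m ⟫ (F i m * (F ⋆ X) m k)) ∎
    where
    flip : ∀ m u → σ ⟪ ⁻ m ⟫ (- u) ≈ σ ⟪ m ⟫ u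
    flip (Sign.+ , _) u = RP.-‿involutive u
    flip (Sign.- , _) u = refl

  module _ (κ : Fin N) where
    Λ Ξ : Carrier
    Λ = F (pos κ) (pos κ)
    Ξ = F (pos κ) (neg κ)

    -- The superbracket of the odd element Ξ with itself is 2Ξ², while the commutation rule
    -- evaluates it to 2Λ; hence the division by two.
    Ξ² : Ξ * Ξ ≈ Λ
    Ξ² = halve (begin
      Ξ * Ξ + Ξ * Ξ
        ≈⟨ +-congˡ (adjoint-F (pos κ) (neg κ) (pos κ) (neg κ)) ⟩
      Ξ * Ξ + (- (Ξ * Ξ) + ad F (pos κ) (neg κ) (pos κ) (neg κ))
        ≈⟨ trans (sym (+-assoc _ _ _)) (trans (+-congʳ (-‿inverseʳ _)) (+-identityˡ _)) ⟩
      ad F (pos κ) (neg κ) (pos κ) (neg κ)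
        ≈⟨ +-cong (trans (+-cong (δ-≢ (neg κ) (pos κ) (F (pos κ) (neg κ)) λ ()) (δ-refl (neg κ) _)) (+-identityˡ _))
                  (trans (+-cong (δ-≢ (pos κ) (neg κ) (F (pos κ) (neg κ)) λ ()) (δ-refl (neg κ) _)) (+-identityˡ _)) ⟩
      F (neg κ) (neg κ) + Λ
        ≈⟨ +-congʳ (F-⁻ (pos κ) (pos κ)) ⟩
      Λ + Λ ∎)

    ΞΛ : Ξ * Λ ≈ Λ * Ξ
    ΞΛ = begin
      Ξ * Λ
        ≈⟨ adjoint-F (pos κ) (neg κ) (pos κ) (pos κ) ⟩
      Λ * Ξ + ad F (pos κ) (neg κ) (pos κ) (pos κ)
        ≈⟨ +-congˡ (+-cong (trans (+-cong (δ-≢ (neg κ) (pos κ) (F (pos κ) (pos κ)) λ ()) (δ-refl (neg κ) _)) (+-identityˡ _))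
                           (trans (+-cong (-‿cong (δ-refl (pos κ) _)) (trans (-‿cong (δ-≢ (neg κ) (pos κ) (F (pos κ) (pos κ)) λ ())) RP.-0#≈0#)) (+-identityʳ _))) ⟩
      Λ * Ξ + (F (neg κ) (pos κ) - Ξ)
        ≈⟨ +-congˡ (trans (+-congʳ (F-⁻ (pos κ) (neg κ))) (-‿inverseʳ Ξ)) ⟩
      Λ * Ξ + 0#
        ≈⟨ +-identityʳ _ ⟩
      Λ * Ξ ∎

    -- The antidiagonal entry Y₋ contributes -ΛΞY₋ + ΞΛY₋ = 0.
    two-steps : ∀ {Y} → Adjoint Y → Triangular Y → Even Y →
      (F ⋆ (F ⋆ Y)) (pos κ) (pos κ) ≋
        Λ * (Λ * Y (pos κ) (pos κ) + sum> κ (λ μ → - (Y (pos μ) (pos μ) + Y (pos μ) (pos μ)))) - Λ * Y (pos κ) (pos κ)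
    two-steps {Y} adY tri ev = ≋-trans
      (diagonal-step (adjoint-⋆ adjoint-F adY) (triangular-⋆ adY tri) κ)
      -- In the second step `F ⋆ Y` changes sign under negation of both indices, so its diagonal
      -- entries at -μ and μ cancel and the later indices contribute nothing. They enter through the
      -- first step only.
      (≋-trans (≋-+ (≋-+ (≋-neg (≋-*ˡ Ξ Y₋′)) (≋-*ˡ Λ Y₊′)) (≋-trans (sum>-≋ κ odd) (≈⇒≋ (sum>-0 κ))))
      (≈⇒≋ (begin
        - (Ξ * (- (Λ * Y₋) + Ξ * Y₊)) + Λ * (- (Ξ * Y₋) + Λ * Y₊ + S) + 0#
          ≈⟨ +-identityʳ _ ⟩
        - (Ξ * (- (Λ * Y₋) + Ξ * Y₊)) + Λ * (- (Ξ * Y₋) + Λ * Y₊ + S)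
          ≈⟨ +-cong (-‿cong (trans (distribˡ _ _ _) (+-cong (trans (sym (RP.-‿distribʳ-* _ _)) (-‿cong (sym (*-assoc _ _ _)))) (trans (sym (*-assoc _ _ _)) (*-congʳ Ξ²)))))
               (trans (*-congˡ (+-assoc _ _ _)) (trans (distribˡ _ _ _) (+-congʳ (trans (sym (RP.-‿distribʳ-* _ _)) (-‿cong (sym (*-assoc _ _ _))))))) ⟩
        - (- (Ξ * Λ * Y₋) + Λ * Y₊) + (- (Λ * Ξ * Y₋) + Λ * (Λ * Y₊ + S))
          ≈⟨ +-congʳ (-‿cong (+-congʳ (-‿cong (*-congʳ ΞΛ)))) ⟩
        - (- (Λ * Ξ * Y₋) + Λ * Y₊) + (- (Λ * Ξ * Y₋) + Λ * (Λ * Y₊ + S))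
          ≈⟨ cancel-first _ _ _ ⟩
        - (Λ * Y₊) + Λ * (Λ * Y₊ + S)
          ≈⟨ +-comm _ _ ⟩
        Λ * (Λ * Y₊ + S) - Λ * Y₊ ∎)))
      where
      Y₊ = Y (pos κ) (pos κ)
      Y₋ = Y (neg κ) (pos κ)
      S = sum> κ (λ μ → - (Y (pos μ) (pos μ) + Y (pos μ) (pos μ)))
      sum>-0 : ∀ {n} (κ : Fin n) → sum> κ (λ _ → 0#) ≈ 0#
      sum>-0 {suc n} zero    = SemiringSum.sum-replicate-zero semiring n
      sum>-0 (suc κ) = sum>-0 κ
      Y₊′ : (F ⋆ Y) (pos κ) (pos κ) ≋ - (Ξ * Y₋) + Λ * Y₊ + S
      Y₊′ = ≋-trans (diagonal-step adY tri κ) (≋-+ ≋-refl (sum>-≋ κ λ μ →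
        ≈⇒≋ (trans (RP.-‿+-comm _ _) (-‿cong (+-congʳ (ev (pos μ) (pos μ)))))))
      Y₋′ : (F ⋆ Y) (neg κ) (pos κ) ≋ - (Λ * Y₋) + Ξ * Y₊
      Y₋′ = ≋-trans (antidiagonal-step adY tri κ) (≋-trans
        (≋-+ (≈⇒≋ (+-cong (-‿cong (*-congʳ (F-⁻ (pos κ) (pos κ)))) (*-congʳ (F-⁻ (pos κ) (neg κ)))))
          -- For an even Y the antidiagonal entries at (-μ , μ) and (μ , -μ) are equal and appear
          -- with opposite signs.
          (≋-trans (sum>-≋ κ λ μ → ≈⇒≋ (trans (+-congʳ (trans (RP.-‿involutive _) (ev (pos μ) (neg μ)))) (-‿inverseʳ _)))
            (≈⇒≋ (sum>-0 κ))))
        (≈⇒≋ (+-identityʳ _)))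
      odd : ∀ μ → - (F ⋆ Y) (neg μ) (neg μ) - (F ⋆ Y) (pos μ) (pos μ) ≋ 0#
      odd μ = ≈⇒≋ (trans (+-congʳ (trans (-‿cong (odd-⋆ ev (pos μ) (pos μ))) (RP.-‿involutive _))) (-‿inverseʳ _))

-- Determinants along a relation between two rings

module DeterminantRelation {a ℓ a′ ℓ′ r} (A : Ring a ℓ) (B : Ring a′ ℓ′)
  (_~_ : Ring.Carrier A → Ring.Carrier B → Set r)
  (~-0 : Ring.0# A ~ Ring.0# B)
  (~-1 : Ring.1# A ~ Ring.1# B)
  (~-neg : ∀ {u v} → u ~ v → Ring.-_ A u ~ Ring.-_ B v)
  (~-+ : ∀ {u v u′ v′} → u ~ v → u′ ~ v′ → Ring._+_ A u u′ ~ Ring._+_ B v v′)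
  (~-* : ∀ {u v u′ v′} → u ~ v → u′ ~ v′ → Ring._*_ A u u′ ~ Ring._*_ B v v′) where

  sum-~ : ∀ {n} {f : Fin n → Ring.Carrier A} {g : Fin n → Ring.Carrier B} →
    (∀ i → f i ~ g i) → BigOperators.sum A f ~ BigOperators.sum B g
  sum-~ {zero}  e = ~-0
  sum-~ {suc n} e = ~-+ (e zero) (sum-~ (e ∘ suc))

  power-~ : ∀ k → BigOperators._^_ A (Ring.-_ A (Ring.1# A)) k ~ BigOperators._^_ B (Ring.-_ B (Ring.1# B)) k
  power-~ zero    = ~-1
  power-~ (suc k) = ~-* (~-neg ~-1) (power-~ k)

  -- Phrased for a relation because both applications in mind concern a graph: Harish-Chandra images
  -- are related to central elements rather than computed from them, and `det` on the side of U is
  -- noncommutative.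
  det-~ : ∀ {n} (M : Fin n → Fin n → Ring.Carrier A) (M′ : Fin n → Fin n → Ring.Carrier B) →
    (∀ i j → M i j ~ M′ i j) → det A M ~ det B M′
  det-~ {zero}  M M′ e = ~-1
  det-~ {suc n} M M′ e = sum-~ λ j → ~-* (~-* (power-~ (toℕ j)) (e zero j))
    (det-~ (λ i k → M (suc i) (punchIn j k)) (λ i k → M′ (suc i) (punchIn j k)) λ i k → e (suc i) (punchIn j k))

-- Commutation in the enveloping algebra and centrality of the cyclic elements

module Enveloping {c ℓ} (K : CommutativeRing c ℓ) (N : ℕ) where
  private
    module K = CommutativeRing K
    module KP = RingProps K.ring
    module KS = SignedSums K.ring N
    module KSolver = Solver K
  open Queer K N
  open Ring U hiding (zero)
  private
    module RP = RingProps U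
  open QueerCommutation U N Fᵁ public hiding (I; ⁻_; _≡ᴵ_)
  open Presented K (Σ Matrix 𝔮) EnvelopingRelation public hiding (distribˡ; distribʳ)
  private module R = SetoidReasoning setoid

  scalar-neg : ∀ a → scalar (K.- a) ≈ - scalar a
  scalar-neg a = RP.+-inverseˡ-unique (scalar (K.- a)) (scalar a)
    (trans (sym (scalar-plus (K.- a) a)) (scalar-cong (K.-‿inverseˡ a)))

  sgn-* : ∀ p u → scalar (sgn p) * u ≈ σ p u
  sgn-* 0ℙ u = times-one u
  sgn-* 1ℙ u = trans (*-congʳ (scalar-neg K.1#)) (trans (sym (RP.-‿distribˡ-* _ _)) (-‿cong (times-one u)))

  linear-combination : ∀ {A B C} (A∈ : 𝔮 A) (B∈ : 𝔮 B) (C∈ : 𝔮 C) a b → C ≈ᴹ a ·ᴹ A +ᴹ b ·ᴹ B →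
    gen (C , C∈) ≈ scalar a * gen (A , A∈) + scalar b * gen (B , B∈)
  linear-combination A∈ B∈ C∈ a b e = relation (linear A∈ B∈ C∈ a b e)

  gen-cong : ∀ {A B} (A∈ : 𝔮 A) (B∈ : 𝔮 B) → A ≈ᴹ B → gen (A , A∈) ≈ gen (B , B∈)
  gen-cong A∈ B∈ e = trans
    (linear-combination B∈ B∈ A∈ K.1# K.0# λ i j → K.trans (e i j) (K.sym (K.trans (K.+-cong (K.*-identityˡ _) (K.zeroˡ _)) (K.+-identityʳ _))))
    (trans (+-cong (*-identityˡ _) (zeroˡ _)) (+-identityʳ _))

  gen-+ : ∀ {A B} (A∈ : 𝔮 A) (B∈ : 𝔮 B) (C∈ : 𝔮 (A +ᴹ B)) → gen (A +ᴹ B , C∈) ≈ gen (A , A∈) + gen (B , B∈)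
  gen-+ A∈ B∈ C∈ = trans
    (linear-combination A∈ B∈ C∈ K.1# K.1# λ i j → K.sym (K.+-cong (K.*-identityˡ _) (K.*-identityˡ _)))
    (+-cong (*-identityˡ _) (*-identityˡ _))

  gen-· : ∀ {A} a (A∈ : 𝔮 A) (C∈ : 𝔮 (a ·ᴹ A)) → gen (a ·ᴹ A , C∈) ≈ scalar a * gen (A , A∈)
  gen-· a A∈ C∈ = trans
    (linear-combination A∈ A∈ C∈ a K.0# λ i j → K.sym (K.trans (K.+-congˡ (K.zeroˡ _)) (K.+-identityʳ _)))
    (trans (+-congˡ (zeroˡ _)) (+-identityʳ _))

  gen-0 : (C∈ : 𝔮 0ᴹ) → gen (0ᴹ , C∈) ≈ 0#
  gen-0 C∈ = trans
    (linear-combination C∈ C∈ C∈ K.0# K.0# λ i j → K.sym (K.trans (K.+-cong (K.zeroˡ _) (K.zeroˡ _)) (K.+-identityʳ _)))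
    (trans (+-cong (zeroˡ _) (zeroˡ _)) (+-identityʳ _))

  -- Builds the membership proof and the equation in U together, so that a bracket written as an
  -- expression in U is matched with a single matrix to which the relation `bracket` applies.
  Image : Carrier → Matrix → Set _
  Image u A = Σ (𝔮 A) λ A∈ → u ≈ gen (A , A∈)

  image-F : ∀ i j → Image (Fᵁ i j) (F i j)
  image-F i j = span-gen (i , j) , refl

  image-+ : ∀ {u v A B} → Image u A → Image v B → Image (u + v) (A +ᴹ B)
  image-+ (A∈ , e) (B∈ , f) = span-+ A∈ B∈ , trans (+-cong e f) (sym (gen-+ A∈ B∈ _))

  image-σ : ∀ {u A} p → Image u A → Image (σ p u) (sgn p ·ᴹ A)
  image-σ p (A∈ , e) = span-· (sgn p) A∈ , trans (σ-cong p e) (trans (sym (sgn-* p _)) (sym (gen-· (sgn p) A∈ _)))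

  image-δ : ∀ {u A} i j → Image u A → Image (δ i j u) (λ a b → KS.δ i j (A a b))
  image-δ {u} {A} i j (A∈ , e) with i ≡ᴵ j
  ... | true  = A∈ , e
  ... | false = span-0 , sym (gen-0 span-0)

  e : I → I → K.Carrier
  e i j = KS.δ i j K.1#

  δ-e : ∀ i j u → KS.δ i j u K.≈ e i j K.* u
  δ-e i j u with i ≡ᴵ j
  ... | true  = K.sym (K.*-identityˡ u)
  ... | false = K.sym (K.zeroˡ u)

  ≡ᴵ-sym : ∀ i j → (i ≡ᴵ j) ≡ (j ≡ᴵ i)
  ≡ᴵ-sym (s , i) (t , j) with s Signₚ.≟ t | t Signₚ.≟ s | i Finₚ.≟ j | j Finₚ.≟ i
  ... | yes _ | yes _ | yes _ | yes _ = ≡.refl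
  ... | yes p | no ¬p | _ | _ = ⊥-elim (¬p (≡.sym p))
  ... | no ¬p | yes p | _ | _ = ⊥-elim (¬p (≡.sym p))
  ... | no _  | no _  | _ | _ = ≡.refl
  ... | yes _ | yes _ | yes p | no ¬p = ⊥-elim (¬p (≡.sym p))
  ... | yes _ | yes _ | no ¬p | yes p = ⊥-elim (¬p (≡.sym p))
  ... | yes _ | yes _ | no _  | no _  = ≡.refl

  ≡ᴵ-⁻ : ∀ i j → ((⁻ i) ≡ᴵ j) ≡ (i ≡ᴵ (⁻ j))
  ≡ᴵ-⁻ (Sign.+ , i) (Sign.+ , j) = ≡.refl
  ≡ᴵ-⁻ (Sign.+ , i) (Sign.- , j) = ≡.refl
  ≡ᴵ-⁻ (Sign.- , i) (Sign.+ , j) = ≡.refl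
  ≡ᴵ-⁻ (Sign.- , i) (Sign.- , j) = ≡.refl

  e-sym : ∀ i j → e i j ≡ e j i
  e-sym i j = ≡.cong (λ b → if b then K.1# else K.0#) (≡ᴵ-sym i j)

  e-⁻ : ∀ i j → e (⁻ i) j ≡ e i (⁻ j)
  e-⁻ i j = ≡.cong (λ b → if b then K.1# else K.0#) (≡ᴵ-⁻ i j)

  E-e : ∀ i j a b → E i j a b K.≈ e a i K.* e b j
  E-e i j a b with a ≡ᴵ i | b ≡ᴵ j
  ... | true  | true  = K.sym (K.*-identityˡ _)
  ... | true  | false = K.sym (K.zeroʳ _)
  ... | false | _     = K.sym (K.zeroˡ _)

  F-e : ∀ i j a b → F i j a b K.≈ e a i K.* e b j K.+ e a (⁻ i) K.* e b (⁻ j)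
  F-e i j a b = K.+-cong (E-e i j a b) (E-e (⁻ i) (⁻ j) a b)

  F-⁻ᴹ : ∀ i j → F (⁻ i) (⁻ j) ≈ᴹ F i j
  F-⁻ᴹ i j a b = K.trans (K.+-comm _ _) (K.+-congʳ (K.reflexive
    (≡.cong₂ (λ i j → E i j a b) (KS.⁻-involutive i) (KS.⁻-involutive j))))

  Fᵁ-⁻ : ∀ i j → Fᵁ (⁻ i) (⁻ j) ≈ Fᵁ i j
  Fᵁ-⁻ i j = gen-cong _ _ (F-⁻ᴹ i j)

  -- The `F i j` span an associative matrix algebra: each of the two matrix units in `F i j` meets
  -- each of the two in `F k l`, and the four products regroup into two generators.
  F-*ᴹ : ∀ i j k l a b → (F i j *ᴹ F k l) a b K.≈ e j k K.* F i l a b K.+ e j (⁻ k) K.* F (⁻ i) l a b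
  F-*ᴹ i j k l a b = begin
    KS.ΣI (λ m → F i j a m K.* F k l m b)
      ≈⟨ KS.ΣI-cong (λ m → K.trans (K.*-congʳ {F k l m b} (F-e i j a m))
           (K.trans (K.distribʳ _ _ _) (K.+-cong (pull a i m j _) (pull a (⁻ i) m (⁻ j) _)))) ⟩
    KS.ΣI (λ m → KS.δ j m (e a i K.* F k l m b) K.+ KS.δ (⁻ j) m (e a (⁻ i) K.* F k l m b))
      ≈⟨ KS.ΣI-+ (λ m → KS.δ j m (e a i K.* F k l m b)) (λ m → KS.δ (⁻ j) m (e a (⁻ i) K.* F k l m b)) ⟩
    KS.ΣI (λ m → KS.δ j m (e a i K.* F k l m b)) K.+ KS.ΣI (λ m → KS.δ (⁻ j) m (e a (⁻ i) K.* F k l m b))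
      ≈⟨ K.+-cong (KS.collapse j (λ m → e a i K.* F k l m b)) (KS.collapse (⁻ j) (λ m → e a (⁻ i) K.* F k l m b)) ⟩
    e a i K.* F k l j b K.+ e a (⁻ i) K.* F k l (⁻ j) b
      ≈⟨ K.+-cong (K.*-congˡ (F-e k l j b)) (K.*-congˡ (K.trans (F-e k l (⁻ j) b)
           (K.+-cong (K.*-congʳ (K.reflexive (e-⁻ j k))) (K.*-congʳ (K.reflexive
             (≡.trans (e-⁻ j (⁻ k)) (≡.cong (e j) (KS.⁻-involutive k)))))))) ⟩
    e a i K.* (e j k K.* e b l K.+ e j (⁻ k) K.* e b (⁻ l)) K.+ e a (⁻ i) K.* (e j (⁻ k) K.* e b l K.+ e j k K.* e b (⁻ l))
      ≈⟨ KSolver.solve 6 (λ ai a-i jk j-k bl b-l →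
           ai :* (jk :* bl :+ j-k :* b-l) :+ a-i :* (j-k :* bl :+ jk :* b-l)
             := jk :* (ai :* bl :+ a-i :* b-l) :+ j-k :* (a-i :* bl :+ ai :* b-l))
           K.refl (e a i) (e a (⁻ i)) (e j k) (e j (⁻ k)) (e b l) (e b (⁻ l)) ⟩
    e j k K.* (e a i K.* e b l K.+ e a (⁻ i) K.* e b (⁻ l)) K.+ e j (⁻ k) K.* (e a (⁻ i) K.* e b l K.+ e a i K.* e b (⁻ l))
      ≈⟨ K.+-cong (K.*-congˡ (F-e i l a b)) (K.*-congˡ (K.trans (F-e (⁻ i) l a b)
           (K.+-congˡ (K.*-congʳ (K.reflexive (≡.cong (e a) (KS.⁻-involutive i))))))) ⟨
    e j k K.* F i l a b K.+ e j (⁻ k) K.* F (⁻ i) l a b ∎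
    where
    open SetoidReasoning K.setoid
    open KSolver using (_:=_; _:+_; _:*_)
    pull : ∀ a i m j u → e a i K.* e m j K.* u K.≈ KS.δ j m (e a i K.* u)
    pull a i m j u = K.trans
      (KSolver.solve 3 (λ x y z → x :* y :* z := y :* (x :* z)) K.refl (e a i) (e m j) u)
      (K.trans (K.*-congʳ (K.reflexive (e-sym m j))) (K.sym (δ-e j m _)))

  F-parity : ∀ i j → HasParity (parity i ℙ.+ parity j) (F i j)
  F-parity i j a b p≢ = K.trans (F-e i j a b) (K.trans
    (K.+-cong (vanish i j ≡.refl) (vanish (⁻ i) (⁻ j) (opposite i j))) (K.+-identityˡ _))
    where
    opposite : ∀ i j → parity (⁻ i) ℙ.+ parity (⁻ j) ≡ parity i ℙ.+ parity j
    opposite (Sign.+ , _) (Sign.+ , _) = ≡.refl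
    opposite (Sign.+ , _) (Sign.- , _) = ≡.refl
    opposite (Sign.- , _) (Sign.+ , _) = ≡.refl
    opposite (Sign.- , _) (Sign.- , _) = ≡.refl
    ≡ᴵ⇒≡ : ∀ x y → (x ≡ᴵ y) ≡ true → x ≡ y
    ≡ᴵ⇒≡ (s , x) (t , y) q with s Signₚ.≟ t | x Finₚ.≟ y
    ... | yes ≡.refl | yes ≡.refl = ≡.refl
    ... | no _ | _ with () ← q
    ... | yes _ | no _ with () ← q
    vanish : ∀ x y → parity x ℙ.+ parity y ≡ parity i ℙ.+ parity j → e a x K.* e b y K.≈ K.0#
    vanish x y q with a ≡ᴵ x in a≡x | b ≡ᴵ y in b≡y
    ... | false | _     = K.zeroˡ _
    ... | true  | false = K.zeroʳ _
    ... | true  | true  = ⊥-elim (p≢ (≡.trans (≡.cong₂ (λ a b → parity a ℙ.+ parity b) (≡ᴵ⇒≡ a x a≡x) (≡ᴵ⇒≡ b y b≡y)) q))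

  -- The defining relation with its second product moved across. `C` is the bracket written as a
  -- combination of the `F i j`, and `entries` checks it against the matrix superbracket.
  adjoint-Fᵁ : Adjoint Fᵁ
  adjoint-Fᵁ i j k l = R.begin
    Fᵁ i j * Fᵁ k l
      R.≈⟨ trans (+-congˡ (-‿inverseˡ _)) (+-identityʳ _) ⟨
    Fᵁ i j * Fᵁ k l + (- swapped + swapped)
      R.≈⟨ trans (sym (+-assoc _ _ _)) (+-comm _ _) ⟩
    swapped + (Fᵁ i j * Fᵁ k l - swapped)
      R.≈⟨ +-cong (sgn-* (s i j k l) _)
             (trans (relation (bracket (span-gen (i , j)) (span-gen (k , l)) (proj₁ image)
                (parity i ℙ.+ parity j) (parity k ℙ.+ parity l) (F-parity i j) (F-parity k l) entries))
              (sym (proj₂ image))) ⟩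
    σ (s i j k l) (Fᵁ k l * Fᵁ i j) + ad Fᵁ i j k l R.∎
    where
    swapped = scalar (sgn (s i j k l)) * (Fᵁ k l * Fᵁ i j)
    q = 1ℙ ℙ.+ s i j k l
    C : Matrix
    C = ((λ a b → KS.δ j k (F i l a b)) +ᴹ (λ a b → KS.δ j (⁻ k) (F (⁻ i) l a b)))
      +ᴹ ((sgn q ·ᴹ (λ a b → KS.δ i l (F k j a b))) +ᴹ (sgn q ·ᴹ (λ a b → KS.δ (⁻ i) l (F k (⁻ j) a b))))
    image : Image (ad Fᵁ i j k l) C
    image = image-+ (image-+ (image-δ j k (image-F i l)) (image-δ j (⁻ k) (image-F (⁻ i) l)))
      (image-+ (image-σ q (image-δ i l (image-F k j))) (image-σ q (image-δ (⁻ i) l (image-F k (⁻ j)))))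
    sgn-suc : ∀ p → sgn (1ℙ ℙ.+ p) K.≈ K.- sgn p
    sgn-suc 0ℙ = K.refl
    sgn-suc 1ℙ = K.sym (KP.-‿involutive _)
    entries : C ≈ᴹ [ F i j , F k l ]⟨ parity i ℙ.+ parity j , parity k ℙ.+ parity l ⟩
    entries a b = K.+-cong
      (K.trans (K.+-cong (δ-e j k _) (δ-e j (⁻ k) _)) (K.sym (F-*ᴹ i j k l a b)))
      (K.trans (K.sym (K.distribˡ _ _ _)) (K.*-cong (sgn-suc (s i j k l))
        (K.trans (K.+-cong
            (K.trans (δ-e i l _) (K.*-congʳ (K.reflexive (e-sym i l))))
            -- The product formula yields `F (⁻ k) j` here, which is the same matrix as `F k (⁻ j)`.
            (K.trans (δ-e (⁻ i) l _) (K.*-cong (K.reflexive (e-sym (⁻ i) l))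
              (K.trans (K.sym (F-⁻ᴹ k (⁻ j) a b)) (K.reflexive (≡.cong (λ x → F (⁻ k) x a b) (KS.⁻-involutive j)))))))
          (K.sym (F-*ᴹ k l i j a b)))))

  powers : ℕ → I → I → Carrier
  powers zero    = Fᵁ
  powers (suc n) = Fᵁ ⋆ powers n

  adjoint-powers : ∀ n → Adjoint (powers n)
  adjoint-powers zero    = adjoint-Fᵁ
  adjoint-powers (suc n) = adjoint-⋆ adjoint-Fᵁ (adjoint-powers n)

  sumTuples-cong : ∀ r {f g : Vec I r → Carrier} → (∀ v → f v ≈ g v) → sumTuples r f ≈ sumTuples r g
  sumTuples-cong zero    e = e []
  sumTuples-cong (suc r) e = ΣI-cong λ i → sumTuples-cong r λ v → e (i ∷ v)

  sumTuples-*ˡ : ∀ r u (f : Vec I r → Carrier) → u * sumTuples r f ≈ sumTuples r (λ v → u * f v)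
  sumTuples-*ˡ zero    u f = refl
  sumTuples-*ˡ (suc r) u f = trans (ΣI-*ˡ u (λ i → sumTuples r λ v → f (i ∷ v))) (ΣI-cong λ i → sumTuples-*ˡ r u (λ v → f (i ∷ v)))

  sumTuples-σ : ∀ r p (f : Vec I r → Carrier) → σ p (sumTuples r f) ≈ sumTuples r (λ v → σ p (f v))
  sumTuples-σ zero    p f = refl
  sumTuples-σ (suc r) p f = trans (ΣI-σ p (λ i → sumTuples r λ v → f (i ∷ v))) (ΣI-cong λ i → sumTuples-σ r p (λ v → f (i ∷ v)))

  powers-paths : ∀ n k l → sumTuples n (λ v → scalar (sgn (totalParity v)) * path k v l) ≈ powers n k l
  powers-paths zero    k l = *-identityˡ _
  powers-paths (suc n) k l = ΣI-cong λ m → R.begin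
    sumTuples n (λ v → scalar (sgn (parity m ℙ.+ totalParity v)) * (Fᵁ k m * path m v l))
      R.≈⟨ sumTuples-cong n (λ v → R.begin
           scalar (sgn (parity m ℙ.+ totalParity v)) * (Fᵁ k m * path m v l)
             R.≈⟨ sgn-* (parity m ℙ.+ totalParity v) _ ⟩
           σ (parity m ℙ.+ totalParity v) (Fᵁ k m * path m v l)
             R.≈⟨ σ-σ (parity m) (totalParity v) _ ⟨
           σ (parity m) (σ (totalParity v) (Fᵁ k m * path m v l))
             R.≈⟨ σ-cong (parity m) (trans (sym (σ-*ʳ (totalParity v) _ _)) (*-congˡ (sym (sgn-* (totalParity v) _)))) ⟩
           σ (parity m) (Fᵁ k m * (scalar (sgn (totalParity v)) * path m v l)) R.∎) ⟩
    sumTuples n (λ v → σ (parity m) (Fᵁ k m * (scalar (sgn (totalParity v)) * path m v l)))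
      R.≈⟨ sumTuples-σ n (parity m) (λ v → Fᵁ k m * (scalar (sgn (totalParity v)) * path m v l)) ⟨
    σ (parity m) (sumTuples n (λ v → Fᵁ k m * (scalar (sgn (totalParity v)) * path m v l)))
      R.≈⟨ σ-cong (parity m) (sumTuples-*ˡ n (Fᵁ k m) (λ v → scalar (sgn (totalParity v)) * path m v l)) ⟨
    σ (parity m) (Fᵁ k m * sumTuples n (λ v → scalar (sgn (totalParity v)) * path m v l))
      R.≈⟨ σ-cong (parity m) (*-congˡ (powers-paths n m l)) ⟩
    σ (parity m) (Fᵁ k m * powers n m l) R.∎

  cyclic-trace : ∀ n → cyclic (suc n) ≈ ΣI (λ k → powers n k k)
  cyclic-trace n = ΣI-cong λ k → powers-paths n k k

  Commuting : Carrier → Carrier → Set _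
  Commuting z u = z * u ≈ u * z

  -- The first membership proof drives the induction; the second is the one carried by the generator
  -- and may be any, since by `gen-cong` generators with equal matrices agree in U.
  commuting-gen : ∀ z → (∀ i j → Commuting z (Fᵁ i j)) → ∀ {A} → 𝔮 A → (A∈ : 𝔮 A) → Commuting z (gen (A , A∈))
  commuting-gen z comm = go
    where
    along : ∀ {u v} → u ≈ v → Commuting z v → Commuting z u
    along e f = trans (*-congˡ e) (trans f (*-congʳ (sym e)))
    go : ∀ {A} → 𝔮 A → (A∈ : 𝔮 A) → Commuting z (gen (A , A∈))
    go (span-gen (i , j)) A∈ = along (gen-cong A∈ (span-gen (i , j)) (λ _ _ → K.refl)) (comm i j)
    go span-0 A∈ = along (gen-0 A∈) (trans (zeroʳ z) (sym (zeroˡ z)))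
    go (span-+ S T) A∈ = along (gen-+ S T A∈) (trans (distribˡ _ _ _) (trans (+-cong (go S S) (go T T)) (sym (distribʳ _ _ _))))
    go (span-· a S) A∈ = along (gen-· a S A∈) (trans (sym (*-assoc _ _ _)) (trans (*-congʳ (sym (scalar-comm a z)))
      (trans (*-assoc _ _ _) (trans (*-congˡ (go S S)) (sym (*-assoc _ _ _))))))
    go (span-resp e S) A∈ = along (gen-cong A∈ S (λ i j → K.sym (e i j))) (go S S)

  commuting-all : ∀ z → (∀ i j → Commuting z (Fᵁ i j)) → ∀ u → Commuting z u
  commuting-all z comm (scalar a)       = sym (scalar-comm a z)
  commuting-all z comm (gen (A , A∈))   = commuting-gen z comm A∈ A∈
  commuting-all z comm (plus u v)       = trans (distribˡ _ _ _) (trans (+-cong (commuting-all z comm u) (commuting-all z comm v)) (sym (distribʳ _ _ _)))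
  commuting-all z comm (times u v)      = trans (sym (*-assoc _ _ _)) (trans (*-congʳ (commuting-all z comm u))
    (trans (*-assoc _ _ _) (trans (*-congˡ (commuting-all z comm v)) (sym (*-assoc _ _ _)))))
  commuting-all z comm (minus u)        = trans (sym (RP.-‿distribʳ-* _ _)) (trans (-‿cong (commuting-all z comm u)) (RP.-‿distribˡ-* _ _))

  -- For an even element supercommuting is plain commuting, so closure under the ring operations
  -- involves neither signs nor the splitting into components that `Central` asks for.
  record EvenCentral (z : Carrier) : Set (c Level.⊔ ℓ) where
    constructor _,ᶜ_
    field
      even     : Homogeneous 0ℙ z
      commutes : ∀ u → Commuting z u
  open EvenCentral public

  evenCentral⇒central : ∀ {z} → EvenCentral z → Central z
  evenCentral⇒central {z} (ev ,ᶜ comm) = record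
    { z₀ = z ; z₁ = 0# ; z≈ = sym (+-identityʳ z) ; even = ev ; odd = hom-0
    ; comm₀ = λ {q} {u} _ → trans (comm u) (sym (times-one _))
    ; comm₁ = λ {q} {u} _ → trans (zeroˡ u) (sym (trans (*-congˡ (zeroʳ u)) (zeroʳ _))) }

  hom-neg : ∀ {p u} → Homogeneous p u → Homogeneous p (- u)
  hom-neg {p} {u} h = hom-resp (sgn-* 1ℙ u) (hom-* (hom-scalar (sgn 1ℙ)) h)

  hom-σ : ∀ {p u} q → Homogeneous p u → Homogeneous p (σ q u)
  hom-σ 0ℙ h = h
  hom-σ 1ℙ h = hom-neg h

  hom-ΣI : ∀ {p} {f : I → Carrier} → (∀ i → Homogeneous p (f i)) → Homogeneous p (ΣI f)
  hom-ΣI {p} h = hom-+ (hom-sum λ i → h (Sign.- , i)) (hom-sum λ i → h (Sign.+ , i))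
    where
    hom-sum : ∀ {n} {f : Fin n → Carrier} → (∀ i → Homogeneous p (f i)) → Homogeneous p (BigOperators.sum U f)
    hom-sum {zero}  h = hom-0
    hom-sum {suc n} h = hom-+ (h zero) (hom-sum (h ∘ suc))

  hom-powers : ∀ n k l → Homogeneous (parity k ℙ.+ parity l) (powers n k l)
  hom-powers zero    k l = hom-gen (span-gen (k , l)) (F-parity k l)
  hom-powers (suc n) k l = hom-ΣI λ m → hom-σ (parity m)
    (≡.subst (λ p → Homogeneous p (Fᵁ k m * powers n m l)) (middle (parity k) (parity m) (parity l))
      (hom-* (hom-gen (span-gen (k , m)) (F-parity k m)) (hom-powers n m l)))

  evenCentral-cyclic : ∀ n → EvenCentral (cyclic (suc n))
  evenCentral-cyclic n =
    hom-resp (sym (cyclic-trace n)) (hom-ΣI λ k →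
      ≡.subst (λ p → Homogeneous p (powers n k k)) (double (parity k)) (hom-powers n k k))
    ,ᶜ commuting-all (cyclic (suc n)) λ i j → trans (*-congʳ (cyclic-trace n))
      (trans (sym (adjoint-trace (adjoint-powers n) i j)) (*-congˡ (sym (cyclic-trace n))))
    where
    double : ∀ p → p ℙ.+ p ≡ 0ℙ
    double 0ℙ = ≡.refl
    double 1ℙ = ≡.refl

  evenCentral-0 : EvenCentral 0#
  evenCentral-0 = hom-0 ,ᶜ λ u → trans (zeroˡ u) (sym (zeroʳ u))

  evenCentral-1 : EvenCentral 1#
  evenCentral-1 = hom-scalar K.1# ,ᶜ scalar-comm K.1#

  evenCentral-neg : ∀ {z} → EvenCentral z → EvenCentral (- z)
  evenCentral-neg (ev ,ᶜ comm) = hom-neg ev ,ᶜ λ u → trans (sym (RP.-‿distribˡ-* _ u)) (trans (-‿cong (comm u)) (RP.-‿distribʳ-* u _))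

  evenCentral-+ : ∀ {z w} → EvenCentral z → EvenCentral w → EvenCentral (z + w)
  evenCentral-+ (ev ,ᶜ comm) (ev′ ,ᶜ comm′) = hom-+ ev ev′ ,ᶜ λ u →
    trans (distribʳ _ _ _) (trans (+-cong (comm u) (comm′ u)) (sym (distribˡ _ _ _)))

  evenCentral-* : ∀ {z w} → EvenCentral z → EvenCentral w → EvenCentral (z * w)
  evenCentral-* {z} {w} (ev ,ᶜ comm) (ev′ ,ᶜ comm′) = hom-* ev ev′ ,ᶜ λ u →
    trans (*-assoc z w u) (trans (*-congˡ (comm′ u)) (trans (sym (*-assoc z u w)) (trans (*-congʳ (comm u)) (*-assoc u z w))))

-- Substitution of commuting elements is a ring homomorphism

module Substitution {c ℓ a ℓ′} (K : CommutativeRing c ℓ) (A : Ring a ℓ′)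
  (ι : CommutativeRing.Carrier K → Ring.Carrier A)
  (ι-cong : ∀ {u v} → CommutativeRing._≈_ K u v → Ring._≈_ A (ι u) (ι v))
  (ι-+ : ∀ u v → Ring._≈_ A (ι (CommutativeRing._+_ K u v)) (Ring._+_ A (ι u) (ι v)))
  (ι-* : ∀ u v → Ring._≈_ A (ι (CommutativeRing._*_ K u v)) (Ring._*_ A (ι u) (ι v)))
  (ι-neg : ∀ u → Ring._≈_ A (ι (CommutativeRing.-_ K u)) (Ring.-_ A (ι u)))
  (ι-0 : Ring._≈_ A (ι (CommutativeRing.0# K)) (Ring.0# A))
  (ι-1 : Ring._≈_ A (ι (CommutativeRing.1# K)) (Ring.1# A))
  (ι-central : ∀ u v → Ring._≈_ A (Ring._*_ A (ι u) v) (Ring._*_ A v (ι u))) where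
  open Ring A hiding (zero)
  private
    module RP = RingProps A
    module CS = CommSemigroupProps +-commutativeSemigroup
    open SetoidReasoning setoid
    module M n = CommutativeRing (MPoly K n)

    S : ∀ {n} → (Fin n → Carrier) → M.Carrier n → Carrier
    S = substitute K A ι

  module _ {n} (x : Fin (suc n) → Carrier) where
    -- The local Horner scheme of substitute, which carries the whole polynomial P as a
    -- dummy argument; it has no name, so unification has to find it.
    mutual
      horner : List (M.Carrier n) → List (M.Carrier n) → Carrier
      horner P q = _

      S-horner : ∀ a p → S x (a ∷ p) ≈ S (x ∘ suc) a + x zero * horner (a ∷ p) p
      S-horner a p with a ∷ p
      ... | P = refl

    horner-dummy : ∀ P Q q → horner P q ≈ horner Q q
    horner-dummy P Q []      = refl
    horner-dummy P Q (a ∷ q) = +-congˡ (*-congˡ (horner-dummy P Q q))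

    S-∷ : ∀ a p → S x (a ∷ p) ≈ S (x ∘ suc) a + x zero * S x p
    S-∷ a p = +-congˡ (*-congˡ (horner-dummy (a ∷ p) p p))

  Commute : Carrier → Carrier → Set ℓ′
  Commute u v = u * v ≈ v * u

  commute-S : ∀ {n} (x : Fin n → Carrier) y → (∀ i → Commute y (x i)) → ∀ p → Commute y (S x p)
  commute-S {zero}  x y comm p       = sym (ι-central p y)
  commute-S {suc n} x y comm []      = trans (zeroʳ y) (sym (zeroˡ y))
  commute-S {suc n} x y comm (a ∷ p) = trans (*-congˡ (S-∷ x a p)) (trans (begin
    y * (S (x ∘ suc) a + x zero * S x p)       ≈⟨ distribˡ _ _ _ ⟩
    y * S (x ∘ suc) a + y * (x zero * S x p)   ≈⟨ +-cong (commute-S (x ∘ suc) y (comm ∘ suc) a) (sym (*-assoc _ _ _)) ⟩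
    S (x ∘ suc) a * y + y * x zero * S x p     ≈⟨ +-congˡ (trans (*-congʳ (comm zero)) (trans (*-assoc _ _ _) (trans (*-congˡ (commute-S {suc n} x y comm p)) (sym (*-assoc _ _ _))))) ⟩
    S (x ∘ suc) a * y + x zero * S x p * y     ≈⟨ distribʳ _ _ _ ⟨
    (S (x ∘ suc) a + x zero * S x p) * y       ∎) (*-congʳ (sym (S-∷ x a p))))

  record IsHomomorphism {n} (x : Fin n → Carrier) : Set (c Level.⊔ ℓ Level.⊔ ℓ′) where
    field
      cong  : ∀ {p q} → M._≈_ n p q → S x p ≈ S x q
      homo-+ : ∀ p q → S x (M._+_ n p q) ≈ S x p + S x q
      homo-* : ∀ p q → S x (M._*_ n p q) ≈ S x p * S x q
      homo-neg : ∀ p → S x (M.-_ n p) ≈ - S x p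
      homo-0 : S x (M.0# n) ≈ 0#
      homo-1 : S x (M.1# n) ≈ 1#

  homomorphism : ∀ {n} (x : Fin n → Carrier) → (∀ i j → Commute (x i) (x j)) → IsHomomorphism x
  homomorphism {zero} x comm = record
    { cong = ι-cong ; homo-+ = ι-+ ; homo-* = ι-* ; homo-neg = ι-neg ; homo-0 = ι-0 ; homo-1 = ι-1 }
  homomorphism {suc n} x comm = record
    { cong = S-cong ; homo-+ = S-+ ; homo-* = S-* ; homo-neg = S-neg ; homo-0 = refl
    ; homo-1 = trans (+-cong IH.homo-1 (zeroʳ X₀)) (+-identityʳ 1#) }
    where
    module IH = IsHomomorphism (homomorphism (x ∘ suc) (λ i j → comm (suc i) (suc j)))
    open Polynomial (MPoly K n) hiding (-ₚ_)
    X₀ = x zero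
    S′ = S (x ∘ suc)

    S-zero : ∀ p → p ≈ₚ [] → S x p ≈ 0#
    S-zero []      e = refl
    S-zero (a ∷ p) e = trans (S-∷ x a p) (trans
      (+-cong (trans (IH.cong (e .coeff-≈ 0)) IH.homo-0) (trans (*-congˡ (S-zero p (coeffwise λ k → e .coeff-≈ (suc k)))) (zeroʳ X₀)))
      (+-identityˡ 0#))

    S-cong : ∀ {p q} → p ≈ₚ q → S x p ≈ S x q
    S-cong {[]}    {q}     e = sym (S-zero q (coeffwise λ k → M.sym n (e .coeff-≈ k)))
    S-cong {a ∷ p} {[]}    e = S-zero (a ∷ p) e
    S-cong {a ∷ p} {b ∷ q} e = trans (S-∷ x a p) (trans
      (+-cong (IH.cong (e .coeff-≈ 0)) (*-congˡ (S-cong {p} {q} (coeffwise λ k → e .coeff-≈ (suc k)))))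
      (sym (S-∷ x b q)))

    S-+ : ∀ p q → S x (p +ₚ q) ≈ S x p + S x q
    S-+ []      q       = sym (+-identityˡ _)
    S-+ (a ∷ p) []      = sym (+-identityʳ _)
    S-+ (a ∷ p) (b ∷ q) = trans (S-∷ x (M._+_ n a b) (p +ₚ q)) (trans
      (+-cong (IH.homo-+ a b) (trans (*-congˡ (S-+ p q)) (distribˡ _ _ _)))
      (trans (CS.interchange _ _ _ _) (sym (+-cong (S-∷ x a p) (S-∷ x b q)))))

    S-scale : ∀ a q → S x (scale a q) ≈ S′ a * S x q
    S-scale a []      = sym (zeroʳ _)
    S-scale a (b ∷ q) = begin
      S x (M._*_ n a b ∷ scale a q)             ≈⟨ S-∷ x (M._*_ n a b) (scale a q) ⟩
      S′ (M._*_ n a b) + X₀ * S x (scale a q)   ≈⟨ +-cong (IH.homo-* a b) (*-congˡ (S-scale a q)) ⟩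
      -- Here the commutation of the values enters: the outermost one has to pass a coefficient
      -- built from the others.
      S′ a * S′ b + X₀ * (S′ a * S x q)         ≈⟨ +-congˡ (trans (sym (*-assoc _ _ _)) (trans (*-congʳ (commute-S (x ∘ suc) X₀ (λ i → comm zero (suc i)) a)) (*-assoc _ _ _))) ⟩
      S′ a * S′ b + S′ a * (X₀ * S x q)         ≈⟨ distribˡ _ _ _ ⟨
      S′ a * (S′ b + X₀ * S x q)                ≈⟨ *-congˡ (S-∷ x b q) ⟨
      S′ a * S x (b ∷ q)                        ∎

    S-* : ∀ p q → S x (p *ₚ q) ≈ S x p * S x q
    S-* []      q = sym (zeroˡ _)
    S-* (a ∷ p) q = begin
      S x (scale a q +ₚ (M.0# n ∷ p *ₚ q))              ≈⟨ S-+ (scale a q) (M.0# n ∷ p *ₚ q) ⟩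
      S x (scale a q) + S x (M.0# n ∷ p *ₚ q)           ≈⟨ +-congˡ (S-∷ x (M.0# n) (p *ₚ q)) ⟩
      S x (scale a q) + (S′ (M.0# n) + X₀ * S x (p *ₚ q)) ≈⟨ +-cong (S-scale a q) (trans (+-congʳ IH.homo-0) (+-identityˡ _)) ⟩
      S′ a * S x q + X₀ * S x (p *ₚ q)                  ≈⟨ +-congˡ (trans (*-congˡ (S-* p q)) (sym (*-assoc _ _ _))) ⟩
      S′ a * S x q + X₀ * S x p * S x q                 ≈⟨ distribʳ _ _ _ ⟨
      (S′ a + X₀ * S x p) * S x q                       ≈⟨ *-congʳ (S-∷ x a p) ⟨
      S x (a ∷ p) * S x q                               ∎

    S-neg : ∀ p → S x (M.-_ (suc n) p) ≈ - S x p
    S-neg []      = sym RP.-0#≈0#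
    S-neg (a ∷ p) = trans (S-∷ x (M.-_ n a) (M.-_ (suc n) p)) (trans
      (+-cong (IH.homo-neg a) (trans (*-congˡ (S-neg p)) (sym (RP.-‿distribʳ-* _ _))))
      (trans (RP.-‿+-comm _ _) (-‿cong (sym (S-∷ x a p)))))

  S-var : ∀ {n} (x : Fin n → Carrier) i → S x (var K i) ≈ x i
  S-var {suc n} x zero = trans
    (+-cong (S-0 (x ∘ suc)) (trans (*-congˡ (trans (+-cong (S-1 (x ∘ suc)) (zeroʳ _)) (+-identityʳ 1#))) (*-identityʳ _)))
    (+-identityˡ _)
    where
    S-0 : ∀ {n} (x : Fin n → Carrier) → S x (M.0# n) ≈ 0#
    S-0 {zero}  x = ι-0
    S-0 {suc n} x = refl
    S-1 : ∀ {n} (x : Fin n → Carrier) → S x (M.1# n) ≈ 1#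
    S-1 {zero}  x = ι-1
    S-1 {suc n} x = trans (+-cong (S-1 (x ∘ suc)) (zeroʳ _)) (+-identityʳ 1#)
  S-var {suc n} x (suc i) = trans (+-cong (S-var (x ∘ suc) i) (zeroʳ _)) (+-identityʳ _)

-- The diagonal entries of the Harish-Chandra images of the even powers, see two-steps.
module DiagonalRecursion {c ℓ} (R : CommutativeRing c ℓ) where
  open CommutativeRing R hiding (zero)
  open SuffixSum ring
  open BigOperators ring using (sum)

  diagonal : ∀ {n} → (Fin n → Carrier) → ℕ → Fin n → Carrier
  diagonal Λ zero    κ = Λ κ
  diagonal Λ (suc r) κ =
    Λ κ * (Λ κ * diagonal Λ r κ + sum> κ (λ μ → - (diagonal Λ r μ + diagonal Λ r μ))) - Λ κ * diagonal Λ r κ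

  -- The doubling accounts for the indices κ and -κ, which contribute equally to the trace of an
  -- even power.
  moment : ∀ {n} → (Fin n → Carrier) → ℕ → Carrier
  moment Λ r = sum (diagonal Λ r) + sum (diagonal Λ r)

-- Harish-Chandra images of the odd cyclic elements and of their determinant

module HarishChandra {c ℓ} (K : CommutativeRing c ℓ) (N : ℕ)
  (½ : CommutativeRing.Carrier K)
  (½+½ : CommutativeRing._≈_ K (CommutativeRing._+_ K ½ ½) (CommutativeRing.1# K)) where
  private
    module L = CommutativeRing (MPoly K N)
  open Queer K N hiding (pos; ⁻_; _≡ᴵ_)
  open Enveloping K N
  open Ring U hiding (zero)
  private
    module RP = RingProps U
    module R = SetoidReasoning setoid


  halve : ∀ {u v} → u + u ≈ v + v → u ≈ v
  halve {u} {v} e = trans (sym (half u)) (trans (*-congˡ e) (half v))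
    where
    half : ∀ u → scalar ½ * (u + u) ≈ u
    half u = trans (distribˡ _ _ _) (trans (sym (distribʳ u (scalar ½) (scalar ½)))
      (trans (*-congʳ (trans (sym (scalar-plus ½ ½)) (scalar-cong ½+½))) (times-one u)))

  -- Leaving out the part 𝔫₋U gives a set closed under multiplication from the left, so that the
  -- calculus of congruences modulo a left ideal applies.
  data U𝔫₊-ideal : Carrier → Set (c Level.⊔ ℓ) where
    ideal-gen  : ∀ u {A} (A∈ : 𝔮 A) → 𝔫₊ A → U𝔫₊-ideal (u * gen (A , A∈))
    ideal-0    : U𝔫₊-ideal 0#
    ideal-+    : ∀ {u v} → U𝔫₊-ideal u → U𝔫₊-ideal v → U𝔫₊-ideal (u + v)
    ideal-resp : ∀ {u v} → u ≈ v → U𝔫₊-ideal u → U𝔫₊-ideal v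

  ideal-*ˡ : ∀ u {v} → U𝔫₊-ideal v → U𝔫₊-ideal (u * v)
  ideal-*ˡ u (ideal-gen v A∈ p)  = ideal-resp (*-assoc u v _) (ideal-gen (u * v) A∈ p)
  ideal-*ˡ u ideal-0             = ideal-resp (sym (zeroʳ u)) ideal-0
  ideal-*ˡ u (ideal-+ e f)       = ideal-resp (sym (distribˡ _ _ _)) (ideal-+ (ideal-*ˡ u e) (ideal-*ˡ u f))
  ideal-*ˡ u (ideal-resp q e)    = ideal-resp (*-congˡ q) (ideal-*ˡ u e)

  ideal-*ʳ : ∀ {z v} → (∀ u → z * u ≈ u * z) → U𝔫₊-ideal v → U𝔫₊-ideal (v * z)
  ideal-*ʳ {z} comm (ideal-gen v A∈ p)  = ideal-resp
    (trans (*-assoc v z _) (trans (*-congˡ (comm _)) (sym (*-assoc v _ z)))) (ideal-gen (v * z) A∈ p)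
  ideal-*ʳ comm ideal-0             = ideal-resp (sym (zeroˡ _)) ideal-0
  ideal-*ʳ comm (ideal-+ e f)       = ideal-resp (sym (distribʳ _ _ _)) (ideal-+ (ideal-*ʳ comm e) (ideal-*ʳ comm f))
  ideal-*ʳ comm (ideal-resp q e)    = ideal-resp (*-congʳ q) (ideal-*ʳ comm e)

  ideal-F : ∀ k m → proj₂ k Fin.< proj₂ m → U𝔫₊-ideal (Fᵁ k m)
  ideal-F (Sign.+ , i) (s , j) i<j = ideal-resp (*-identityˡ _)
    (ideal-gen 1# (span-gen _) (span-gen (s , i , j , i<j)))
  ideal-F (Sign.- , i) (s , j) i<j = ideal-resp (Fᵁ-⁻ (Sign.- , i) (s , j)) (ideal-F (Sign.+ , i) (Sign.opposite s , j) i<j)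

  ideal⇒𝔫₋U+U𝔫₊ : ∀ {u} → U𝔫₊-ideal u → 𝔫₋U+U𝔫₊ u
  ideal⇒𝔫₋U+U𝔫₊ (ideal-gen u A∈ p) = U𝔫₊ u A∈ p
  ideal⇒𝔫₋U+U𝔫₊ ideal-0            = sum-0
  ideal⇒𝔫₋U+U𝔫₊ (ideal-+ e f)      = sum-+ (ideal⇒𝔫₋U+U𝔫₊ e) (ideal⇒𝔫₋U+U𝔫₊ f)
  ideal⇒𝔫₋U+U𝔫₊ (ideal-resp q e)   = sum-resp q (ideal⇒𝔫₋U+U𝔫₊ e)

  open HarishChandraRecursion U N Fᵁ adjoint-Fᵁ Fᵁ-⁻ halve U𝔫₊-ideal ideal-0 ideal-+ ideal-*ˡ ideal-resp ideal-F

  Λᵁ : Fin N → Carrier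
  Λᵁ i = Fᵁ (pos i) (pos i)

  Λᵁ-commute : ∀ i j → Λᵁ i * Λᵁ j ≈ Λᵁ j * Λᵁ i
  Λᵁ-commute i j with i Finₚ.≟ j
  ... | yes ≡.refl = refl
  ... | no i≢j = trans (adjoint-Fᵁ (pos i) (pos i) (pos j) (pos j)) (trans (+-congˡ vanish) (+-identityʳ _))
    where
    vanish : ad Fᵁ (pos i) (pos i) (pos j) (pos j) ≈ 0#
    vanish = trans (+-cong
      (trans (+-cong (δ-≢ (pos i) (pos j) _ λ { ≡.refl → i≢j ≡.refl }) (δ-≢ (pos i) (neg j) (Fᵁ (neg i) (pos j)) λ ())) (+-identityˡ 0#))
      (trans (+-cong (trans (-‿cong (δ-≢ (pos i) (pos j) _ λ { ≡.refl → i≢j ≡.refl })) RP.-0#≈0#)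
                     (trans (-‿cong (δ-≢ (neg i) (pos j) (Fᵁ (pos j) (neg i)) λ ())) RP.-0#≈0#)) (+-identityˡ 0#)))
      (+-identityˡ 0#)

  private
    module Subst = Substitution K U scalar scalar-cong scalar-plus scalar-times scalar-neg refl refl scalar-comm
  open Subst.IsHomomorphism (Subst.homomorphism Λᵁ Λᵁ-commute) public

  S : L.Carrier → Carrier
  S = substitute K U scalar Λᵁ

  open DiagonalRecursion (MPoly K N)

  Λᴸ : Fin N → L.Carrier
  Λᴸ i = var K {N} i

  -- The powers with even index, with a recursion in steps of two to fit `two-steps`.
  evenPowers : ℕ → I → I → Carrier
  evenPowers zero    = Fᵁ
  evenPowers (suc r) = Fᵁ ⋆ (Fᵁ ⋆ evenPowers r)

  evenPowers-powers : ∀ r k l → powers (2 ℕ.* r) k l ≡ evenPowers r k l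
  evenPowers-powers r k l = ≡.cong (λ X → X k l) (lemma r)
    where
    lemma : ∀ r → powers (2 ℕ.* r) ≡ evenPowers r
    lemma zero    = ≡.refl
    lemma (suc r) = ≡.trans (≡.cong powers (≡.cong suc (ℕₚ.+-suc r (r ℕ.+ 0)))) (≡.cong (λ X → Fᵁ ⋆ (Fᵁ ⋆ X)) (lemma r))

  adjoint-evenPowers : ∀ r → Adjoint (evenPowers r)
  adjoint-evenPowers zero    = adjoint-Fᵁ
  adjoint-evenPowers (suc r) = adjoint-⋆ adjoint-Fᵁ (adjoint-⋆ adjoint-Fᵁ (adjoint-evenPowers r))

  triangular-evenPowers : ∀ r → Triangular (evenPowers r)
  triangular-evenPowers zero    = ideal-F
  triangular-evenPowers (suc r) = triangular-⋆ (adjoint-⋆ adjoint-Fᵁ (adjoint-evenPowers r))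
    (triangular-⋆ (adjoint-evenPowers r) (triangular-evenPowers r))

  even-evenPowers : ∀ r → Even (evenPowers r)
  even-evenPowers zero    = Fᵁ-⁻
  even-evenPowers (suc r) = even-⋆⋆ (even-evenPowers r)

  S-sum : ∀ {n} (t : Fin n → L.Carrier) → S (BigOperators.sum L.ring t) ≈ BigOperators.sum U (S ∘ t)
  S-sum {zero}  t = homo-0
  S-sum {suc n} t = trans (homo-+ _ _) (+-congˡ (S-sum (t ∘ suc)))

  S-sum> : ∀ {n} (κ : Fin n) (t : Fin n → L.Carrier) → S (SuffixSum.sum> L.ring κ t) ≈ SuffixSum.sum> U κ (S ∘ t)
  S-sum> zero    t = S-sum (t ∘ suc)
  S-sum> (suc κ) t = S-sum> κ (t ∘ suc)

  evenPowers-diagonal : ∀ r κ → evenPowers r (pos κ) (pos κ) ≋ S (diagonal Λᴸ r κ)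
  evenPowers-diagonal zero    κ = ≈⇒≋ (sym (Subst.S-var Λᵁ κ))
  evenPowers-diagonal (suc r) κ = ≋-trans
    (two-steps κ (adjoint-evenPowers r) (triangular-evenPowers r) (even-evenPowers r))
    (≋-trans
      (≋-+ (≋-*ˡ (Λᵁ κ) (≋-+ (≋-*ˡ (Λᵁ κ) (evenPowers-diagonal r κ))
             (sum>-≋ κ λ μ → ≋-neg (≋-+ (evenPowers-diagonal r μ) (evenPowers-diagonal r μ)))))
           (≋-neg (≋-*ˡ (Λᵁ κ) (evenPowers-diagonal r κ))))
      (≈⇒≋ (sym (R.begin
        S (diagonal Λᴸ (suc r) κ)
          R.≈⟨ trans (homo-+ _ _) (+-cong (homo-* _ _) (trans (homo-neg _) (-‿cong (homo-* _ _)))) ⟩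
        S (Λᴸ κ) * S (Λᴸ κ L.* d κ L.+ sum>ᴸ κ (λ μ → L.- (d μ L.+ d μ))) - S (Λᴸ κ) * S (d κ)
          R.≈⟨ +-cong (*-cong (Subst.S-var Λᵁ κ) (trans (homo-+ _ _) (+-cong (trans (homo-* _ _) (*-congʳ (Subst.S-var Λᵁ κ)))
                 (trans (S-sum> κ (λ μ → L.- (d μ L.+ d μ))) (SuffixSum.sum>-cong U κ λ μ → trans (homo-neg _) (-‿cong (homo-+ _ _)))))))
               (-‿cong (*-congʳ (Subst.S-var Λᵁ κ))) ⟩
        Λᵁ κ * (Λᵁ κ * S (d κ) + SuffixSum.sum> U κ (λ μ → - (S (d μ) + S (d μ)))) - Λᵁ κ * S (d κ) R.∎))))
    where
    d = diagonal Λᴸ r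
    sum>ᴸ : ∀ {n} → Fin n → (Fin n → L.Carrier) → L.Carrier
    sum>ᴸ = SuffixSum.sum> L.ring

  -- The left ideal U𝔫₊ suffices in place of 𝔫₋U + U𝔫₊.
  record Image₊ (z : Carrier) (f : L.Carrier) : Set (c Level.⊔ ℓ) where
    constructor _,ᴴ_
    field
      evenCentral : EvenCentral z
      image       : z ≋ S f
  open Image₊ public

  -- Write z w - S f S g as (z - S f) w + S f (w - S g). The first summand stays in the ideal
  -- because w is central, the second because the ideal is a left ideal.
  image₊-* : ∀ {z f w g} → Image₊ z f → Image₊ w g → Image₊ (z * w) (f L.* g)
  image₊-* {z} {f} {w} {g} (c₁ ,ᴴ e) (c₂ ,ᴴ e′) = evenCentral-* c₁ c₂ ,ᴴ ≋-trans
    (congruent (ideal-resp (RP.[y-z]x≈yx-zx w z (S f)) (ideal-*ʳ (commutes c₂) (J-difference e))))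
    (≋-trans (≋-*ˡ (S f) e′) (≈⇒≋ (sym (homo-* f g))))

  image₊-b : ∀ r → Image₊ (b (suc r)) (moment Λᴸ r)
  image₊-b r = evenCentral-cyclic (2 ℕ.* r) ,ᴴ ≋-trans (≈⇒≋ (cyclic-trace (2 ℕ.* r)))
    (≋-trans
      (≋-+ (≋-sum λ κ → ≋-trans (≈⇒≋ (trans (reflexive (evenPowers-powers r (neg κ) (neg κ))) (even-evenPowers r (pos κ) (pos κ)))) (evenPowers-diagonal r κ))
           (≋-sum λ κ → ≋-trans (≈⇒≋ (reflexive (evenPowers-powers r (pos κ) (pos κ)))) (evenPowers-diagonal r κ)))
      (≈⇒≋ (sym (trans (homo-+ _ _) (+-cong (S-sum (diagonal Λᴸ r)) (S-sum (diagonal Λᴸ r)))))))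

  momentMatrix : Fin N → Fin N → L.Carrier
  momentMatrix i j = moment Λᴸ (toℕ i ℕ.+ toℕ j)

  image₊-Δ : Image₊ Δ (det L.ring momentMatrix)
  image₊-Δ = DeterminantRelation.det-~ U L.ring Image₊
    (evenCentral-0 ,ᴴ ≈⇒≋ (sym homo-0))
    (evenCentral-1 ,ᴴ ≈⇒≋ (sym homo-1))
    (λ { {u} {v} (c₁ ,ᴴ e) → evenCentral-neg c₁ ,ᴴ ≋-trans (≋-neg e) (≈⇒≋ (sym (homo-neg v))) })
    (λ { {u} {v} {u′} {v′} (c₁ ,ᴴ e) (c₂ ,ᴴ e′) → evenCentral-+ c₁ c₂ ,ᴴ ≋-trans (≋-+ e e′) (≈⇒≋ (sym (homo-+ v v′))) })
    image₊-* (λ i j → b (suc (toℕ i ℕ.+ toℕ j))) momentMatrix (λ i j → image₊-b (toℕ i ℕ.+ toℕ j))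

  HC-Δ : ∀ {h} → det L.ring momentMatrix L.≈ h → HC Δ h
  HC-Δ {h} e = record
    { central = evenCentral⇒central (evenCentral image₊-Δ)
    ; congruent = ideal⇒𝔫₋U+U𝔫₊ (J-difference
        (≋-trans (image image₊-Δ) (≈⇒≋ (cong {det L.ring momentMatrix} {h} e)))) }

-- Hankel determinants from rational generating series

module PowerSeries {c ℓ} (R : CommutativeRing c ℓ) where
  open CommutativeRing R hiding (zero)
  open BigOperators ring using (sum; product; _^_)
  open Determinant R
  open Hankel R
  private
    module RP = RingProps ring
    open SetoidReasoning setoid
    open Solver R

  -- Multiplication of the generating series Σ sᵣ zʳ by 1 - x z, resp. by ∏ₖ (1 - xₖ z).
  B : Carrier → Seq → Seq
  B x s zero    = s zero
  B x s (suc r) = s (suc r) - x * s r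

  B* : ∀ {n} → Row n → Seq → Seq
  B* {zero}  x s = s
  B* {suc n} x s = B* (x ∘ suc) (B (x zero) s)

  one : Seq
  one zero    = 1#
  one (suc r) = 0#

  B-cong : ∀ x {s t} → (∀ r → s r ≈ t r) → ∀ r → B x s r ≈ B x t r
  B-cong x e zero    = e zero
  B-cong x e (suc r) = +-cong (e (suc r)) (-‿cong (*-congˡ (e r)))

  B*-cong : ∀ {n} (x : Row n) {s t} → (∀ r → s r ≈ t r) → ∀ r → B* x s r ≈ B* x t r
  B*-cong {zero}  x e = e
  B*-cong {suc n} x e = B*-cong (x ∘ suc) (B-cong (x zero) e)

  B-comm : ∀ x y s r → B x (B y s) r ≈ B y (B x s) r
  B-comm x y s zero          = refl
  B-comm x y s (suc zero)    = solve 4 (λ x y a b → (a :- y :* b) :- x :* b := (a :- x :* b) :- y :* b) refl x y (s 1) (s 0)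
  B-comm x y s (suc (suc r)) = ∇-comm x y s r

  B*-B-comm : ∀ {n} (x : Row n) y s r → B* x (B y s) r ≈ B y (B* x s) r
  B*-B-comm {zero}  x y s r = refl
  B*-B-comm {suc n} x y s r = trans
    (B*-cong (x ∘ suc) (B-comm (x zero) y s) r)
    (B*-B-comm (x ∘ suc) y (B (x zero) s) r)

  -- The series 1 - x z is invertible: its constant term is 1, so coefficients are recovered one
  -- after another.
  B-injective : ∀ x {s t} → (∀ r → B x s r ≈ B x t r) → ∀ r → s r ≈ t r
  B-injective x e zero    = e zero
  B-injective x {s} {t} e (suc r) = begin
    s (suc r)                          ≈⟨ solve 2 (λ a b → a := (a :- b) :+ b) refl (s (suc r)) (x * s r) ⟩
    s (suc r) - x * s r + x * s r      ≈⟨ +-cong (e (suc r)) (*-congˡ (B-injective x {s} {t} e r)) ⟩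
    t (suc r) - x * t r + x * t r      ≈⟨ solve 2 (λ a b → (a :- b) :+ b := a) refl (t (suc r)) (x * t r) ⟩
    t (suc r)                          ∎

  B*-remove : ∀ {n} (x : Row (suc n)) m s r → B (x m) (B* (x ∘ punchIn m) s) r ≈ B* x s r
  B*-remove x zero s r = sym (B*-B-comm (x ∘ suc) (x zero) s r)
  B*-remove {suc n} x (suc m) s r = B*-remove (x ∘ suc) m (B (x zero) s) r

  ∇*-shift : ∀ {n} (x : Row n) s k → ∇* x (s ∘ suc) k ≡ ∇* x s (suc k)
  ∇*-shift {zero}  x s k = ≡.refl
  ∇*-shift {suc n} x s k = ∇*-shift (x ∘ suc) (∇ (x zero) s) k

  -- From coefficient n on, multiplying a series by ∏ (1 - xᵢ z) is the recurrence operator of the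
  -- reversed polynomial ∏ (τ - xᵢ). This translates between generating series and the operators of
  -- the Hankel lemma.
  ∇*-B* : ∀ {n} (x : Row n) s k → ∇* x s k ≡ B* x s (n ℕ.+ k)
  ∇*-B* {zero}  x s k = ≡.refl
  ∇*-B* {suc n} x s k = ≡.trans (∇*-shift (x ∘ suc) (B (x zero) s) k)
    (≡.trans (∇*-B* (x ∘ suc) (B (x zero) s) (suc k)) (≡.cong (B* x s) (ℕₚ.+-suc n k)))

  ∇*-0 : ∀ {n} (x : Row n) {s} → (∀ k → s k ≈ 0#) → ∀ k → ∇* x s k ≈ 0#
  ∇*-0 {zero}  x e k = e k
  ∇*-0 {suc n} x {s} e k = ∇*-0 (x ∘ suc) (λ k → trans (+-cong (e (suc k)) (-‿cong (trans (*-congˡ (e k)) (zeroʳ _)))) (-‿inverseʳ 0#)) k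

  ∇*-neg : ∀ {n} (x : Row n) s k → ∇* x (λ r → - s r) k ≈ - ∇* x s k
  ∇*-neg {zero}  x s k = refl
  ∇*-neg {suc n} x s k = trans
    (∇*-cong (x ∘ suc) (λ r → solve 3 (λ x a b → :- a :- x :* (:- b) := :- (a :- x :* b)) refl (x zero) (s (suc r)) (s r)) k)
    (∇*-neg (x ∘ suc) (∇ (x zero) s) k)

  -- A geometric sequence is an eigenvector of the shift, so each τ - yᵢ multiplies it by x - yᵢ.
  ∇*-geometric : ∀ {n} (y : Row n) c x k → ∇* y (λ r → c * x ^ r) k ≈ c * product (λ i → x - y i) * x ^ k
  ∇*-geometric {zero}  y c x k = solve 2 (λ c g → c :* g := c :* :1 :* g) refl c (x ^ k)
  ∇*-geometric {suc n} y c x k = begin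
    ∇* (y ∘ suc) (∇ (y zero) (λ r → c * x ^ r)) k
      ≈⟨ ∇*-cong (y ∘ suc) (λ r → solve 4 (λ c x y g → c :* (x :* g) :- y :* (c :* g) := c :* (x :- y) :* g) refl c x (y zero) (x ^ r)) k ⟩
    ∇* (y ∘ suc) (λ r → c * (x - y zero) * x ^ r) k
      ≈⟨ ∇*-geometric (y ∘ suc) (c * (x - y zero)) x k ⟩
    c * (x - y zero) * product (λ i → x - y (suc i)) * x ^ k
      ≈⟨ *-congʳ (*-assoc _ _ _) ⟩
    c * product (λ i → x - y i) * x ^ k ∎

  -- If ∏ (1 - xᵢ z) W(z) = ∏ (1 - yᵢ z), the coefficients of -W(z) from z on
  -- form a Hankel matrix with the following determinant.
  det-rational-hankel : ∀ {n} (x y : Row (suc n)) w → (∀ r → B* x w r ≈ B* y one r) →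
    det ring {suc n} (λ i j → - w (suc (toℕ i ℕ.+ toℕ j)))
      ≈ ⟨ suc n C 2 ⟩ * product (λ m → - product (λ k → x m - y k))
  det-rational-hankel {n} x y w e = trans (det-hankel x a annihilated)
    (*-congˡ (MonoidSum.sum-cong-≋ *-commutativeMonoid residue))
    where
    a : Seq
    a r = - w (suc r)
    ∇*-a : ∀ {m} (z : Row m) k → ∇* z a k ≈ - B* z w (m ℕ.+ suc k)
    ∇*-a z k = trans (∇*-neg z (w ∘ suc) k)
      (-‿cong (reflexive (≡.trans (∇*-shift z w k) (∇*-B* z w (suc k)))))
    -- The sequence starts at the coefficient of z, which pushes the index to `suc n + suc k`,
    -- strictly above the degree of ∏ (1 - yᵢ z).
    annihilated : ∀ k → ∇* x a k ≈ 0#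
    annihilated k = begin
      ∇* x a k                        ≈⟨ ∇*-a x k ⟩
      - B* x w (suc n ℕ.+ suc k)      ≈⟨ -‿cong (e _) ⟩
      - B* y one (suc n ℕ.+ suc k)    ≈⟨ -‿cong (reflexive (≡.trans (∇*-shift y one k) (∇*-B* y one (suc k)))) ⟨
      - ∇* y (one ∘ suc) k            ≈⟨ trans (-‿cong (∇*-0 y (λ _ → refl) k)) RP.-0#≈0# ⟩
      0#                              ∎
    -- Dividing the hypothesis by 1 - xₘ z shows that the product over i ≠ m times W(z) equals ∏ (1
    -- - yᵢ z) Σ xₘʳ zʳ. The required coefficient, in degree `suc n`, is then an eigenvalue of ∏ (τ
    -- - yᵢ) on a geometric sequence.
    residue : ∀ m → ∇* (x ∘ punchIn m) a 0 ≈ - product (λ k → x m - y k)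
    residue m = begin
      ∇* (x ∘ punchIn m) a 0                   ≈⟨ ∇*-a (x ∘ punchIn m) 0 ⟩
      - B* (x ∘ punchIn m) w (n ℕ.+ 1)         ≈⟨ -‿cong (B-injective (x m) quotient (n ℕ.+ 1)) ⟩
      - B* y g (n ℕ.+ 1)                       ≈⟨ -‿cong (reflexive (≡.trans (∇*-B* y g 0) (≡.cong (B* y g) (≡.sym (ℕₚ.+-suc n 0))))) ⟨
      - ∇* y g 0                               ≈⟨ -‿cong (trans (∇*-cong y (λ r → sym (*-identityˡ (x m ^ r))) 0) (∇*-geometric y 1# (x m) 0)) ⟩
      - (1# * product (λ k → x m - y k) * 1#)  ≈⟨ -‿cong (trans (*-identityʳ _) (*-identityˡ _)) ⟩
      - product (λ k → x m - y k)              ∎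
      where
      g : Seq
      g r = x m ^ r
      B-g : ∀ r → B (x m) g r ≈ one r
      B-g zero    = refl
      B-g (suc r) = -‿inverseʳ _
      quotient : ∀ r → B (x m) (B* (x ∘ punchIn m) w) r ≈ B (x m) (B* y g) r
      quotient r = trans (B*-remove x m w r) (trans (e r)
        (trans (B*-cong y (λ k → sym (B-g k)) r) (B*-B-comm y (x m) g r)))

-- The generating series of the moments and the factorized determinant

module MomentDeterminant {c ℓ} (R : CommutativeRing c ℓ) where
  open CommutativeRing R hiding (zero)
  open BigOperators ring using (sum; product; _^_)
  open Determinant R
  open Hankel R using (Seq)
  open PowerSeries R
  open SuffixSum ring
  open DiagonalRecursion R
  private
    module RP = RingProps ring
    module ∏ = MonoidSum *-commutativeMonoid
    open SetoidReasoning setoid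
    open Solver R

  x y : Carrier → Carrier
  x l = l * (l - 1#)
  y l = l * (l + 1#)

  -- The recursion for an entry refers only to itself and to later ones, so it does not see the
  -- first variable. This makes induction on the number of variables possible.
  diagonal-tail : ∀ {n} (Λ : Row (suc n)) r κ → diagonal Λ r (suc κ) ≈ diagonal (Λ ∘ suc) r κ
  diagonal-tail Λ zero    κ = refl
  diagonal-tail Λ (suc r) κ = +-cong
    (*-congˡ (+-cong (*-congˡ (diagonal-tail Λ r κ)) (sum>-cong κ λ μ → -‿cong (+-cong (diagonal-tail Λ r μ) (diagonal-tail Λ r μ)))))
    (-‿cong (*-congˡ (diagonal-tail Λ r κ)))

  moment-tail : ∀ {n} (Λ : Row (suc n)) r →
    moment Λ r ≈ (diagonal Λ r zero + diagonal Λ r zero) + moment (Λ ∘ suc) r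
  moment-tail Λ r = trans
    (+-cong (+-congˡ (sum-cong-≋ (diagonal-tail Λ r))) (+-congˡ (sum-cong-≋ (diagonal-tail Λ r))))
    (solve 2 (λ d s → (d :+ s) :+ (d :+ s) := (d :+ d) :+ (s :+ s)) refl (diagonal Λ r zero) (sum (diagonal (Λ ∘ suc) r)))

  sum-neg-double : ∀ {n} (t : Row n) → sum (λ i → - (t i + t i)) ≈ - (sum t + sum t)
  sum-neg-double {zero}  t = solve 0 (:0 := :- (:0 :+ :0)) refl
  sum-neg-double {suc n} t = trans (+-congˡ (sum-neg-double (t ∘ suc)))
    (solve 2 (λ a s → :- (a :+ a) :+ :- (s :+ s) := :- ((a :+ s) :+ (a :+ s))) refl (t zero) (sum (t ∘ suc)))

  diagonal-head : ∀ {n} (Λ : Row (suc n)) r → diagonal Λ (suc r) zero ≈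
    x (Λ zero) * diagonal Λ r zero - Λ zero * moment (Λ ∘ suc) r
  diagonal-head Λ r = trans
    (+-congʳ (*-congˡ (+-congˡ (trans (sum-neg-double (diagonal Λ r ∘ suc))
      (-‿cong (+-cong (sum-cong-≋ (diagonal-tail Λ r)) (sum-cong-≋ (diagonal-tail Λ r))))))))
    (solve 3 (λ l d m → l :* (l :* d :+ :- m) :- l :* d := l :* (l :- :1) :* d :- l :* m)
      refl (Λ zero) (diagonal Λ r zero) (moment (Λ ∘ suc) r))

  -- The series 1 - Σ_{r ≥ 1} HC(bᵣ) zʳ = ∏ (1 - yᵢ z) / ∏ (1 - xᵢ z).
  series : ∀ {n} → Row n → Seq
  series Λ zero    = 1#
  series Λ (suc r) = - moment Λ r

  -- One variable contributes the factor (1 - y z) / (1 - x z). With l the first variable, d its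
  -- diagonal entry and m the moment of the others, the moment is 2d + m and the next entry is x d -
  -- l m. Multiplying by 1 - x z cancels d and leaves (x + 2l) m, where x + 2l = y.
  series-head : ∀ {n} (Λ : Row (suc n)) r → B (x (Λ zero)) (series Λ) r ≈ B (y (Λ zero)) (series (Λ ∘ suc)) r
  series-head Λ zero       = refl
  series-head Λ (suc zero) = trans
    (+-congʳ (-‿cong (moment-tail Λ zero)))
    (solve 2 (λ l m → :- ((l :+ l) :+ m) :- l :* (l :- :1) :* :1 := :- m :- l :* (l :+ :1) :* :1) refl
      (Λ zero) (moment (Λ ∘ suc) zero))
  series-head Λ (suc (suc r)) = trans
    (+-cong (-‿cong (trans (moment-tail Λ (suc r)) (+-congʳ (+-cong (diagonal-head Λ r) (diagonal-head Λ r)))))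
      (-‿cong (*-congˡ (-‿cong (moment-tail Λ r)))))
    (solve 4 (λ l d m m′ →
        :- (((l :* (l :- :1) :* d :- l :* m) :+ (l :* (l :- :1) :* d :- l :* m)) :+ m′) :- l :* (l :- :1) :* (:- ((d :+ d) :+ m))
        := :- m′ :- l :* (l :+ :1) :* (:- m))
      refl (Λ zero) (diagonal Λ r zero) (moment (Λ ∘ suc) r) (moment (Λ ∘ suc) (suc r)))

  series-rational : ∀ {n} (Λ : Row n) r → B* (x ∘ Λ) (series Λ) r ≈ B* (y ∘ Λ) one r
  series-rational {zero}  Λ zero    = refl
  series-rational {zero}  Λ (suc r) = solve 0 (:- (:0 :+ :0) := :0) refl
  series-rational {suc n} Λ r = begin
    B* (x ∘ Λ ∘ suc) (B (x (Λ zero)) (series Λ)) r             ≈⟨ B*-cong (x ∘ Λ ∘ suc) (series-head Λ) r ⟩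
    B* (x ∘ Λ ∘ suc) (B (y (Λ zero)) (series (Λ ∘ suc))) r     ≈⟨ B*-B-comm (x ∘ Λ ∘ suc) (y (Λ zero)) (series (Λ ∘ suc)) r ⟩
    B (y (Λ zero)) (B* (x ∘ Λ ∘ suc) (series (Λ ∘ suc))) r     ≈⟨ B-cong (y (Λ zero)) (series-rational (Λ ∘ suc)) r ⟩
    B (y (Λ zero)) (B* (y ∘ Λ ∘ suc) one) r                    ≈⟨ B*-B-comm (y ∘ Λ ∘ suc) (y (Λ zero)) one r ⟨
    B* (y ∘ Λ) one r                                           ∎

  -- The diagonal factor -1 of the full product is traded for the outer sign.
  neg-product : ∀ {n} (c : Row n) m → c m ≈ - 1# → - product c ≈ product (λ k → if does (m Finₚ.≟ k) then 1# else c k)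
  neg-product c zero e = trans (-‿cong (*-congʳ e))
    (solve 1 (λ p → :- ((:- :1) :* p) := :1 :* p) refl (product (c ∘ suc)))
  neg-product c (suc m) e = trans
    (solve 2 (λ a p → :- (a :* p) := a :* (:- p)) refl (c zero) (product (c ∘ suc)))
    (*-congˡ (neg-product (c ∘ suc) m e))

  -- Rests on l(l - 1) - k(k + 1) = (l + k)(l - k - 1). On the diagonal the second factor is -1,
  -- which absorbs the sign of each residue.
  factors : ∀ {n} (Λ : Row n) → product (λ m → - product (λ k → x (Λ m) - y (Λ k))) ≈
    product (λ i → product λ j → Λ i + Λ j)
      * product (λ i → product λ j → if does (i Finₚ.≟ j) then 1# else Λ i - Λ j - 1#)
  factors Λ = trans
    (∏.sum-cong-≋ λ m → begin
      - product (λ k → x (Λ m) - y (Λ k))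
        ≈⟨ -‿cong (∏.sum-cong-≋ λ k → solve 2 (λ l k → l :* (l :- :1) :- k :* (k :+ :1) := (l :+ k) :* (l :- k :- :1)) refl (Λ m) (Λ k)) ⟩
      - product (λ k → (Λ m + Λ k) * (Λ m - Λ k - 1#))
        ≈⟨ -‿cong (∏.∑-distrib-+ (λ k → Λ m + Λ k) (λ k → Λ m - Λ k - 1#)) ⟩
      - (product (λ k → Λ m + Λ k) * product (λ k → Λ m - Λ k - 1#))
        ≈⟨ RP.-‿distribʳ-* _ _ ⟩
      product (λ k → Λ m + Λ k) * - product (λ k → Λ m - Λ k - 1#)
        ≈⟨ *-congˡ (neg-product (λ k → Λ m - Λ k - 1#) m (solve 1 (λ l → l :- l :- :1 := :- :1) refl (Λ m))) ⟩
      product (λ k → Λ m + Λ k) * product (λ k → if does (m Finₚ.≟ k) then 1# else Λ m - Λ k - 1#) ∎)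
    (∏.∑-distrib-+ (λ m → product (λ k → Λ m + Λ k)) (λ m → product (λ k → if does (m Finₚ.≟ k) then 1# else Λ m - Λ k - 1#)))

  det-moments : ∀ {N} .{{_ : NonZero N}} (Λ : Row N) →
    det ring {N} (λ i j → moment Λ (toℕ i ℕ.+ toℕ j)) ≈ ⟨ N C 2 ⟩ *
      (product (λ i → product λ j → Λ i + Λ j)
        * product (λ i → product λ j → if does (i Finₚ.≟ j) then 1# else Λ i - Λ j - 1#))
  det-moments {suc n} Λ = begin
    det ring {suc n} (λ i j → moment Λ (toℕ i ℕ.+ toℕ j))
      ≈⟨ det-cong {suc n} (λ i j → moment Λ (toℕ i ℕ.+ toℕ j)) (λ i j → - series Λ (suc (toℕ i ℕ.+ toℕ j))) (λ i j → sym (RP.-‿involutive _)) ⟩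
    det ring {suc n} (λ i j → - series Λ (suc (toℕ i ℕ.+ toℕ j)))
      ≈⟨ det-rational-hankel (x ∘ Λ) (y ∘ Λ) (series Λ) (series-rational Λ) ⟩
    ⟨ suc n C 2 ⟩ * product (λ m → - product (λ k → x (Λ m) - y (Λ k)))
      ≈⟨ *-congˡ (factors Λ) ⟩
    ⟨ suc n C 2 ⟩ * _ ∎

  signs : ∀ n → ⟨ n ⟩ ≈ 1# ⊎ ⟨ n ⟩ ≈ - 1#
  signs zero    = inj₁ refl
  signs (suc n) with signs n
  ... | inj₁ e = inj₂ (trans (*-congˡ e) (*-identityʳ _))
  ... | inj₂ e = inj₁ (trans (*-congˡ e) (solve 0 ((:- :1) :* (:- :1) := :1) refl))

  product-neg : ∀ {n} (f : Row n) → product (λ i → - f i) ≈ ⟨ n ⟩ * product f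
  product-neg {zero}  f = sym (*-identityˡ 1#)
  product-neg {suc n} f = trans (*-congˡ (product-neg (f ∘ suc)))
    (solve 3 (λ a e p → (:- a) :* (e :* p) := ((:- :1) :* e) :* (a :* p)) refl (f zero) ⟨ n ⟩ (product (f ∘ suc)))

  product-scale : ∀ {n} s (f : Row n) → product (λ i → s * f i) ≈ s ^ n * product f
  product-scale {zero}  s f = sym (*-identityˡ 1#)
  product-scale {suc n} s f = trans (*-congˡ (product-scale s (f ∘ suc)))
    (solve 4 (λ s a e p → (s :* a) :* (e :* p) := (s :* e) :* (a :* p)) refl s (f zero) (s ^ n) (product (f ∘ suc)))

  -- (-1)^(n²) = (-1)ⁿ
  double-product-neg : ∀ {n} (u v : Row n) →
    product (λ m → product (λ k → v k - u m)) ≈ product (λ m → - product (λ k → u m - v k))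
  double-product-neg {n} u v = begin
    product (λ m → product (λ k → v k - u m))
      ≈⟨ ∏.sum-cong-≋ (λ m → trans (∏.sum-cong-≋ λ k → sym (RP.⁻¹-anti-homo‿- (u m) (v k))) (product-neg (λ k → u m - v k))) ⟩
    product (λ m → ⟨ n ⟩ * product (λ k → u m - v k))
      ≈⟨ product-scale ⟨ n ⟩ (λ m → product (λ k → u m - v k)) ⟩
    ⟨ n ⟩ ^ n * product (λ m → product (λ k → u m - v k))
      ≈⟨ *-congʳ (square (signs n)) ⟩
    ⟨ n ⟩ * product (λ m → product (λ k → u m - v k))
      ≈⟨ product-neg (λ m → product (λ k → u m - v k)) ⟨
    product (λ m → - product (λ k → u m - v k)) ∎
    where
    ^-cong : ∀ {u v} k → u ≈ v → u ^ k ≈ v ^ k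
    ^-cong zero    e = refl
    ^-cong (suc k) e = *-cong e (^-cong k e)
    1^ : ∀ k → 1# ^ k ≈ 1#
    1^ zero    = refl
    1^ (suc k) = trans (*-identityˡ _) (1^ k)
    square : ⟨ n ⟩ ≈ 1# ⊎ ⟨ n ⟩ ≈ - 1# → ⟨ n ⟩ ^ n ≈ ⟨ n ⟩
    square (inj₁ e) = trans (^-cong n e) (trans (1^ n) (sym e))
    square (inj₂ e) = ^-cong n e

-- Regular elements of polynomial rings

module RegularPolynomials {c ℓ} (R : CommutativeRing c ℓ) where
  open CommutativeRing R hiding (zero)
  open Polynomial R
  private
    module RP = RingProps ring
    module F = Fractions R
    module Fₚ = Fractions polyRing
    open SetoidReasoning setoid

  regular-resp : ∀ {d e} → d ≈ e → F.Regular d → F.Regular e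
  regular-resp d≈e rd q = rd (trans (*-congʳ d≈e) (trans q (*-congʳ (sym d≈e))))

  coeff-const-* : ∀ a p k → coeff (const a *ₚ p) k ≈ a * coeff p k
  coeff-const-* a p k = trans (coeff-+ (scale a p) (0# ∷ []) k)
    (trans (+-cong (coeff-scale a p k) (zero-coeff k)) (+-identityʳ _))
    where
    zero-coeff : ∀ k → coeff (0# ∷ []) k ≈ 0#
    zero-coeff zero    = refl
    zero-coeff (suc k) = refl

  coeff-linear-* : ∀ a b p k → coeff ((a ∷ b ∷ []) *ₚ p) (suc k) ≈ a * coeff p (suc k) + b * coeff p k
  coeff-linear-* a b p k = trans (coeff-+ (scale a p) (0# ∷ const b *ₚ p) (suc k))
    (+-cong (coeff-scale a p (suc k)) (coeff-const-* b p k))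

  regular-const : ∀ {a} → F.Regular a → Fₚ.Regular (const a)
  regular-const {a} ra {p} {q} e .coeff-≈ k =
    ra (trans (sym (coeff-const-* a p k)) (trans (e .coeff-≈ k) (coeff-const-* a q k)))

  coeff-beyond : ∀ p k → length p ℕ.≤ k → coeff p k ≈ 0#
  coeff-beyond []      k       _       = refl
  coeff-beyond (a ∷ p) (suc k) (s≤s l) = coeff-beyond p k l

  -- Coefficients are compared from the top down: beyond both lengths they vanish, and because X has
  -- coefficient 1, coefficient `suc k` of the product determines coefficient k once coefficient
  -- `suc k` of the factor is known.
  regular-monic : ∀ a → Fₚ.Regular (a ∷ 1# ∷ [])
  regular-monic a {p} {q} e .coeff-≈ k = descend (length p ℕ.+ length q) k λ j l → trans
    (coeff-beyond p j (ℕₚ.≤-trans (ℕₚ.m≤m+n (length p) (length q)) (ℕₚ.≤-trans (ℕₚ.m≤n+m _ k) l)))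
    (sym (coeff-beyond q j (ℕₚ.≤-trans (ℕₚ.m≤n+m (length q) (length p)) (ℕₚ.≤-trans (ℕₚ.m≤n+m _ k) l))))
    where
    descend : ∀ m k → (∀ j → k ℕ.+ m ℕ.≤ j → coeff p j ≈ coeff q j) → coeff p k ≈ coeff q k
    descend zero    k top = top k (ℕₚ.≤-reflexive (ℕₚ.+-identityʳ k))
    descend (suc m) k top = begin
      coeff p k                                             ≈⟨ *-identityˡ _ ⟨
      1# * coeff p k                                        ≈⟨ RP.+-cancelˡ (a * coeff p (suc k)) _ _ (begin
        a * coeff p (suc k) + 1# * coeff p k ≈⟨ coeff-linear-* a 1# p k ⟨
        coeff ((a ∷ 1# ∷ []) *ₚ p) (suc k)   ≈⟨ e .coeff-≈ (suc k) ⟩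
        coeff ((a ∷ 1# ∷ []) *ₚ q) (suc k)   ≈⟨ coeff-linear-* a 1# q k ⟩
        a * coeff q (suc k) + 1# * coeff q k ≈⟨ +-congʳ (*-congˡ next) ⟨
        a * coeff p (suc k) + 1# * coeff q k ∎) ⟩
      1# * coeff q k                                        ≈⟨ *-identityˡ _ ⟩
      coeff q k                                             ∎
      where
      next : coeff p (suc k) ≈ coeff q (suc k)
      next = descend m (suc k) λ j l → top j (ℕₚ.≤-trans (ℕₚ.≤-reflexive (ℕₚ.+-suc k m)) l)

module RegularVariables {c ℓ} (K : CommutativeRing c ℓ) where
  private
    module M n = CommutativeRing (MPoly K n)

  constant : ∀ n → CommutativeRing.Carrier K → M.Carrier n
  constant zero    a = a
  constant (suc n) a = Polynomial.const (MPoly K n) (constant n a)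

  regular-var-+ : ∀ {n} (i : Fin n) a → Fractions.Regular (MPoly K n) (M._+_ n (var K i) (constant n a))
  regular-var-+ {suc n} zero a {p} {q} = RegularPolynomials.regular-resp (MPoly K (suc n))
    {constant n a ∷ M.1# n ∷ []} {M._+_ (suc n) (var K {suc n} zero) (constant (suc n) a)}
    (Polynomial.coeffwise λ { zero → M.sym n (M.+-identityˡ n (constant n a)) ; (suc k) → M.refl n })
    (λ {p q} → RegularPolynomials.regular-monic (MPoly K n) (constant n a) {p} {q}) {p} {q}
  regular-var-+ {suc n} (suc i) a {p} {q} = RegularPolynomials.regular-const (MPoly K n)
    {M._+_ n (var K i) (constant n a)} (λ {x y} → regular-var-+ i a {x} {y}) {p} {q}

  constant-0 : ∀ n → M._≈_ n (constant n (CommutativeRing.0# K)) (M.0# n)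
  constant-0 zero    = CommutativeRing.refl K
  constant-0 (suc n) = Polynomial.coeffwise λ { zero → constant-0 n ; (suc k) → M.refl n }

  constant-1 : ∀ n → constant n (CommutativeRing.1# K) ≡ M.1# n
  constant-1 zero    = ≡.refl
  constant-1 (suc n) = ≡.cong (Polynomial.const (MPoly K n)) (constant-1 n)

  constant-neg : ∀ n a → constant n (CommutativeRing.-_ K a) ≡ M.-_ n (constant n a)
  constant-neg zero    a = ≡.refl
  constant-neg (suc n) a = ≡.cong (Polynomial.const (MPoly K n)) (constant-neg n a)

  1≉0 : ¬ CommutativeRing._≈_ K (CommutativeRing.1# K) (CommutativeRing.0# K) → ∀ n → ¬ M._≈_ n (M.1# n) (M.0# n)
  1≉0 e zero    = e
  1≉0 e (suc n) f = 1≉0 e n (Polynomial.coeff-≈ f 0)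

-- The embedding into the ring of fractions

module FractionProperties {c ℓ} (R : CommutativeRing c ℓ) where
  open Fractions R
  private
    module R = CommutativeRing R
    module F = CommutativeRing fractionRing
    open Solver R

  fromRing-cong : ∀ {a b} → a R.≈ b → fromRing a F.≈ fromRing b
  fromRing-cong e = cross (R.*-congʳ e)

  fromRing-injective : ∀ {a b} → fromRing a F.≈ fromRing b → a R.≈ b
  fromRing-injective (cross e) = R.trans (R.sym (R.*-identityʳ _)) (R.trans e (R.*-identityʳ _))

  fromRing-+ : ∀ a b → fromRing (a R.+ b) F.≈ fromRing a F.+ fromRing b
  fromRing-+ a b = cross (solve 2 (λ a b → (a :+ b) :* (:1 :* :1) := (a :* :1 :+ b :* :1) :* :1) R.refl a b)

  fromRing-* : ∀ a b → fromRing (a R.* b) F.≈ fromRing a F.* fromRing b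
  fromRing-* a b = cross (solve 2 (λ a b → (a :* b) :* (:1 :* :1) := (a :* b) :* :1) R.refl a b)

  fromRing-inverse : ∀ d → (rd : Regular d) → fromRing d F.* (R.1# / d [ rd ]) F.≈ F.1#
  fromRing-inverse d rd = cross (solve 1 (λ d → (d :* :1) :* :1 := :1 :* (:1 :* d)) R.refl d)

  fromRing-product : ∀ {n} (f : Fin n → R.Carrier) →
    fromRing (BigOperators.product R.ring f) F.≈ BigOperators.product F.ring (fromRing ∘ f)
  fromRing-product {zero}  f = F.refl {fromRing R.1#}
  fromRing-product {suc n} f = F.trans {fromRing (BigOperators.product R.ring f)}
    (fromRing-* (f zero) (BigOperators.product R.ring (f ∘ suc)))
    (F.*-congˡ {fromRing (f zero)} (fromRing-product (f ∘ suc)))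

  fromRing-power : ∀ a n → fromRing (BigOperators._^_ R.ring a n) F.≈ BigOperators._^_ F.ring (fromRing a) n
  fromRing-power a zero    = F.refl {fromRing R.1#}
  fromRing-power a (suc n) = F.trans {fromRing (a R.* BigOperators._^_ R.ring a n)}
    (fromRing-* a (BigOperators._^_ R.ring a n))
    (F.*-congˡ {fromRing a} (fromRing-power a n))

-- Resultants of products of factors 1 - b z with invertible b

module Resultant {c ℓ} (R : CommutativeRing c ℓ) where
  open CommutativeRing R hiding (zero)
  open Polynomial R
  open BigOperators ring using (product; _^_)
  open MomentDeterminant R using (product-scale)
  open RegularPolynomials R using (coeff-linear-*)
  private
    module P = CommutativeRing polyRing
    module PS = Solver polyRing
    module ∏ = MonoidSum *-commutativeMonoid
    module ∏ₚ = MonoidSum P.*-commutativeMonoid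
    productₚ = λ {n} → BigOperators.product P.ring {n}
    open SetoidReasoning setoid
    open Solver R

  factor : Carrier → Poly
  factor b = P.1# P.- const b *ₚ X

  factor-linear : ∀ b → factor b P.≈ 1# ∷ (- b) ∷ []
  factor-linear b = coeffwise λ
    { zero          → solve 1 (λ b → :1 :+ :- (b :* :0 :+ :0) := :1) refl b
    ; (suc zero)    → solve 1 (λ b → :- (b :* :1) := :- b) refl b
    ; (suc (suc k)) → refl }

  const-* : ∀ a b → const (a * b) P.≈ const a P.* const b
  const-* a b = coeffwise λ { zero → sym (+-identityʳ _) ; (suc k) → refl }

  const-product : ∀ {n} (f : Fin n → Carrier) → const (product f) P.≈ productₚ (const ∘ f)
  const-product {zero}  f = P.refl
  const-product {suc n} f = P.trans (const-* (f zero) (product (f ∘ suc))) (P.*-congˡ {const (f zero)} (const-product (f ∘ suc)))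

  coeff-product-above : ∀ {n} (b : Fin n → Carrier) k → n ℕ.< k → coeff (productₚ (factor ∘ b)) k ≈ 0#
  coeff-product-above {zero}  b (suc k) l = refl
  coeff-product-above {suc n} b (suc k) (s≤s l) = begin
    coeff (factor (b zero) *ₚ productₚ (factor ∘ b ∘ suc)) (suc k)
      ≈⟨ coeff-≈ (P.*-congʳ {productₚ (factor ∘ b ∘ suc)} (factor-linear (b zero))) (suc k) ⟩
    coeff ((1# ∷ (- b zero) ∷ []) *ₚ productₚ (factor ∘ b ∘ suc)) (suc k)
      ≈⟨ coeff-linear-* 1# (- b zero) (productₚ (factor ∘ b ∘ suc)) k ⟩
    1# * coeff (productₚ (factor ∘ b ∘ suc)) (suc k) + - b zero * coeff (productₚ (factor ∘ b ∘ suc)) k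
      ≈⟨ +-cong (*-congˡ (coeff-product-above (b ∘ suc) (suc k) (ℕₚ.m<n⇒m<1+n l))) (*-congˡ (coeff-product-above (b ∘ suc) k l)) ⟩
    1# * 0# + - b zero * 0#
      ≈⟨ trans (+-cong (zeroʳ _) (zeroʳ _)) (+-identityˡ 0#) ⟩
    0# ∎

  coeff-product-top : ∀ {n} (b : Fin n → Carrier) → coeff (productₚ (factor ∘ b)) n ≈ product (λ i → - b i)
  coeff-product-top {zero}  b = refl
  coeff-product-top {suc n} b = begin
    coeff (factor (b zero) *ₚ productₚ (factor ∘ b ∘ suc)) (suc n)
      ≈⟨ coeff-≈ (P.*-congʳ {productₚ (factor ∘ b ∘ suc)} (factor-linear (b zero))) (suc n) ⟩
    coeff ((1# ∷ (- b zero) ∷ []) *ₚ productₚ (factor ∘ b ∘ suc)) (suc n)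
      ≈⟨ coeff-linear-* 1# (- b zero) (productₚ (factor ∘ b ∘ suc)) n ⟩
    1# * coeff (productₚ (factor ∘ b ∘ suc)) (suc n) + - b zero * coeff (productₚ (factor ∘ b ∘ suc)) n
      ≈⟨ +-cong (*-congˡ (coeff-product-above (b ∘ suc) (suc n) ℕₚ.≤-refl)) (*-congˡ (coeff-product-top (b ∘ suc))) ⟩
    1# * 0# + - b zero * product (λ i → - b (suc i))
      ≈⟨ trans (+-congʳ (zeroʳ 1#)) (+-identityˡ _) ⟩
    product (λ i → - b i) ∎

  private
    module E (v : Carrier) where
      open Substitution R ring (λ a → a) (λ e → e) (λ _ _ → refl) (λ _ _ → refl) (λ _ → refl) refl refl *-comm public
      open IsHomomorphism (homomorphism {1} (λ _ → v) (λ _ _ → refl)) public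

  evaluate-substitute : ∀ p v → evaluate p v ≈ substitute R ring (λ a → a) {1} (λ _ → v) p
  evaluate-substitute []      v = refl
  evaluate-substitute (a ∷ p) v = trans (+-congˡ (*-congˡ (evaluate-substitute p v))) (sym (E.S-∷ v {0} (λ _ → v) a p))

  evaluate-product : ∀ {n} (b : Fin n → Carrier) v → evaluate (productₚ (factor ∘ b)) v ≈ product (λ i → 1# - b i * v)
  evaluate-product b v = trans (evaluate-substitute (productₚ (factor ∘ b)) v) (go b)
    where
    S : Poly → Carrier
    S = substitute R ring (λ a → a) {1} (λ _ → v)
    S-factor : ∀ b → S (factor b) ≈ 1# - b * v
    S-factor b = trans (E.cong v {factor b} (factor-linear b)) (trans (sym (evaluate-substitute (1# ∷ (- b) ∷ []) v))
      (solve 2 (λ b v → :1 :+ v :* (:- b :+ v :* :0) := :1 :- b :* v) refl b v))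
    go : ∀ {n} (b : Fin n → Carrier) → S (productₚ (factor ∘ b)) ≈ product (λ i → 1# - b i * v)
    go {zero}  b = E.homo-1 v
    go {suc n} b = trans (E.homo-* v (factor (b zero)) (productₚ (factor ∘ b ∘ suc))) (*-cong (S-factor (b zero)) (go (b ∘ suc)))

  -- The root is the inverse of the parameter, and passing to the monic factor costs -a; these costs
  -- multiply to the leading coefficient.
  factor-root : ∀ a v → a * v ≈ 1# → factor a P.≈ const (- a) *ₚ (X +ₚ (-ₚ const v))
  factor-root a v e = P.trans
    (P.+-congʳ {P.- (const a *ₚ X)} {P.1#} {const a *ₚ const v}
      (P.trans {P.1#} {const (a * v)} (coeffwise λ { zero → sym e ; (suc k) → refl }) (const-* a v)))
    (PS.solve 3 (λ a v X → a PS.:* v PS.:- a PS.:* X PS.:= (PS.:- a) PS.:* (X PS.:+ PS.:- v)) P.refl (const a) (const v) X)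

  -- An explicit inverse of the leading coefficient shows it to be nonzero, in a ring that may have
  -- zero divisors.
  product-inverse : ∀ {n} (a v : Fin n → Carrier) → (∀ i → a i * v i ≈ 1#) → product (λ i → - a i) * product (λ i → - v i) ≈ 1#
  product-inverse {zero}  a v e = *-identityˡ 1#
  product-inverse {suc n} a v e = trans
    (solve 4 (λ a v p q → (:- a :* p) :* (:- v :* q) := (a :* v) :* (p :* q)) refl (a zero) (v zero) (product (λ i → - a (suc i))) (product (λ i → - v (suc i))))
    (trans (*-cong (e zero) (product-inverse (a ∘ suc) (v ∘ suc) (e ∘ suc))) (*-identityˡ 1#))

  product-power : ∀ {n} (f : Fin n → Carrier) k → product f ^ k ≈ product (λ i → f i ^ k)
  product-power f zero    = sym (ones f)
    where
    ones : ∀ {n} (f : Fin n → Carrier) → product (λ i → f i ^ 0) ≈ 1#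
    ones {zero}  f = refl
    ones {suc n} f = trans (*-identityˡ _) (ones (f ∘ suc))
  product-power f (suc k) = trans (*-congˡ (product-power f k)) (sym (∏.∑-distrib-+ f (λ i → f i ^ k)))

  module _ (1≉0 : ¬ 1# ≈ 0#) {n} (a v b w : Fin n → Carrier)
           (av : ∀ i → a i * v i ≈ 1#) (bw : ∀ i → b i * w i ≈ 1#) where
    private
      product≉0 : ∀ (a v : Fin n → Carrier) → (∀ i → a i * v i ≈ 1#) → ¬ product (λ i → - a i) ≈ 0#
      product≉0 a v e q = 1≉0 (trans (sym (product-inverse a v e)) (trans (*-congʳ q) (zeroˡ _)))

    resultant : Carrier
    resultant = product (λ i → - a i) ^ n * product (λ k → evaluate (productₚ (factor ∘ b)) (v k))

    isResultant : IsResultant (productₚ (factor ∘ a)) (productₚ (factor ∘ b)) resultant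
    isResultant = record
      { splitting = record
        { degree = n ; leading = product (λ i → - a i) ; roots = v
        ; leading≉0 = product≉0 a v av
        ; splits = P.trans (∏ₚ.sum-cong-≋ λ i → factor-root (a i) (v i) (av i))
            (P.trans (∏ₚ.∑-distrib-+ (λ i → const (- a i)) (λ i → X +ₚ (-ₚ const (v i))))
              (P.*-congʳ {productₚ (λ i → X +ₚ (-ₚ const (v i)))} (P.sym (const-product (λ i → - a i))))) }
      ; degree-g = n
      ; hasDegree = record
        { leading≉0 = λ q → product≉0 b w bw (trans (sym (coeff-product-top b)) q)
        ; above = λ k l → coeff-product-above b k l }
      ; ρ≈ = refl }

    -- The power of the leading coefficient supplies one factor -aₘ for each pair (m , k), and -aₘ
    -- (1 - bₖ vₘ) = bₖ - aₘ because vₘ inverts aₘ.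
    resultant-product : resultant ≈ product (λ m → product (λ k → b k - a m))
    resultant-product = begin
      product (λ i → - a i) ^ n * product (λ m → evaluate (productₚ (factor ∘ b)) (v m))
        ≈⟨ *-cong (product-power (λ i → - a i) n) (∏.sum-cong-≋ λ m → evaluate-product b (v m)) ⟩
      product (λ m → (- a m) ^ n) * product (λ m → product (λ k → 1# - b k * v m))
        ≈⟨ ∏.∑-distrib-+ (λ m → (- a m) ^ n) (λ m → product (λ k → 1# - b k * v m)) ⟨
      product (λ m → (- a m) ^ n * product (λ k → 1# - b k * v m))
        ≈⟨ ∏.sum-cong-≋ (λ m → trans (sym (product-scale (- a m) (λ k → 1# - b k * v m)))
             (∏.sum-cong-≋ λ k → trans
               (solve 3 (λ a v b → :- a :* (:1 :- b :* v) := (a :* v) :* b :- a) refl (a m) (v m) (b k))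
               (+-congʳ (trans (*-congʳ (av m)) (*-identityˡ (b k)))))) ⟩
      product (λ m → product (λ k → b k - a m)) ∎

-- A representation of the enveloping algebra on words

-- With V = K^{N|N}, the map A ↦ A · Σₖ eₖ ⊗ eₖ is a 1-cocycle in V ⊗ K^N, so 𝔮 acts by affine
-- maps on V ⊗ K^N, i.e. linearly on (V ⊗ K^N) ⊕ K, and hence on the tensor powers of the
-- latter.  Words record the tensor factors lying in V ⊗ K^N.
module WordRepresentation {c ℓ} (K : CommutativeRing c ℓ) (N : ℕ) where
  open Queer K N using (I; pos; sgn; Matrix; _≈ᴹ_; _+ᴹ_; _·ᴹ_; _*ᴹ_; HasParity; [_,_]⟨_,_⟩; UTerm; 𝔮; EnvelopingRelation; linear; bracket)
  open CommutativeRing K hiding (zero)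
  open SignedSums ring N hiding (I; ⁻_; _≡ᴵ_; ⁻-involutive)
  open Presented K (Σ Matrix 𝔮) EnvelopingRelation using (_∼_)
  private
    module RP = RingProps ring
    module CS = CommSemigroupProps +-commutativeSemigroup
    open SetoidReasoning setoid
    open Solver K
    module D = Determinant K
    Σᶠ : ∀ {n} → (Fin n → Carrier) → Carrier
    Σᶠ = BigOperators.sum ring

  Letter : Set
  Letter = I × Fin N

  Word : Set
  Word = List Letter

  -- Coordinates of a tensor in the basis of words, with no finiteness imposed on the support.
  Functional : Set c
  Functional = Word → Carrier

  infix 4 _≐_
  _≐_ : Functional → Functional → Set ℓ
  f ≐ g = ∀ v → f v ≈ g v

  after : Letter → Functional → Functional
  after l f v = f (l ∷ v)

  -- The parity automorphism, applied when A moves past an odd letter.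
  twist : I → Matrix → Matrix
  twist (Sign.+ , _) A = A
  twist (Sign.- , _) A a b = σ (⟪ a ⟫ ℙ.+ ⟪ b ⟫) (A a b)

  -- The three terms are the linear action on the first letter, the creation of a first letter by
  -- the cocycle, and the action behind the first letter. Only the second one changes the tensor
  -- degree, raising it by one.
  act : Matrix → Functional → Functional
  act A f []            = 0#
  act A f ((i , k) ∷ v) =
    ΣI (λ m → A i m * f ((m , k) ∷ v)) + A i (pos k) * f v + act (twist i A) (after (i , k) f) v

  twist-cong : ∀ i {A B} → A ≈ᴹ B → twist i A ≈ᴹ twist i B
  twist-cong (Sign.+ , _) e     = e
  twist-cong (Sign.- , _) e a b = σ-cong (⟪ a ⟫ ℙ.+ ⟪ b ⟫) (e a b)

  act-cong : ∀ {A B} {f g : Functional} → A ≈ᴹ B → f ≐ g → act A f ≐ act B g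
  act-cong e h []            = refl
  act-cong e h ((i , k) ∷ v) = +-cong
    (+-cong (ΣI-cong λ m → *-cong (e i m) (h ((m , k) ∷ v))) (*-cong (e i (pos k)) (h v)))
    (act-cong (twist-cong i e) (λ u → h ((i , k) ∷ u)) v)

  σ-linear : ∀ p a b u v → σ p (a * u + b * v) ≈ a * σ p u + b * σ p v
  σ-linear 0ℙ a b u v = refl
  σ-linear 1ℙ a b u v = solve 4 (λ a b u v → :- (a :* u :+ b :* v) := a :* (:- u) :+ b :* (:- v)) refl a b u v

  twist-linear : ∀ i a b A B → twist i (a ·ᴹ A +ᴹ b ·ᴹ B) ≈ᴹ a ·ᴹ twist i A +ᴹ b ·ᴹ twist i B
  twist-linear (Sign.+ , _) a b A B x y = refl
  twist-linear (Sign.- , _) a b A B x y = σ-linear (⟪ x ⟫ ℙ.+ ⟪ y ⟫) a b (A x y) (B x y)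

  ΣI-linear : ∀ a b (f g : I → Carrier) → ΣI (λ m → a * f m + b * g m) ≈ a * ΣI f + b * ΣI g
  ΣI-linear a b f g = trans (ΣI-+ (λ m → a * f m) (λ m → b * g m)) (sym (+-cong (ΣI-*ˡ a f) (ΣI-*ˡ b g)))

  act-linearˡ : ∀ a b A B f v → act (a ·ᴹ A +ᴹ b ·ᴹ B) f v ≈ a * act A f v + b * act B f v
  act-linearˡ a b A B f [] = sym (trans (+-cong (zeroʳ a) (zeroʳ b)) (+-identityˡ 0#))
  act-linearˡ a b A B f ((i , k) ∷ v) = trans
    (+-cong (+-cong
        (trans (ΣI-cong λ m → solve 5 (λ a b x y f → (a :* x :+ b :* y) :* f := a :* (x :* f) :+ b :* (y :* f)) refl a b (A i m) (B i m) (f ((m , k) ∷ v)))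
          (ΣI-linear a b (λ m → A i m * f ((m , k) ∷ v)) (λ m → B i m * f ((m , k) ∷ v))))
        refl)
      (trans (act-cong (twist-linear i a b A B) (λ _ → refl) v) (act-linearˡ a b (twist i A) (twist i B) (after (i , k) f) v)))
    (solve 9 (λ a b s t x y f p q →
        (a :* s :+ b :* t) :+ (a :* x :+ b :* y) :* f :+ (a :* p :+ b :* q) := a :* (s :+ x :* f :+ p) :+ b :* (t :+ y :* f :+ q))
      refl a b (ΣI λ m → A i m * f ((m , k) ∷ v)) (ΣI λ m → B i m * f ((m , k) ∷ v)) (A i (pos k)) (B i (pos k)) (f v)
      (act (twist i A) (after (i , k) f) v) (act (twist i B) (after (i , k) f) v))

  act-linearʳ : ∀ a b A f g v → act A (λ u → a * f u + b * g u) v ≈ a * act A f v + b * act A g v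
  act-linearʳ a b A f g [] = sym (trans (+-cong (zeroʳ a) (zeroʳ b)) (+-identityˡ 0#))
  act-linearʳ a b A f g ((i , k) ∷ v) = trans
    (+-cong (+-cong
        (trans (ΣI-cong λ m → solve 5 (λ a b x f g → x :* (a :* f :+ b :* g) := a :* (x :* f) :+ b :* (x :* g)) refl a b (A i m) (f ((m , k) ∷ v)) (g ((m , k) ∷ v)))
          (ΣI-linear a b (λ m → A i m * f ((m , k) ∷ v)) (λ m → A i m * g ((m , k) ∷ v))))
        refl)
      (act-linearʳ a b (twist i A) (after (i , k) f) (after (i , k) g) v))
    (solve 9 (λ a b s t x f g p q →
        (a :* s :+ b :* t) :+ x :* (a :* f :+ b :* g) :+ (a :* p :+ b :* q) := a :* (s :+ x :* f :+ p) :+ b :* (t :+ x :* g :+ q))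
      refl a b (ΣI λ m → A i m * f ((m , k) ∷ v)) (ΣI λ m → A i m * g ((m , k) ∷ v)) (A i (pos k)) (f v) (g v)
      (act (twist i A) (after (i , k) f) v) (act (twist i A) (after (i , k) g) v))

  ⟦_⟧ : UTerm → Functional → Functional
  ⟦ scalar a ⟧ f v      = a * f v
  ⟦ gen (A , _) ⟧ f     = act A f
  ⟦ plus s t ⟧ f v      = ⟦ s ⟧ f v + ⟦ t ⟧ f v
  ⟦ times s t ⟧ f       = ⟦ s ⟧ (⟦ t ⟧ f)
  ⟦ minus s ⟧ f v       = - ⟦ s ⟧ f v

  ⟦⟧-cong : ∀ s {f g} → f ≐ g → ⟦ s ⟧ f ≐ ⟦ s ⟧ g
  ⟦⟧-cong (scalar a)  e v = *-congˡ (e v)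
  ⟦⟧-cong (gen (A , _)) e = act-cong (λ _ _ → refl) e
  ⟦⟧-cong (plus s t)  e v = +-cong (⟦⟧-cong s e v) (⟦⟧-cong t e v)
  ⟦⟧-cong (times s t) e   = ⟦⟧-cong s (⟦⟧-cong t e)
  ⟦⟧-cong (minus s)   e v = -‿cong (⟦⟧-cong s e v)

  Linear : (Functional → Functional) → Set (c Level.⊔ ℓ)
  Linear T = ∀ a b f g v → T (λ u → a * f u + b * g u) v ≈ a * T f v + b * T g v

  ⟦⟧-linear : ∀ s → Linear ⟦ s ⟧
  ⟦⟧-linear (scalar x) a b f g v = solve 5 (λ x a b f g → x :* (a :* f :+ b :* g) := a :* (x :* f) :+ b :* (x :* g)) refl x a b (f v) (g v)
  ⟦⟧-linear (gen (A , _)) a b f g = act-linearʳ a b A f g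
  ⟦⟧-linear (plus s t) a b f g v = trans (+-cong (⟦⟧-linear s a b f g v) (⟦⟧-linear t a b f g v))
    (solve 6 (λ a b p q r s → (a :* p :+ b :* q) :+ (a :* r :+ b :* s) := a :* (p :+ r) :+ b :* (q :+ s)) refl
      a b (⟦ s ⟧ f v) (⟦ s ⟧ g v) (⟦ t ⟧ f v) (⟦ t ⟧ g v))
  ⟦⟧-linear (times s t) a b f g v = trans (⟦⟧-cong s (⟦⟧-linear t a b f g) v) (⟦⟧-linear s a b (⟦ t ⟧ f) (⟦ t ⟧ g) v)
  ⟦⟧-linear (minus s) a b f g v = trans (-‿cong (⟦⟧-linear s a b f g v))
    (solve 4 (λ a b p q → :- (a :* p :+ b :* q) := a :* (:- p) :+ b :* (:- q)) refl a b (⟦ s ⟧ f v) (⟦ s ⟧ g v))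

  act-linear : ∀ A → Linear (act A)
  act-linear A a b = act-linearʳ a b A

  module _ {T : Functional → Functional} (T-cong : ∀ {f g} → f ≐ g → T f ≐ T g) (T-linear : Linear T) where
    linear-+ : ∀ f g v → T (λ u → f u + g u) v ≈ T f v + T g v
    linear-+ f g v = trans (T-cong (λ u → sym (+-cong (*-identityˡ _) (*-identityˡ _))) v)
      (trans (T-linear 1# 1# f g v) (+-cong (*-identityˡ _) (*-identityˡ _)))

    linear-* : ∀ a f v → T (λ u → a * f u) v ≈ a * T f v
    linear-* a f v = trans (T-cong (λ u → sym (trans (+-congˡ (zeroˡ _)) (+-identityʳ _))) v)
      (trans (T-linear a 0# f f v) (trans (+-congˡ (zeroˡ _)) (+-identityʳ _)))

    linear-ΣI : ∀ (a : I → Carrier) (f : I → Functional) v → T (λ u → ΣI λ m → a m * f m u) v ≈ ΣI λ m → a m * T (f m) v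
    linear-ΣI a f v = trans (linear-+ (λ u → Σᶠ λ k → a (Sign.- , k) * f (Sign.- , k) u) (λ u → Σᶠ λ k → a (Sign.+ , k) * f (Sign.+ , k) u) v)
      (+-cong (linear-sum (λ k → a (Sign.- , k)) (λ k → f (Sign.- , k)) v) (linear-sum (λ k → a (Sign.+ , k)) (λ k → f (Sign.+ , k)) v))
      where
      linear-sum : ∀ {n} (a : Fin n → Carrier) (f : Fin n → Functional) v →
        T (λ u → Σᶠ λ k → a k * f k u) v ≈ Σᶠ λ k → a k * T (f k) v
      linear-sum {zero}  a f v = trans (T-cong (λ u → sym (zeroˡ 0#)) v) (trans (linear-* 0# (λ _ → 0#) v) (zeroˡ _))
      linear-sum {suc n} a f v = trans (linear-+ (λ u → a zero * f zero u) (λ u → Σᶠ λ k → a (suc k) * f (suc k) u) v)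
        (+-cong (linear-* (a zero) (f zero) v) (linear-sum (a ∘ suc) (f ∘ suc) v))

  ΣI-comm : ∀ (f : I → I → Carrier) → ΣI (λ m → ΣI λ n → f m n) ≈ ΣI (λ n → ΣI λ m → f m n)
  ΣI-comm f = trans
    (+-cong (D.∑-distrib-+ (λ m → Σᶠ λ n → f (Sign.- , m) (Sign.- , n)) (λ m → Σᶠ λ n → f (Sign.- , m) (Sign.+ , n)))
            (D.∑-distrib-+ (λ m → Σᶠ λ n → f (Sign.+ , m) (Sign.- , n)) (λ m → Σᶠ λ n → f (Sign.+ , m) (Sign.+ , n))))
    (trans (+-cong (+-cong (D.∑-comm (λ m n → f (Sign.- , m) (Sign.- , n))) (D.∑-comm (λ m n → f (Sign.- , m) (Sign.+ , n))))
                   (+-cong (D.∑-comm (λ m n → f (Sign.+ , m) (Sign.- , n))) (D.∑-comm (λ m n → f (Sign.+ , m) (Sign.+ , n)))))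
    (trans (CS.interchange _ _ _ _)
      (sym (+-cong (D.∑-distrib-+ (λ n → Σᶠ λ m → f (Sign.- , m) (Sign.- , n)) (λ n → Σᶠ λ m → f (Sign.+ , m) (Sign.- , n)))
                   (D.∑-distrib-+ (λ n → Σᶠ λ m → f (Sign.- , m) (Sign.+ , n)) (λ n → Σᶠ λ m → f (Sign.+ , m) (Sign.+ , n)))))))

  sgn-σ : ∀ p u → sgn p * u ≈ σ p u
  sgn-σ 0ℙ u = *-identityˡ u
  sgn-σ 1ℙ u = RP.-1*x≈-x u

  sgn² : ∀ p u → sgn p * (sgn p * u) ≈ u
  sgn² p u = trans (sgn-σ p _) (trans (σ-cong p (sgn-σ p u)) (trans (σ-σ p p u) (even p)))
    where
    even : ∀ p → σ (p ℙ.+ p) u ≈ u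
    even 0ℙ = refl
    even 1ℙ = refl

  twist-homogeneous : ∀ {p A} i → HasParity p A → twist i A ≈ᴹ sgn (⟪ i ⟫ ℙ.* p) ·ᴹ A
  twist-homogeneous (Sign.+ , _) h a b = sym (*-identityˡ _)
  twist-homogeneous {p} {A} (Sign.- , _) h a b with ⟪ a ⟫ ℙ.+ ⟪ b ⟫ ℙₚ.≟ p
  ... | yes e = trans (σ-≡ (A a b) e) (sym (sgn-σ p _))
  ... | no ¬e = trans (σ-cong (⟪ a ⟫ ℙ.+ ⟪ b ⟫) (h a b ¬e)) (trans (σ-0 (⟪ a ⟫ ℙ.+ ⟪ b ⟫)) (sym (trans (*-congˡ (h a b ¬e)) (zeroʳ _))))

  twist-parity : ∀ {p A} i → HasParity p A → HasParity p (twist i A)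
  twist-parity (Sign.+ , _) h = h
  twist-parity (Sign.- , _) h a b e = trans (σ-cong (⟪ a ⟫ ℙ.+ ⟪ b ⟫) (h a b e)) (σ-0 (⟪ a ⟫ ℙ.+ ⟪ b ⟫))

  twist-*ᴹ : ∀ i A B → twist i A *ᴹ twist i B ≈ᴹ twist i (A *ᴹ B)
  twist-*ᴹ (Sign.+ , _) A B a b = refl
  twist-*ᴹ (Sign.- , _) A B a b = trans
    (ΣI-cong λ m → begin
      σ (⟪ a ⟫ ℙ.+ ⟪ m ⟫) (A a m) * σ (⟪ m ⟫ ℙ.+ ⟪ b ⟫) (B m b)
        ≈⟨ trans (σ-*ˡ (⟪ a ⟫ ℙ.+ ⟪ m ⟫) _ _) (σ-cong (⟪ a ⟫ ℙ.+ ⟪ m ⟫) (σ-*ʳ (⟪ m ⟫ ℙ.+ ⟪ b ⟫) _ _)) ⟩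
      σ (⟪ a ⟫ ℙ.+ ⟪ m ⟫) (σ (⟪ m ⟫ ℙ.+ ⟪ b ⟫) (A a m * B m b))
        ≈⟨ trans (σ-σ (⟪ a ⟫ ℙ.+ ⟪ m ⟫) (⟪ m ⟫ ℙ.+ ⟪ b ⟫) _) (σ-≡ _ (middle ⟪ a ⟫ ⟪ m ⟫ ⟪ b ⟫)) ⟩
      σ (⟪ a ⟫ ℙ.+ ⟪ b ⟫) (A a m * B m b) ∎)
    (sym (ΣI-σ (⟪ a ⟫ ℙ.+ ⟪ b ⟫) (λ m → A a m * B m b)))

  twist-bracket : ∀ i A B p q → [ twist i A , twist i B ]⟨ p , q ⟩ ≈ᴹ twist i [ A , B ]⟨ p , q ⟩
  twist-bracket i A B p q a b = trans
    (+-cong (trans (twist-*ᴹ i A B a b) (sym (*-identityˡ _))) (*-congˡ (twist-*ᴹ i B A a b)))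
    (trans (sym (twist-linear i 1# (- sgn (p ℙ.* q)) (A *ᴹ B) (B *ᴹ A) a b))
      (twist-cong i (λ x y → +-congʳ (*-identityˡ _)) a b))

  -- An entry `A i m` vanishes unless the parities of i and m differ by p; the twists of B by m and
  -- by i then differ exactly by the sign of p times q.
  act-twist-swap : ∀ {p q A B} → HasParity p A → HasParity q B → ∀ i m g v →
    A i m * act (twist m B) g v ≈ sgn (p ℙ.* q) * (A i m * act (twist i B) g v)
  act-twist-swap {p} {q} {A} {B} hA hB i m g v with ⟪ i ⟫ ℙ.+ ⟪ m ⟫ ℙₚ.≟ p
  ... | no ¬e = trans (trans (*-congʳ (hA i m ¬e)) (zeroˡ _))
    (sym (trans (*-congˡ (trans (*-congʳ (hA i m ¬e)) (zeroˡ _))) (zeroʳ _)))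
  ... | yes ≡.refl = begin
    A i m * act (twist m B) g v
      ≈⟨ *-congˡ (twisted m) ⟩
    A i m * σ (⟪ m ⟫ ℙ.* q) (act B g v)
      ≈⟨ *-congˡ (trans (σ-≡ _ (sign ⟪ i ⟫ ⟪ m ⟫ q)) (sym (σ-σ ((⟪ i ⟫ ℙ.+ ⟪ m ⟫) ℙ.* q) (⟪ i ⟫ ℙ.* q) _))) ⟩
    A i m * σ ((⟪ i ⟫ ℙ.+ ⟪ m ⟫) ℙ.* q) (σ (⟪ i ⟫ ℙ.* q) (act B g v))
      ≈⟨ trans (σ-*ʳ ((⟪ i ⟫ ℙ.+ ⟪ m ⟫) ℙ.* q) _ _) (σ-cong ((⟪ i ⟫ ℙ.+ ⟪ m ⟫) ℙ.* q) (*-congˡ (sym (twisted i)))) ⟩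
    σ ((⟪ i ⟫ ℙ.+ ⟪ m ⟫) ℙ.* q) (A i m * act (twist i B) g v)
      ≈⟨ sgn-σ ((⟪ i ⟫ ℙ.+ ⟪ m ⟫) ℙ.* q) _ ⟨
    sgn ((⟪ i ⟫ ℙ.+ ⟪ m ⟫) ℙ.* q) * (A i m * act (twist i B) g v) ∎
    where
    twisted : ∀ m → act (twist m B) g v ≈ σ (⟪ m ⟫ ℙ.* q) (act B g v)
    twisted m = trans (act-cong {g = g} (λ a b → trans (twist-homogeneous m hB a b) (sym (trans (+-congˡ (zeroˡ (B a b))) (+-identityʳ _)))) (λ _ → refl) v)
      (trans (act-linearˡ (sgn (⟪ m ⟫ ℙ.* q)) 0# B B g v) (trans (+-congˡ (zeroˡ _)) (trans (+-identityʳ _) (sgn-σ (⟪ m ⟫ ℙ.* q) _))))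
    sign : ∀ i m q → m ℙ.* q ≡ ((i ℙ.+ m) ℙ.* q) ℙ.+ (i ℙ.* q)
    sign 0ℙ 0ℙ q = ≡.refl
    sign 0ℙ 1ℙ 0ℙ = ≡.refl
    sign 0ℙ 1ℙ 1ℙ = ≡.refl
    sign 1ℙ 0ℙ 0ℙ = ≡.refl
    sign 1ℙ 0ℙ 1ℙ = ≡.refl
    sign 1ℙ 1ℙ q = ≡.refl

  -- In `T₁` and `T₂` both matrices hit the first letter, in `T₃` and `T₄` only A does, in `T₅` and
  -- `T₆` only B does, and in `T₇` neither. In `T₂`, `T₄` and `T₆` the first letter is created, in
  -- the other three of these it is transformed.
  module Composite (A B : Matrix) (f : Functional) (i : I) (k : Fin N) (v : Word) where
    next : I → Functional
    next m = after (m , k) f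
    T₁ T₂ T₃ T₄ T₅ T₆ T₇ : Carrier
    T₁ = ΣI λ n → (A *ᴹ B) i n * next n v
    T₂ = (A *ᴹ B) i (pos k) * f v
    T₃ = ΣI λ m → A i m * act (twist m B) (next m) v
    T₄ = A i (pos k) * act B f v
    T₅ = ΣI λ m → B i m * act (twist i A) (next m) v
    T₆ = B i (pos k) * act (twist i A) f v
    T₇ = act (twist i A) (act (twist i B) (next i)) v

    composite : act A (act B f) ((i , k) ∷ v) ≈ (T₁ + T₂ + T₃) + T₄ + (T₅ + T₆ + T₇)
    composite = +-cong (+-congʳ (begin
      ΣI (λ m → A i m * (ΣI (λ n → B m n * next n v) + B m (pos k) * f v + act (twist m B) (next m) v))
        ≈⟨ ΣI-cong (λ m → trans (distribˡ (A i m) _ (act (twist m B) (next m) v)) (+-congʳ (trans (distribˡ (A i m) _ (B m (pos k) * f v))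
             (+-cong (ΣI-*ˡ (A i m) (λ n → B m n * next n v)) (sym (*-assoc (A i m) (B m (pos k)) (f v))))))) ⟩
      ΣI (λ m → ΣI (λ n → A i m * (B m n * next n v)) + A i m * B m (pos k) * f v + A i m * act (twist m B) (next m) v)
        ≈⟨ trans (ΣI-+ (λ m → ΣI (λ n → A i m * (B m n * next n v)) + A i m * B m (pos k) * f v) (λ m → A i m * act (twist m B) (next m) v))
             (+-congʳ (ΣI-+ (λ m → ΣI (λ n → A i m * (B m n * next n v))) (λ m → A i m * B m (pos k) * f v))) ⟩
      ΣI (λ m → ΣI (λ n → A i m * (B m n * next n v))) + ΣI (λ m → A i m * B m (pos k) * f v) + T₃
        ≈⟨ +-congʳ (+-cong
             (trans (ΣI-comm (λ m n → A i m * (B m n * next n v))) (ΣI-cong λ n → trans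
               (ΣI-cong λ m → sym (*-assoc (A i m) (B m n) (next n v))) (sym (ΣI-*ʳ (next n v) (λ m → A i m * B m n)))))
             (sym (ΣI-*ʳ (f v) (λ m → A i m * B m (pos k))))) ⟩
      T₁ + T₂ + T₃ ∎))
      (trans (linear-+ (act-cong λ _ _ → refl) (act-linear (twist i A)) (λ u → ΣI (λ m → B i m * next m u) + B i (pos k) * f u) (act (twist i B) (next i)) v)
        (+-congʳ (trans (linear-+ (act-cong λ _ _ → refl) (act-linear (twist i A)) (λ u → ΣI (λ m → B i m * next m u)) (λ u → B i (pos k) * f u) v)
          (+-cong (linear-ΣI (act-cong λ _ _ → refl) (act-linear (twist i A)) (B i) next v)
                  (linear-* (act-cong λ _ _ → refl) (act-linear (twist i A)) (B i (pos k)) f v)))))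

  -- The terms with both matrices on the first letter give the bracket there. The mixed terms `T₃`,
  -- `T₄` of one order are, up to the sign, `T₅`, `T₆` of the other order, and conversely. `T₇` is
  -- the claim for a shorter word.
  act-bracket : ∀ {A B} p q → HasParity p A → HasParity q B → ∀ f v →
    act A (act B f) v ≈ act [ A , B ]⟨ p , q ⟩ f v + sgn (p ℙ.* q) * act B (act A f) v
  act-bracket p q hA hB f [] = sym (trans (+-identityˡ _) (zeroʳ _))
  act-bracket {A} {B} p q hA hB f ((i , k) ∷ v) = begin
    act A (act B f) ((i , k) ∷ v)
      ≈⟨ AB.composite ⟩
    (AB.T₁ + AB.T₂ + AB.T₃) + AB.T₄ + (AB.T₅ + AB.T₆ + AB.T₇)
      ≈⟨ +-cong (+-cong (+-cong (+-cong first (split i (pos k) (f v))) (trans (ΣI-cong λ m → act-twist-swap hA hB i m (AB.next m) v)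
             (sym (ΣI-*ˡ s (λ m → A i m * act (twist i B) (AB.next m) v)))))
           (act-twist-swap hA hB i (pos k) f v))
         (+-cong (+-cong (trans (ΣI-cong λ m → back i m (AB.next m))
             (sym (ΣI-*ˡ s (λ m → B i m * act (twist m A) (AB.next m) v)))) (back i (pos k) f))
           (trans (act-bracket p q (twist-parity i hA) (twist-parity i hB) (AB.next i) v)
             (+-congʳ (act-cong (twist-bracket i A B p q) (λ _ → refl) v)))) ⟩
    ((C₁ + s * BA.T₁) + (C₂ + s * BA.T₂) + s * BA.T₅) + s * BA.T₆ + (s * BA.T₃ + s * BA.T₄ + (C₃ + s * BA.T₇))
      ≈⟨ solve 11 (λ s c₁ c₂ c₃ t₁ t₂ t₃ t₄ t₅ t₆ t₇ →
           ((c₁ :+ s :* t₁) :+ (c₂ :+ s :* t₂) :+ s :* t₅) :+ s :* t₆ :+ (s :* t₃ :+ s :* t₄ :+ (c₃ :+ s :* t₇))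
             := (c₁ :+ c₂ :+ c₃) :+ s :* ((t₁ :+ t₂ :+ t₃) :+ t₄ :+ (t₅ :+ t₆ :+ t₇)))
           refl s C₁ C₂ C₃ BA.T₁ BA.T₂ BA.T₃ BA.T₄ BA.T₅ BA.T₆ BA.T₇ ⟩
    (C₁ + C₂ + C₃) + s * ((BA.T₁ + BA.T₂ + BA.T₃) + BA.T₄ + (BA.T₅ + BA.T₆ + BA.T₇))
      ≈⟨ +-congˡ (*-congˡ BA.composite) ⟨
    act W f ((i , k) ∷ v) + s * act B (act A f) ((i , k) ∷ v) ∎
    where
    module AB = Composite A B f i k v
    module BA = Composite B A f i k v
    s = sgn (p ℙ.* q)
    W = [ A , B ]⟨ p , q ⟩
    C₁ = ΣI λ n → W i n * AB.next n v
    C₂ = W i (pos k) * f v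
    C₃ = act (twist i W) (AB.next i) v
    split : ∀ i n u → (A *ᴹ B) i n * u ≈ W i n * u + s * ((B *ᴹ A) i n * u)
    split i n u = solve 4 (λ x y s u → x :* u := (x :+ (:- s) :* y) :* u :+ s :* (y :* u)) refl ((A *ᴹ B) i n) ((B *ᴹ A) i n) s u
    first : AB.T₁ ≈ C₁ + s * BA.T₁
    first = trans (ΣI-cong λ n → split i n (AB.next n v))
      (trans (ΣI-+ (λ n → W i n * AB.next n v) (λ n → s * ((B *ᴹ A) i n * AB.next n v)))
        (+-congˡ (sym (ΣI-*ˡ s (λ n → (B *ᴹ A) i n * AB.next n v)))))
    back : ∀ i m g → B i m * act (twist i A) g v ≈ s * (B i m * act (twist m A) g v)
    back i m g = trans (sym (sgn² (q ℙ.* p) _)) (trans (*-congˡ (sym (act-twist-swap hB hA i m g v)))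
      (*-congʳ (reflexive (≡.cong sgn (ℙₚ.*-comm q p)))))

  sound : ∀ {s t} → s ∼ t → ∀ f → ⟦ s ⟧ f ≐ ⟦ t ⟧ f
  sound (_∼_.relation (linear {A} {B} _ _ _ a b e)) f v = trans (act-cong e (λ _ → refl) v) (act-linearˡ a b A B f v)
  sound (_∼_.relation (bracket {A} {B} _ _ _ p q hA hB e)) f v = trans
    (+-congʳ (act-bracket p q hA hB f v))
    (trans (solve 2 (λ c s → c :+ s :+ :- s := c) refl (act [ A , B ]⟨ p , q ⟩ f v) (sgn (p ℙ.* q) * act B (act A f) v))
      (act-cong (λ a b → sym (e a b)) (λ _ → refl) v))
  sound _∼_.∼-refl f v = refl
  sound (_∼_.∼-sym e) f v = sym (sound e f v)
  sound (_∼_.∼-trans e e′) f v = trans (sound e f v) (sound e′ f v)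
  sound (_∼_.plus-cong e e′) f v = +-cong (sound e f v) (sound e′ f v)
  sound (_∼_.times-cong {s} {s′} {t} e e′) f v = trans (sound e (⟦ t ⟧ f) v) (⟦⟧-cong s′ (sound e′ f) v)
  sound (_∼_.minus-cong e) f v = -‿cong (sound e f v)
  sound (_∼_.plus-assoc s t u) f v = +-assoc _ _ _
  sound (_∼_.plus-comm s t) f v = +-comm _ _
  sound (_∼_.plus-zero s) f v = trans (+-congˡ (zeroˡ _)) (+-identityʳ _)
  sound (_∼_.plus-minus s) f v = trans (-‿inverseʳ _) (sym (zeroˡ _))
  sound (_∼_.times-assoc s t u) f v = refl
  sound (_∼_.times-one s) f v = *-identityˡ _
  sound (_∼_.distribˡ s t u) f v = linear-+ (⟦⟧-cong s) (⟦⟧-linear s) (⟦ t ⟧ f) (⟦ u ⟧ f) v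
  sound (_∼_.distribʳ s t u) f v = refl
  sound (_∼_.scalar-cong e) f v = *-congʳ e
  sound (_∼_.scalar-plus a b) f v = distribʳ _ _ _
  sound (_∼_.scalar-times a b) f v = *-assoc _ _ _
  sound (_∼_.scalar-comm a s) f v = sym (linear-* (⟦⟧-cong s) (⟦⟧-linear s) a f v)

module RisingFactorials {c ℓ} (K : CommutativeRing c ℓ) where
  open CommutativeRing K hiding (zero)

  natural : ℕ → Carrier
  natural zero    = 0#
  natural (suc n) = 1# + natural n

  -- (d + r)! / r!
  rising : ℕ → ℕ → Carrier
  rising zero    r = 1#
  rising (suc d) r = natural (suc (d ℕ.+ r)) * rising d r

  rising-+ : ∀ d e r → rising (d ℕ.+ e) r ≈ rising d (e ℕ.+ r) * rising e r
  rising-+ zero    e r = sym (*-identityˡ _)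
  rising-+ (suc d) e r = trans
    (*-cong (reflexive (≡.cong (natural ∘ suc) (ℕₚ.+-assoc d e r))) (rising-+ d e r)) (sym (*-assoc _ _ _))

-- Symbols read off from the top tensor degree

module Symbols {c ℓ} (K : CommutativeRing c ℓ) (N : ℕ) (a : Fin N → CommutativeRing.Carrier K) where
  private
    module Q = Queer K N
    module U = Ring Q.U
    module En = Enveloping K N
  open Q using (I; pos; Matrix; UTerm; Fᵁ; 𝔮)
  open WordRepresentation K N
  open CommutativeRing K hiding (zero)
  open SignedSums ring N hiding (I; ⁻_; _≡ᴵ_; ⁻-involutive)
  open BigOperators ring using (sum; _^_)
  open RisingFactorials K
  private
    module RP = RingProps ring
    module D = Determinant K
    open SetoidReasoning setoid
    open Solver K

  VanishesFrom : ℕ → Functional → Set ℓ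
  VanishesFrom r f = ∀ v → r ℕ.≤ length v → f v ≈ 0#

  -- A tensor of degree below r is sent to one of degree below r + 1, since a generator creates at
  -- most one letter.
  vanishes-act : ∀ A {r f} → VanishesFrom r f → VanishesFrom (suc r) (act A f)
  vanishes-act A {r} {f} h []            l = refl
  vanishes-act A {r} {f} h ((i , k) ∷ v) (s≤s l) = trans (+-cong (trans (+-cong
      (trans (ΣI-cong λ m → trans (*-congˡ {A i m} (h ((m , k) ∷ v) (ℕₚ.m≤n⇒m≤1+n l))) (zeroʳ (A i m))) ΣI-0)
      (trans (*-congˡ {A i (pos k)} (h v l)) (zeroʳ _))) (+-identityˡ 0#))
      (rest v l))
    (+-identityˡ 0#)
    where
    rest : ∀ v → r ℕ.≤ length v → act (twist i A) (after (i , k) f) v ≈ 0#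
    rest []      l = refl
    -- Fixing the first letter lowers the bound by one; `ℕ.pred` also covers the bound zero, where
    -- all of f vanishes.
    rest (x ∷ v) l = vanishes-act (twist i A) {ℕ.pred r} (λ u q → h ((i , k) ∷ u) (pred-≤ q)) (x ∷ v) (pred-< l)
      where
      pred-≤ : ∀ {r n} → ℕ.pred r ℕ.≤ n → r ℕ.≤ suc n
      pred-≤ {zero}  q = z≤n
      pred-≤ {suc r} q = s≤s q
      pred-< : ∀ {r n} → r ℕ.≤ suc n → suc (ℕ.pred r) ℕ.≤ suc n
      pred-< {zero}  q = s≤s z≤n
      pred-< {suc r} q = q

  _∙_ : Functional → Fin N → Functional
  f ∙ k = after (pos k , k) f

  -- Evaluation of the part of degree r, regarded as a symmetric tensor, at diag(a).
  evaluation : ℕ → Functional → Carrier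
  evaluation zero    f = f []
  evaluation (suc r) f = sum λ k → a k * evaluation r (f ∙ k)

  evaluation-cong : ∀ r {f g : Functional} → (∀ v → length v ≡ r → f v ≈ g v) → evaluation r f ≈ evaluation r g
  evaluation-cong zero    e = e [] ≡.refl
  evaluation-cong (suc r) e = D.sum-cong-≋ λ k → *-congˡ {a k} (evaluation-cong r λ v q → e ((pos k , k) ∷ v) (≡.cong suc q))

  evaluation-linear : ∀ r x y f g → evaluation r (λ v → x * f v + y * g v) ≈ x * evaluation r f + y * evaluation r g
  evaluation-linear zero    x y f g = refl
  evaluation-linear (suc r) x y f g = begin
    sum (λ k → a k * evaluation r (λ v → x * f ((pos k , k) ∷ v) + y * g ((pos k , k) ∷ v)))
      ≈⟨ D.sum-cong-≋ (λ k → trans (*-congˡ {a k} (evaluation-linear r x y (f ∙ k) (g ∙ k)))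
           (solve 5 (λ a x y p q → a :* (x :* p :+ y :* q) := x :* (a :* p) :+ y :* (a :* q)) refl
             (a k) x y (evaluation r (f ∙ k)) (evaluation r (g ∙ k)))) ⟩
    sum (λ k → x * (a k * evaluation r (f ∙ k)) + y * (a k * evaluation r (g ∙ k)))
      ≈⟨ D.∑-distrib-+ (λ k → x * (a k * evaluation r (f ∙ k))) (λ k → y * (a k * evaluation r (g ∙ k))) ⟩
    sum (λ k → x * (a k * evaluation r (f ∙ k))) + sum (λ k → y * (a k * evaluation r (g ∙ k)))
      ≈⟨ +-cong (D.*-distribˡ-sum x (λ k → a k * evaluation r (f ∙ k))) (D.*-distribˡ-sum y (λ k → a k * evaluation r (g ∙ k))) ⟨
    x * evaluation (suc r) f + y * evaluation (suc r) g ∎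

  α : Matrix → Carrier
  α A = sum λ k → a k * A (pos k) (pos k)

  -- In top degree only the creation of a letter counts. It can happen at r + 1 positions, each
  -- contributing `α A`, and no signs arise because `evaluation` reads even letters only. Iteration
  -- accumulates these counts into `rising`.
  evaluation-act : ∀ A r f → VanishesFrom (suc r) f →
    evaluation (suc r) (act A f) ≈ natural (suc r) * (α A * evaluation r f)
  evaluation-act A r f h = begin
    sum (λ k → a k * evaluation r (λ v → act A f ((pos k , k) ∷ v)))
      ≈⟨ D.sum-cong-≋ (λ k → *-congˡ {a k} (trans
           (evaluation-cong r λ v q → top k v q)
           (trans (evaluation-linear r (A (pos k) (pos k)) 1# f (act A (f ∙ k))) (+-congˡ (*-identityˡ _))))) ⟩
    sum (λ k → a k * (A (pos k) (pos k) * evaluation r f + evaluation r (act A (f ∙ k))))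
      ≈⟨ D.sum-cong-≋ (λ k → trans (distribˡ (a k) _ _) (+-congʳ (sym (*-assoc _ _ _)))) ⟩
    sum (λ k → a k * A (pos k) (pos k) * evaluation r f + a k * evaluation r (act A (f ∙ k)))
      ≈⟨ D.∑-distrib-+ (λ k → a k * A (pos k) (pos k) * evaluation r f) (λ k → a k * evaluation r (act A (f ∙ k))) ⟩
    sum (λ k → a k * A (pos k) (pos k) * evaluation r f) + sum (λ k → a k * evaluation r (act A (f ∙ k)))
      ≈⟨ +-cong (sym (D.*-distribʳ-sum (evaluation r f) (λ k → a k * A (pos k) (pos k)))) (later r f h) ⟩
    α A * evaluation r f + natural r * (α A * evaluation r f)
      ≈⟨ solve 2 (λ n x → x :+ n :* x := (:1 :+ n) :* x) refl (natural r) (α A * evaluation r f) ⟩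
    natural (suc r) * (α A * evaluation r f) ∎
    where
    top : ∀ k v → length v ≡ r → act A f ((pos k , k) ∷ v) ≈ A (pos k) (pos k) * f v + 1# * act A (f ∙ k) v
    top k v ≡.refl = +-cong
      (trans (+-congʳ (trans (ΣI-cong λ m → trans (*-congˡ {A (pos k) m} (h ((m , k) ∷ v) ℕₚ.≤-refl)) (zeroʳ _)) ΣI-0)) (+-identityˡ _))
      (sym (*-identityˡ _))
    later : ∀ r f → VanishesFrom (suc r) f →
      sum (λ k → a k * evaluation r (act A (f ∙ k))) ≈ natural r * (α A * evaluation r f)
    later zero    f h = trans (D.sum-0 λ k → zeroʳ (a k)) (sym (zeroˡ _))
    later (suc r) f h = begin
      sum (λ k → a k * evaluation (suc r) (act A (f ∙ k)))
        ≈⟨ D.sum-cong-≋ (λ k → trans (*-congˡ {a k} (evaluation-act A r (f ∙ k) (λ v l → h ((pos k , k) ∷ v) (s≤s l))))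
             (solve 4 (λ x n y p → x :* (n :* (y :* p)) := n :* y :* (x :* p)) refl (a k) (natural (suc r)) (α A) (evaluation r (f ∙ k)))) ⟩
      sum (λ k → natural (suc r) * α A * (a k * evaluation r (f ∙ k)))
        ≈⟨ D.*-distribˡ-sum (natural (suc r) * α A) (λ k → a k * evaluation r (f ∙ k)) ⟨
      natural (suc r) * α A * evaluation (suc r) f
        ≈⟨ *-assoc _ _ _ ⟩
      natural (suc r) * (α A * evaluation (suc r) f) ∎

  -- u has degree at most d, and its symbol of degree d takes the value s at diag(a).
  record Symbol (d : ℕ) (u : UTerm) (s : Carrier) : Set (c Level.⊔ ℓ) where
    constructor symbol
    field
      degree : ∀ r f → VanishesFrom (suc r) f → VanishesFrom (suc (d ℕ.+ r)) (⟦ u ⟧ f)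
      value  : ∀ r f → VanishesFrom (suc r) f →
        evaluation (d ℕ.+ r) (⟦ u ⟧ f) ≈ rising d r * (s * evaluation r f)
  open Symbol public

  symbol-resp : ∀ {d u v s t} → u U.≈ v → s ≈ t → Symbol d u s → Symbol d v t
  symbol-resp {d} e e′ (symbol h q) = symbol
    (λ r f z v l → trans (sym (sound e f v)) (h r f z v l))
    (λ r f z → trans (evaluation-cong (d ℕ.+ r) λ v _ → sym (sound e f v)) (trans (q r f z) (*-congˡ (*-congʳ e′))))

  symbol-+ : ∀ {d u v s t} → Symbol d u s → Symbol d v t → Symbol d (u U.+ v) (s + t)
  symbol-+ {d} {u} {v} {s} {t} (symbol h q) (symbol h′ q′) = symbol
    (λ r f z w l → trans (+-cong (h r f z w l) (h′ r f z w l)) (+-identityˡ 0#))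
    (λ r f z → trans (evaluation-cong (d ℕ.+ r) λ w _ → sym (+-cong (*-identityˡ (⟦ u ⟧ f w)) (*-identityˡ (⟦ v ⟧ f w))))
      (trans (evaluation-linear (d ℕ.+ r) 1# 1# (⟦ u ⟧ f) (⟦ v ⟧ f)) (trans (+-cong (*-congˡ (q r f z)) (*-congˡ (q′ r f z)))
        (solve 4 (λ x s t p → :1 :* (x :* (s :* p)) :+ :1 :* (x :* (t :* p)) := x :* ((s :+ t) :* p)) refl
          (rising d r) s t (evaluation r f)))))

  symbol-neg : ∀ {d u s} → Symbol d u s → Symbol d (U.- u) (- s)
  symbol-neg {d} {u} {s} (symbol h q) = symbol
    (λ r f z w l → trans (-‿cong (h r f z w l)) RP.-0#≈0#)
    (λ r f z → trans (evaluation-cong (d ℕ.+ r) λ w _ → solve 1 (λ x → :- x := (:- :1) :* x :+ :0 :* x) refl (⟦ u ⟧ f w))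
      (trans (evaluation-linear (d ℕ.+ r) (- 1#) 0# (⟦ u ⟧ f) (⟦ u ⟧ f)) (trans (+-cong (*-congˡ (q r f z)) (zeroˡ _))
        (solve 3 (λ x s p → (:- :1) :* (x :* (s :* p)) :+ :0 := x :* ((:- s) :* p)) refl (rising d r) s (evaluation r f)))))

  symbol-0 : ∀ {d} → Symbol d U.0# 0#
  symbol-0 {d} = symbol (λ r f z w l → zeroˡ _) λ r f z → trans
    (evaluation-cong (d ℕ.+ r) λ w _ → solve 1 (λ x → :0 :* x := :0 :* x :+ :0 :* x) refl (f w))
    (trans (evaluation-linear (d ℕ.+ r) 0# 0# f f)
      (solve 3 (λ x y p → :0 :* x :+ :0 :* x := y :* (:0 :* p)) refl (evaluation (d ℕ.+ r) f) (rising d r) (evaluation r f)))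

  symbol-1 : Symbol 0 U.1# 1#
  symbol-1 = symbol (λ r f z w l → trans (*-identityˡ _) (z w l))
    λ r f z → trans (evaluation-cong r λ w _ → *-identityˡ (f w)) (trans (sym (*-identityˡ _)) (sym (*-identityˡ _)))

  symbol-* : ∀ {d e u v s t} → Symbol d u s → Symbol e v t → Symbol (d ℕ.+ e) (u U.* v) (s * t)
  symbol-* {d} {e} {u} {v} {s} {t} (symbol h q) (symbol h′ q′) = symbol
    (λ r f z → ≡.subst (λ n → VanishesFrom (suc n) (⟦ u ⟧ (⟦ v ⟧ f))) (≡.sym (ℕₚ.+-assoc d e r)) (h (e ℕ.+ r) (⟦ v ⟧ f) (h′ r f z)))
    λ r f z → begin
      evaluation (d ℕ.+ e ℕ.+ r) (⟦ u ⟧ (⟦ v ⟧ f))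
        ≡⟨ ≡.cong (λ n → evaluation n (⟦ u ⟧ (⟦ v ⟧ f))) (ℕₚ.+-assoc d e r) ⟩
      evaluation (d ℕ.+ (e ℕ.+ r)) (⟦ u ⟧ (⟦ v ⟧ f))
        ≈⟨ q (e ℕ.+ r) (⟦ v ⟧ f) (h′ r f z) ⟩
      rising d (e ℕ.+ r) * (s * evaluation (e ℕ.+ r) (⟦ v ⟧ f))
        ≈⟨ *-congˡ (*-congˡ (q′ r f z)) ⟩
      rising d (e ℕ.+ r) * (s * (rising e r * (t * evaluation r f)))
        ≈⟨ solve 5 (λ x s y t p → x :* (s :* (y :* (t :* p))) := (x :* y) :* ((s :* t) :* p)) refl
             (rising d (e ℕ.+ r)) s (rising e r) t (evaluation r f) ⟩
      rising d (e ℕ.+ r) * rising e r * (s * t * evaluation r f)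
        ≈⟨ *-congʳ (rising-+ d e r) ⟨
      rising (d ℕ.+ e) r * (s * t * evaluation r f) ∎

  symbol-gen : ∀ {A} (A∈ : 𝔮 A) → Symbol 1 (gen (A , A∈)) (α A)
  symbol-gen {A} A∈ = symbol (λ r f z → vanishes-act A z)
    λ r f z → trans (evaluation-act A r f z) (*-congʳ (sym (*-identityʳ _)))

  symbol-sum : ∀ {d n} {u : Fin n → UTerm} {s : Fin n → Carrier} → (∀ i → Symbol d (u i) (s i)) →
    Symbol d (BigOperators.sum Q.U u) (sum s)
  symbol-sum {n = zero}  e = symbol-0
  symbol-sum {n = suc n} e = symbol-+ (e zero) (symbol-sum (e ∘ suc))

  total : ∀ {n} → (Fin n → ℕ) → ℕ
  total = MonoidSum.sum ℕₚ.+-0-commutativeMonoid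

  -- Splitting the degree of each entry into a row part and a column part gives all terms of the
  -- expansion the same total degree, so their symbols add up to the determinant of the symbols.
  symbol-det : ∀ {n} (d e : Fin n → ℕ) (M : Fin n → Fin n → UTerm) (S : Fin n → Fin n → Carrier) →
    (∀ i j → Symbol (d i ℕ.+ e j) (M i j) (S i j)) → Symbol (total d ℕ.+ total e) (det Q.U M) (det ring S)
  symbol-det {zero}  d e M S h = symbol-1
  symbol-det {suc n} d e M S h = symbol-sum λ j → ≡.subst (λ k → Symbol k (term j) (value-term j)) (degrees j)
    (symbol-* (symbol-* (symbol-power (toℕ j)) (h zero j))
      (symbol-det (d ∘ suc) (e ∘ punchIn j) (λ i k → M (suc i) (punchIn j k)) (λ i k → S (suc i) (punchIn j k))
        λ i k → h (suc i) (punchIn j k)))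
    where
    term : Fin (suc n) → UTerm
    term j = BigOperators._^_ Q.U (U.- U.1#) (toℕ j) U.* M zero j U.* det Q.U (λ i k → M (suc i) (punchIn j k))
    value-term : Fin (suc n) → Carrier
    value-term j = (- 1#) ^ toℕ j * S zero j * det ring (λ i k → S (suc i) (punchIn j k))
    symbol-power : ∀ k → Symbol 0 (BigOperators._^_ Q.U (U.- U.1#) k) ((- 1#) ^ k)
    symbol-power zero    = symbol-1
    symbol-power (suc k) = symbol-* (symbol-neg symbol-1) (symbol-power k)
    degrees : ∀ j → (d zero ℕ.+ e j) ℕ.+ (total (d ∘ suc) ℕ.+ total (e ∘ punchIn j)) ≡ total d ℕ.+ total e
    degrees j = ≡.trans
      (CommSemigroupProps.interchange ℕₚ.+-commutativeSemigroup (d zero) (e j) (total (d ∘ suc)) (total (e ∘ punchIn j)))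
      (≡.cong (total d ℕ.+_) (≡.sym (MonoidSum.sum-remove ℕₚ.+-0-commutativeMonoid {i = j} e)))

  α-F : ∀ i j → α (Q.F i j) ≈ δ i j (a (proj₂ i))
  α-F i j = trans (D.sum-cong-≋ λ k → trans (*-congˡ {a k} (trans (En.F-e i j (pos k) (pos k))
      (+-cong (*-congʳ (reflexive (En.e-sym (pos k) i))) (*-congʳ (reflexive (≡.trans (En.e-sym (pos k) (Q.⁻ i)) (En.e-⁻ i (pos k))))))))
      (trans (distribˡ (a k) _ _) (+-comm _ _)))
    (trans (trans (D.∑-distrib-+ (λ k → a k * (En.e i (neg k) * En.e (pos k) (Q.⁻ j))) (λ k → a k * (En.e i (pos k) * En.e (pos k) j)))
      (+-congʳ (D.sum-cong-≋ λ k → *-congˡ {a k} (*-congˡ (reflexive (≡.sym (En.e-⁻ (pos k) j)))))))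
    (trans (ΣI-cong (λ m → trans (solve 3 (λ x y z → x :* (y :* z) := y :* (x :* z)) refl (a (proj₂ m)) (En.e i m) (En.e m j)) (sym (En.δ-e i m _))))
    (trans (collapse i (λ m → a (proj₂ m) * En.e m j)) (trans (*-comm _ _) (sym (En.δ-e i j _))))))
    where
    neg : Fin N → I
    neg k = Sign.- , k

  -- The symbol of a diagonal entry of `powers n`. For negative i each step changes the sign, which
  -- disappears after an even number of steps; after an odd number the contributions of i and -i
  -- would cancel in the trace.
  trace-symbol : ℕ → I → Carrier
  trace-symbol zero    i = a (proj₂ i)
  trace-symbol (suc n) i = σ ⟪ i ⟫ (a (proj₂ i) * trace-symbol n i)

  symbol-σ : ∀ {d u s} p → Symbol d u s → Symbol d (En.σ p u) (σ p s)
  symbol-σ 0ℙ h = h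
  symbol-σ 1ℙ h = symbol-neg h

  symbol-ΣI : ∀ {d u s} → (∀ m → Symbol d (u m) (s m)) → Symbol d (En.ΣI u) (ΣI s)
  symbol-ΣI h = symbol-+ (symbol-sum λ k → h (Sign.- , k)) (symbol-sum λ k → h (Sign.+ , k))

  symbol-powers : ∀ n i j → Symbol (suc n) (En.powers n i j) (δ i j (trace-symbol n i))
  symbol-powers zero    i j = symbol-resp U.refl (α-F i j) (symbol-gen _)
  symbol-powers (suc n) i j = symbol-resp U.refl
    (trans (ΣI-cong λ m → begin
        σ ⟪ m ⟫ (δ i m A * δ m j (t m))    ≈⟨ σ-cong ⟪ m ⟫ (trans (δ-*ˡ i m A (δ m j (t m))) (δ-cong i m (δ-*ʳ m j A (t m)))) ⟩
        σ ⟪ m ⟫ (δ i m (δ m j (A * t m)))  ≈⟨ δ-σ i m ⟪ m ⟫ (δ m j (A * t m)) ⟩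
        δ i m (σ ⟪ m ⟫ (δ m j (A * t m)))  ∎)
      (trans (collapse i (λ m → σ ⟪ m ⟫ (δ m j (A * t m)))) (δ-σ i j ⟪ i ⟫ (A * t i))))
    (symbol-ΣI λ m → symbol-σ ⟪ m ⟫ (symbol-* (symbol-resp U.refl (α-F i m) (symbol-gen (Q.span-gen (i , m)))) (symbol-powers n m j)))
    where
    A = a (proj₂ i)
    t = trace-symbol n

  moments : ℕ → Carrier
  moments r = sum λ k → (a k + a k) * (a k * a k) ^ r

  trace-symbol-even : ∀ r i → trace-symbol (2 ℕ.* r) i ≈ a (proj₂ i) * (a (proj₂ i) * a (proj₂ i)) ^ r
  trace-symbol-even zero    i = sym (*-identityʳ _)
  trace-symbol-even (suc r) i = trans (reflexive (≡.cong (λ n → trace-symbol n i) (≡.cong suc (ℕₚ.+-suc r (r ℕ.+ 0)))))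
    (trans (square ⟪ i ⟫ (a (proj₂ i)) (trace-symbol (2 ℕ.* r) i)) (trans (*-congˡ (trace-symbol-even r i))
      (solve 2 (λ x p → x :* x :* (x :* p) := x :* (x :* x :* p)) refl (a (proj₂ i)) ((a (proj₂ i) * a (proj₂ i)) ^ r))))
    where
    square : ∀ p x t → σ p (x * σ p (x * t)) ≈ x * x * t
    square 0ℙ x t = sym (*-assoc x x t)
    square 1ℙ x t = solve 2 (λ x t → :- (x :* (:- (x :* t))) := x :* x :* t) refl x t

  symbol-b : ∀ r → Symbol (suc (2 ℕ.* r)) (Q.b (suc r)) (moments r)
  symbol-b r = symbol-resp (U.sym (En.cyclic-trace (2 ℕ.* r)))
    (trans (+-cong (D.sum-cong-≋ λ k → half (Sign.- , k)) (D.sum-cong-≋ λ k → half (Sign.+ , k)))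
      (trans (sym (D.∑-distrib-+ (λ k → a k * (a k * a k) ^ r) (λ k → a k * (a k * a k) ^ r)))
        (D.sum-cong-≋ λ k → sym (distribʳ _ (a k) (a k)))))
    (symbol-ΣI λ i → symbol-powers (2 ℕ.* r) i i)
    where
    half : ∀ i → δ i i (trace-symbol (2 ℕ.* r) i) ≈ a (proj₂ i) * (a (proj₂ i) * a (proj₂ i)) ^ r
    half i = trans (δ-refl i _) (trace-symbol-even r i)

  -- Entry (i , j), counted from 0, has degree 2(i + j) + 1, split as 2i for the row and 2j + 1 for
  -- the column.
  Δ-degree : ℕ
  Δ-degree = total (λ (i : Fin N) → 2 ℕ.* toℕ i) ℕ.+ total (λ (j : Fin N) → suc (2 ℕ.* toℕ j))

  symbol-Δ : Symbol Δ-degree Q.Δ (det ring {N} λ i j → moments (toℕ i ℕ.+ toℕ j))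
  symbol-Δ = symbol-det {N} (λ i → 2 ℕ.* toℕ i) (λ j → suc (2 ℕ.* toℕ j)) (λ i j → Q.b (suc (toℕ i ℕ.+ toℕ j))) (λ i j → moments (toℕ i ℕ.+ toℕ j))
    λ i j → ≡.subst (λ d → Symbol d (Q.b (suc (toℕ i ℕ.+ toℕ j))) (moments (toℕ i ℕ.+ toℕ j)))
      (≡.trans (≡.cong suc (ℕₚ.*-distribˡ-+ 2 (toℕ i) (toℕ j))) (≡.sym (ℕₚ.+-suc (2 ℕ.* toℕ i) (2 ℕ.* toℕ j))))
      (symbol-b (toℕ i ℕ.+ toℕ j))

  -- Zero has symbol 0 in every degree. Comparing with s on the tensor `empty` of degree 0, which
  -- evaluates to 1, gives d! s = 0.
  vanishing-symbol : ∀ {d u s} → Symbol d u s → u U.≈ U.0# → rising d 0 * s ≈ 0#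
  vanishing-symbol {d} {u} {s} h e = begin
    rising d 0 * s                         ≈⟨ *-congˡ (sym (*-identityʳ s)) ⟩
    rising d 0 * (s * evaluation 0 empty)  ≈⟨ value (symbol-resp e refl h) 0 empty vanish ⟨
    evaluation (d ℕ.+ 0) (⟦ U.0# ⟧ empty)  ≈⟨ value (symbol-0 {d}) 0 empty vanish ⟩
    rising d 0 * (0# * evaluation 0 empty) ≈⟨ trans (*-congˡ (zeroˡ _)) (zeroʳ _) ⟩
    0#                                     ∎
    where
    empty : Functional
    empty []      = 1#
    empty (_ ∷ _) = 0#
    vanish : VanishesFrom 1 empty
    vanish (_ ∷ _) _ = refl

-- Nonvanishing by evaluation of the symbol at positive integers

module Nonvanishing {c ℓ} (K : CommutativeRing c ℓ) (n : ℕ) where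
  open CommutativeRing K hiding (zero)
  open BigOperators ring using (sum; product; _^_)
  open Determinant K
  open Hankel K
  open PowerSeries K using (∇*-geometric)
  open RisingFactorials K renaming (natural to ν)
  private
    module RP = RingProps ring
    open SetoidReasoning setoid
    open Solver K

  -- Explicit inverses multiply, so invertibility passes to products over any commutative ring.
  Unit : Carrier → Set (c Level.⊔ ℓ)
  Unit u = ∃[ v ] u * v ≈ 1#

  unit-* : ∀ {u v} → Unit u → Unit v → Unit (u * v)
  unit-* {u} {v} (u′ , e) (v′ , f) = u′ * v′ , trans
    (solve 4 (λ u v u′ v′ → (u :* v) :* (u′ :* v′) := (u :* u′) :* (v :* v′)) refl u v u′ v′)
    (trans (*-cong e f) (*-identityˡ 1#))

  unit-neg : ∀ {u} → Unit u → Unit (- u)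
  unit-neg {u} (u′ , e) = - u′ , trans (solve 2 (λ u u′ → :- u :* :- u′ := u :* u′) refl u u′) e

  unit-resp : ∀ {u v} → u ≈ v → Unit u → Unit v
  unit-resp e (w , f) = w , trans (*-congʳ (sym e)) f

  unit-product : ∀ {n} (f : Fin n → Carrier) → (∀ i → Unit (f i)) → Unit (product f)
  unit-product {zero}  f h = 1# , *-identityˡ 1#
  unit-product {suc n} f h = unit-* (h zero) (unit-product (f ∘ suc) (h ∘ suc))

  unit-power : ∀ k → Unit ((- 1#) ^ k)
  unit-power zero    = 1# , *-identityˡ 1#
  unit-power (suc k) = unit-* (unit-neg (1# , *-identityˡ 1#)) (unit-power k)

  ∇*-moments : ∀ {m k} (y : Row m) (x c : Row k) r →
    ∇* y (λ r → sum λ i → c i * x i ^ r) r ≈ sum λ i → c i * product (λ j → x i - y j) * x i ^ r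
  ∇*-moments {m} {zero}  y x c r = zero-sequence y r
    where
    zero-sequence : ∀ {m} (y : Row m) r → ∇* y (λ _ → 0#) r ≈ 0#
    zero-sequence {zero}  y r = refl
    zero-sequence {suc m} y r = trans (∇*-cong (y ∘ suc) (λ _ → solve 1 (λ y → :0 :- y :* :0 := :0) refl (y zero)) r) (zero-sequence (y ∘ suc) r)
  ∇*-moments {m} {suc k} y x c r = trans
    (∇*-+ y (λ r → c zero * x zero ^ r) (λ r → sum λ i → c (suc i) * x (suc i) ^ r) r)
    (+-cong (∇*-geometric y (c zero) (x zero) r) (∇*-moments y (x ∘ suc) (c ∘ suc) r))
    where
    ∇*-+ : ∀ {m} (y : Row m) s t r → ∇* y (λ r → s r + t r) r ≈ ∇* y s r + ∇* y t r
    ∇*-+ {zero}  y s t r = refl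
    ∇*-+ {suc m} y s t r = trans
      (∇*-cong (y ∘ suc) (λ r → solve 5 (λ y s s′ t t′ → (s′ :+ t′) :- y :* (s :+ t) := (s′ :- y :* s) :+ (t′ :- y :* t)) refl (y zero) (s r) (s (suc r)) (t r) (t (suc r))) r)
      (∇*-+ (y ∘ suc) (∇ (y zero) s) (∇ (y zero) t) r)

  product-zero : ∀ {n} (f : Row n) i → f i ≈ 0# → product f ≈ 0#
  product-zero f zero    e = trans (*-congʳ e) (zeroˡ _)
  product-zero f (suc i) e = trans (*-congˡ (product-zero (f ∘ suc) i e)) (zeroʳ _)

  module _ (a : Fin (suc n) → Carrier)
    (unit-2a : ∀ m → Unit (a m + a m))
    (unit-difference : ∀ {i j} → i ≢ j → Unit (a i * a i - a j * a j)) where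
    private
      x : Row (suc n)
      x i = a i * a i
      s : Seq
      s r = sum λ i → (a i + a i) * x i ^ r

    -- The Hankel evaluation with nodes aᵢ²: the full operator kills every geometric summand, and
    -- omitting node m leaves only the m-th one, with value 2aₘ ∏ (aₘ² - aⱼ²) over j ≠ m.
    det-moments-unit : Unit (det ring {suc n} λ i j → s (toℕ i ℕ.+ toℕ j))
    det-moments-unit = unit-resp (sym (det-hankel x s annihilated))
      (unit-* (unit-power (suc n C 2)) (unit-product (λ m → ∇* (x ∘ punchIn m) s 0) λ m → unit-resp (sym (residue m))
        (unit-* (unit-2a m) (unit-product (λ j → x m - x (punchIn m j)) λ j → unit-difference (Finₚ.punchInᵢ≢i m j ∘ ≡.sym)))))
      where
      annihilated : ∀ k → ∇* x s k ≈ 0#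
      annihilated k = trans (∇*-moments x x (λ i → a i + a i) k) (sum-0 {suc n} λ i → trans
        (*-congʳ {x i ^ k} (trans (*-congˡ {a i + a i} (product-zero (λ j → x i - x j) i (-‿inverseʳ (x i)))) (zeroʳ _))) (zeroˡ _))
      residue : ∀ m → ∇* (x ∘ punchIn m) s 0 ≈ (a m + a m) * product (λ j → x m - x (punchIn m j))
      residue m = begin
        ∇* (x ∘ punchIn m) s 0
          ≈⟨ ∇*-moments (x ∘ punchIn m) x (λ i → a i + a i) 0 ⟩
        sum t
          ≈⟨ MonoidSum.sum-remove +-commutativeMonoid {i = m} t ⟩
        t m + sum (λ i → t (punchIn m i))
          ≈⟨ +-cong (*-identityʳ _) (sum-0 λ i → trans (*-congʳ (trans
               (*-congˡ (product-zero (λ j → x (punchIn m i) - x (punchIn m j)) i (-‿inverseʳ _))) (zeroʳ _))) (zeroˡ _)) ⟩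
        (a m + a m) * product (λ j → x m - x (punchIn m j)) + 0#
          ≈⟨ +-identityʳ _ ⟩
        (a m + a m) * product (λ j → x m - x (punchIn m j)) ∎
        where
        t : Row (suc n)
        t i = (a i + a i) * product (λ j → x i - x (punchIn m j)) * 1#

  private
    module Sy = Symbols K (suc n)
    module Q = Queer K (suc n)

  module _ (1≉0 : ¬ 1# ≈ 0#)
    (unit-natural : ∀ k → Unit (ν (suc k))) where

    ν-+ : ∀ i j → ν (i ℕ.+ j) ≈ ν i + ν j
    ν-+ zero    j = sym (+-identityˡ _)
    ν-+ (suc i) j = trans (+-congˡ (ν-+ i j)) (sym (+-assoc _ _ _))

    -- A difference of squares of positive integers factors as D(2I + D), a product of two positive
    -- integers, where I = i + 1 and D = d + 1.
    unit-square-difference : ∀ i d → Unit (ν (suc i ℕ.+ suc d) * ν (suc i ℕ.+ suc d) - ν (suc i) * ν (suc i))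
    unit-square-difference i d = unit-resp
      (trans (*-cong refl (trans (ν-+ (suc i) (suc i ℕ.+ suc d)) (+-congˡ (ν-+ (suc i) (suc d)))))
        (trans (solve 2 (λ i d → d :* (i :+ (i :+ d)) := (i :+ d) :* (i :+ d) :- i :* i) refl (ν (suc i)) (ν (suc d)))
          (+-congʳ (sym (*-cong (ν-+ (suc i) (suc d)) (ν-+ (suc i) (suc d)))))))
      (unit-* (unit-natural d) (unit-natural (i ℕ.+ (suc i ℕ.+ suc d))))

    -- Distinct positive integers have nonzero doubles and distinct squares, which is what the
    -- Hankel evaluation asks of the nodes.
    point : Fin (suc n) → Carrier
    point i = ν (suc (toℕ i))

    gap : ∀ {i j} → j ℕ.< i → suc j ℕ.+ suc (i ℕ.∸ suc j) ≡ suc i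
    gap {i} {j} l = ≡.trans (ℕₚ.+-suc (suc j) _) (≡.cong suc (ℕₚ.m+[n∸m]≡n l))

    unit-point-difference : ∀ {i j} → i ≢ j → Unit (point i * point i - point j * point j)
    unit-point-difference {i} {j} i≢j with ℕₚ.<-cmp (toℕ i) (toℕ j)
    ... | tri≈ _ e _ = ⊥-elim (i≢j (Finₚ.toℕ-injective e))
    ... | tri> _ _ j<i = ≡.subst (λ k → Unit (ν k * ν k - point j * point j)) (gap j<i)
      (unit-square-difference (toℕ j) (toℕ i ℕ.∸ suc (toℕ j)))
    ... | tri< i<j _ _ = unit-resp (RP.⁻¹-anti-homo‿- (point j * point j) (point i * point i))
      (unit-neg (≡.subst (λ k → Unit (ν k * ν k - point i * point i)) (gap i<j)
        (unit-square-difference (toℕ i) (toℕ j ℕ.∸ suc (toℕ i)))))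

    unit-rising : ∀ d r → Unit (rising d r)
    unit-rising zero    r = 1# , *-identityˡ 1#
    unit-rising (suc d) r = unit-* (unit-natural (d ℕ.+ r)) (unit-rising d r)

    Δ≉0 : ¬ Ring._≈_ Q.U Q.Δ (Ring.0# Q.U)
    Δ≉0 e = 1≉0 (trans (sym (proj₂ inverse)) (trans (*-congʳ (Sy.vanishing-symbol point (Sy.symbol-Δ point) e)) (zeroˡ _)))
      where
      inverse : Unit (rising (Sy.Δ-degree point) 0 * det ring {suc n} λ i j → Sy.moments point (toℕ i ℕ.+ toℕ j))
      inverse = unit-* (unit-rising (Sy.Δ-degree point) 0) (det-moments-unit point
        (λ m → unit-resp (ν-+ (suc (toℕ m)) (suc (toℕ m))) (unit-natural (toℕ m ℕ.+ suc (toℕ m)))) unit-point-difference)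

-- The resultant over the ring of fractions

module FractionResultant {c ℓ} (R : CommutativeRing c ℓ) {n} (Λ : Fin n → CommutativeRing.Carrier R)
  (1≉0 : ¬ CommutativeRing._≈_ R (CommutativeRing.1# R) (CommutativeRing.0# R))
  (regular-x : ∀ i → Fractions.Regular R (MomentDeterminant.x R (Λ i)))
  (regular-y : ∀ i → Fractions.Regular R (MomentDeterminant.y R (Λ i))) where
  open Fractions R
  open MomentDeterminant R using (x; y; factors; double-product-neg)
  open FractionProperties R
  private
    module R = CommutativeRing R
    module F = CommutativeRing fractionRing
    module ∏ = MonoidSum F.*-commutativeMonoid
    module Res = Resultant fractionRing
    ∏ᴿ = λ {k} → BigOperators.product R.ring {k}
    ∏ᶠ = λ {k} → BigOperators.product F.ring {k}
    open SetoidReasoning F.setoid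

    X Y X⁻¹ Y⁻¹ : Fin n → F.Carrier
    X i = fromRing (x (Λ i))
    Y i = fromRing (y (Λ i))
    X⁻¹ i = R.1# / x (Λ i) [ regular-x i ]
    Y⁻¹ i = R.1# / y (Λ i) [ regular-y i ]

    1≉0ᶠ : ¬ F._≈_ F.1# F.0#
    1≉0ᶠ e = 1≉0 (fromRing-injective e)

    X-inverse : ∀ i → X i F.* X⁻¹ i F.≈ F.1#
    X-inverse i = fromRing-inverse (x (Λ i)) (regular-x i)
    Y-inverse : ∀ i → Y i F.* Y⁻¹ i F.≈ F.1#
    Y-inverse i = fromRing-inverse (y (Λ i)) (regular-y i)

  ρ : F.Carrier
  ρ = Res.resultant 1≉0ᶠ X X⁻¹ Y Y⁻¹ X-inverse Y-inverse

  isResultant : Polynomial.IsResultant fractionRing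
    (BigOperators.product (CommutativeRing.ring (Polynomial.polyRing fractionRing)) (Res.factor ∘ X))
    (BigOperators.product (CommutativeRing.ring (Polynomial.polyRing fractionRing)) (Res.factor ∘ Y)) ρ
  isResultant = Res.isResultant 1≉0ᶠ X X⁻¹ Y Y⁻¹ X-inverse Y-inverse

  factorized : R.Carrier
  factorized = (∏ᴿ λ i → ∏ᴿ λ j → Λ i R.+ Λ j)
    R.* (∏ᴿ λ i → ∏ᴿ λ j → if does (i Finₚ.≟ j) then R.1# else Λ i R.- Λ j R.- R.1#)

  -- The resultant produces the differences yₖ - xₘ, the Hankel determinant the residues with xₘ -
  -- yₖ and a sign for each m; `double-product-neg` reconciles the two.
  factorized-resultant : fromRing factorized F.≈ ρ
  factorized-resultant = begin
    fromRing factorized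
      ≈⟨ fromRing-cong (R.trans (double-product-neg (x ∘ Λ) (y ∘ Λ)) (factors Λ)) ⟨
    fromRing (∏ᴿ λ m → ∏ᴿ λ k → y (Λ k) R.- x (Λ m))
      ≈⟨ fromRing-product (λ m → ∏ᴿ λ k → y (Λ k) R.- x (Λ m)) ⟩
    (∏ᶠ λ m → fromRing (∏ᴿ λ k → y (Λ k) R.- x (Λ m)))
      ≈⟨ ∏.sum-cong-≋ (λ m → fromRing-product (λ k → y (Λ k) R.- x (Λ m))) ⟩
    (∏ᶠ λ m → ∏ᶠ λ k → fromRing (y (Λ k) R.- x (Λ m)))
      ≈⟨ ∏.sum-cong-≋ (λ m → ∏.sum-cong-≋ λ k → fromRing-+ (y (Λ k)) (R.- x (Λ m))) ⟩
    (∏ᶠ λ m → ∏ᶠ λ k → Y k F.- X m)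
      ≈⟨ Res.resultant-product 1≉0ᶠ X X⁻¹ Y Y⁻¹ X-inverse Y-inverse ⟨
    ρ ∎

  signed-resultant : ∀ k → fromRing (BigOperators._^_ R.ring (R.- R.1#) k R.* factorized) F.≈
    BigOperators._^_ F.ring (F.- F.1#) k F.* ρ
  signed-resultant k = begin
    fromRing (BigOperators._^_ R.ring (R.- R.1#) k R.* factorized)
      ≈⟨ fromRing-* (BigOperators._^_ R.ring (R.- R.1#) k) factorized ⟩
    fromRing (BigOperators._^_ R.ring (R.- R.1#) k) F.* fromRing factorized
      ≈⟨ F.*-cong (fromRing-power (R.- R.1#) k) factorized-resultant ⟩
    BigOperators._^_ F.ring (F.- F.1#) k F.* ρ ∎

-- Inverses of integers and regularity of the parameters

module CharacteristicZero {c ℓ₁ ℓ₂} (𝕜 : HeytingField c ℓ₁ ℓ₂) (char0 : CharZero 𝕜) where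
  open HeytingField 𝕜 using (_#_; #⇒invertible; #-irrefl)
  K : CommutativeRing c ℓ₁
  K = fieldRing 𝕜
  open CommutativeRing K hiding (zero)
  open RisingFactorials K using (natural)
  open Solver K

  1≉0 : ¬ 1# ≈ 0#
  1≉0 e = #-irrefl (trans (+-identityʳ 1#) e) (char0 0)

  unit-natural : ∀ k → ∃[ v ] natural (suc k) * v ≈ 1#
  unit-natural k with #⇒invertible (char0 k)
  -- Apartness from zero yields an inverse of the difference with `0#`, hence the rewriting of x as
  -- x - 0.
  ... | v , _ , e = v , trans (*-congʳ (trans (multiple (suc k)) (solve 1 (λ x → x := x :- :0) refl _))) e
    where
    multiple : ∀ k → natural k ≈ RawMonoidDefs._×_ +-rawMonoid k 1#
    multiple zero    = refl
    multiple (suc k) = +-congˡ (multiple k)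

  ½ : Carrier
  ½ = proj₁ (unit-natural 1)

  ½+½ : ½ + ½ ≈ 1#
  ½+½ = trans (solve 1 (λ v → v :+ v := (:1 :+ (:1 :+ :0)) :* v) refl ½) (proj₂ (unit-natural 1))

module RegularParameters {c ℓ} (K : CommutativeRing c ℓ) (n : ℕ) where
  private
    module K = CommutativeRing K
    module L = CommutativeRing (MPoly K n)
  open RegularVariables K
  open RegularPolynomials (MPoly K n) using (regular-resp)
  open Fractions (MPoly K n) using (Regular; regular-*)
  open MomentDeterminant (MPoly K n) using (x; y)

  regular-var : ∀ i → Regular (var K {n} i)
  regular-var i {u} {v} = regular-resp (L.trans (L.+-congˡ (constant-0 n)) (L.+-identityʳ _))
    (λ {u v} → regular-var-+ i K.0# {u} {v}) {u} {v}

  regular-x : ∀ i → Regular (x (var K {n} i))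
  regular-x i {u} {v} = regular-* (λ {u v} → regular-var i {u} {v})
    (λ {u v} → regular-resp (L.+-congˡ (L.reflexive (≡.trans (constant-neg n K.1#) (≡.cong L.-_ (constant-1 n)))))
      (λ {u v} → regular-var-+ i (K.- K.1#) {u} {v}) {u} {v}) {u} {v}

  regular-y : ∀ i → Regular (y (var K {n} i))
  regular-y i {u} {v} = regular-* (λ {u v} → regular-var i {u} {v})
    (λ {u v} → regular-resp (L.+-congˡ (L.reflexive (constant-1 n)))
      (λ {u v} → regular-var-+ i K.1# {u} {v}) {u} {v}) {u} {v}

theorem5p8 : ∀ {c ℓ₁ ℓ₂} (𝕜 : HeytingField c ℓ₁ ℓ₂) → CharZero 𝕜 →
    (N : ℕ) → .{{NonZero N}} →
    let K = fieldRing 𝕜 in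
    Queer.Central K N (Queer.Δ K N)
    × (∃[ h ] ∃[ ρ ]
    Queer.HC K N (Queer.Δ K N) h
    × Lambda.IsResultant K N (Lambda.Q K N) (Lambda.P K N) ρ
    × Lambda._≈⟨λ⟩_ K N (Lambda.fromRing K N h) (Lambda.signed K N (Lambda.K⟨λ⟩ K N) ρ)
    × Lambda._≈[λ]_ K N h (Lambda.signed K N (Lambda.K[λ] K N) (Lambda.productFormula K N)))
    × ¬ Ring._≈_ (Queer.U K N) (Queer.Δ K N) (Ring.0# (Queer.U K N))
theorem5p8 𝕜 char0 N =
    Queer.HC.central hc
  , (h , Resultants.ρ , hc , Resultants.isResultant , Resultants.signed-resultant (N C 2)
      , CommutativeRing.refl (MPoly K N))
  , Δ≉0 N
  where
  open CharacteristicZero 𝕜 char0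
  module Parameters = RegularParameters K N
  module Resultants = FractionResultant (MPoly K N) (var K {N}) (RegularVariables.1≉0 K 1≉0 N)
    (λ i {u} {v} → Parameters.regular-x i {u} {v}) (λ i {u} {v} → Parameters.regular-y i {u} {v})
  -- Taking the signed product itself as the image makes the last equation of the theorem
  -- reflexivity; the determinant of the moments enters through `hc`.
  h : CommutativeRing.Carrier (MPoly K N)
  h = Lambda.signed K N (MPoly K N) (Lambda.productFormula K N)
  hc : Queer.HC K N (Queer.Δ K N) h
  hc = HarishChandra.HC-Δ K N ½ ½+½ (MomentDeterminant.det-moments (MPoly K N) (var K {N}))
  Δ≉0 : ∀ N → .{{NonZero N}} → ¬ Ring._≈_ (Queer.U K N) (Queer.Δ K N) (Ring.0# (Queer.U K N))
  Δ≉0 (suc n) = Nonvanishing.Δ≉0 K n 1≉0 unit-natural
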